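{- Let $S_g$ be the orientable surface of fixed genus $g$, and let $\mathcal{X}_{n,6,g}$ be the set of all simple connected $6$-regular graphs with $n$ vertices embeddable on $S_g$. Then $$\lim_{n\to\infty}\left(\sup_{G\in\mathcal{X}_{n,6,g}}\tau(G)^{1/n}\right)\ \le\ \sigma_3^2\ <\ \sigma_6 .$$
   Context: $\tau(G)$ is the number of spanning trees of the graph $G$. For $k\ge3$, $\sigma_k=\dfrac{(k-1)^{k-1}}{(k(k-2))^{k/2-1}}$. -}

module Defs where

open import Data.Empty using (⊥; ⊥-elim)
open import Data.Fin.Base as Fin using (Fin; toℕ)
import Data.Fin.Properties as Fin
open import Data.Integer.Base as ℤ using (+_)
import Data.Integer.Properties as ℤ
open import Data.List.Base using (List; []; _∷_; _++_; _∷ʳ_; map; foldr; filter; length; head; last; allFin; cartesianProduct; cartesianProductWith; deduplicate)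
open import Data.List.Membership.Propositional using (_∈_; find; lose)
import Data.List.Membership.DecPropositional as DecMembership
open import Data.List.Membership.Propositional.Properties using (∈-allFin; ∈-cartesianProductWith⁺; ∈-++⁺ˡ; ∈-++⁺ʳ; ∈-lookup)
open import Data.List.Relation.Unary.All as All using (All; []; _∷_)
open import Data.List.Relation.Unary.AllPairs using ([]; _∷_)
open import Data.List.Relation.Unary.Any using (any?; here; there)
open import Data.List.Relation.Unary.Linked using (Linked; linked?)
open import Data.List.Relation.Unary.Unique.Propositional using (Unique)
import Data.List.Relation.Unary.Unique.DecPropositional as DecUnique
import Data.Maybe.Properties as Maybe
open import Data.Maybe.Base using (just)
open import Data.Nat.Base as ℕ using (ℕ; zero; suc; NonZero)
import Data.Nat.Properties as ℕ
open import Data.Nat.GeneralisedArithmetic using (iterate)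
open import Data.Product.Base using (Σ; ∃; ∃₂; _×_; _,_; proj₁; proj₂; swap)
import Data.Product.Properties as Product
open import Data.Rational.Base as ℚ using (ℚ; 0ℚ; 1ℚ; _/_; *<*; *≤*; mkℚ)
import Data.Rational.Properties as ℚ
import Data.Rational.Solver as ℚSolver
import Data.Rational.Unnormalised.Base as ℚᵘ
import Data.Rational.Unnormalised.Properties as ℚᵘ
open import Data.Sum.Base using (_⊎_; inj₁; inj₂)
open import Data.Vec.Base as Vec using (Vec; []; _∷_)
open import Function.Base using (_∘_)
open import Relation.Binary.Core using (Rel)
open import Relation.Binary.Definitions using (Decidable; DecidableEquality)
open import Relation.Binary.PropositionalEquality using (_≡_; refl; sym; trans; cong; cong₂; subst; subst₂)
open import Relation.Nullary using (Dec; yes; no; ¬_)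
open import Relation.Nullary.Decidable using (map′; ¬?; _×-dec_; _⊎-dec_; _→-dec_)
import Relation.Unary as U
open import Level using (0ℓ)

subsets : ∀ {A : Set} → List A → List (List A)
subsets []       = [] ∷ []
subsets (x ∷ xs) = subsets xs ++ map (x ∷_) (subsets xs)

-- A simple graph with vertex set Fin n is given by its edge set. An edge
-- {u , v} is listed once, as the pair (u , v) with u < v.
EdgeSet : ℕ → Set
EdgeSet n = List (Fin n × Fin n)

completeGraph : ∀ n → EdgeSet n
completeGraph n =
  filter (λ (u , v) → u Fin.<? v) (cartesianProduct (allFin n) (allFin n))

-- Contains every (labelled) simple graph with vertex set Fin n exactly once.
simpleGraphs : ∀ n → List (EdgeSet n)
simpleGraphs n = subsets (completeGraph n)

module _ {n : ℕ} (E : EdgeSet n) where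

  Adj : Rel (Fin n) 0ℓ
  Adj u v = (u , v) ∈ E ⊎ (v , u) ∈ E

  adj? : Decidable Adj
  adj? u v = ((u , v) ∈? E) ⊎-dec ((v , u) ∈? E)
    where open DecMembership (Product.≡-dec Fin._≟_ Fin._≟_) using (_∈?_)

  degree : Fin n → ℕ
  degree v = length (filter (adj? v) (allFin n))

  Regular : ℕ → Set
  Regular k = ∀ v → degree v ≡ k

  IsPath : List (Fin n) → Set
  IsPath p = Unique p × Linked Adj p

  Connected : Set
  Connected = ∀ u v → ∃ λ p → IsPath p × head p ≡ just u × last p ≡ just v

  -- The cycle x, x₁, …, xₘ, x with m ≥ 2 and x, x₁, …, xₘ distinct.
  IsCycle : Fin n → List (Fin n) → Set
  IsCycle x xs = Unique (x ∷ xs) × 2 ℕ.≤ length xs × Linked Adj (x ∷ xs ∷ʳ x)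

  Acyclic : Set
  Acyclic = ∀ x → ¬ ∃ λ xs → IsCycle x xs

  IsTree : Set
  IsTree = Connected × Acyclic

private
  lookup-injective : ∀ {A : Set} {xs : List A} → Unique xs →
    ∀ {i j} → Data.List.Base.lookup xs i ≡ Data.List.Base.lookup xs j → i ≡ j
  lookup-injective (x∉ ∷ u) {Fin.zero}  {Fin.zero}  eq = refl
  lookup-injective (x∉ ∷ u) {Fin.zero}  {Fin.suc j} eq = ⊥-elim (All.lookup x∉ (∈-lookup j) eq)
  lookup-injective (x∉ ∷ u) {Fin.suc i} {Fin.zero}  eq = ⊥-elim (All.lookup x∉ (∈-lookup i) (sym eq))
  lookup-injective (x∉ ∷ u) {Fin.suc i} {Fin.suc j} eq = cong Fin.suc (lookup-injective u eq)

  unique⇒length≤ : ∀ {n} {xs : List (Fin n)} → Unique xs → length xs ℕ.≤ n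
  unique⇒length≤ u = Fin.injective⇒≤ (lookup-injective u)

  listsUpTo : ∀ {n} → ℕ → List (List (Fin n))
  listsUpTo zero    = [] ∷ []
  listsUpTo (suc k) = [] ∷ cartesianProductWith _∷_ (allFin _) (listsUpTo k)

  ∈-listsUpTo : ∀ {n} k (xs : List (Fin n)) → length xs ℕ.≤ k → xs ∈ listsUpTo k
  ∈-listsUpTo zero    []       _         = here refl
  ∈-listsUpTo (suc k) []       _         = here refl
  ∈-listsUpTo (suc k) (x ∷ xs) (ℕ.s≤s l) =
    there (∈-cartesianProductWith⁺ _∷_ (∈-allFin x) (∈-listsUpTo k xs l))

  ∃-from-list? : ∀ {A : Set} {P : A → Set} → U.Decidable P → (xs : List A) →
                 (∀ {x} → P x → x ∈ xs) → Dec (∃ P)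
  ∃-from-list? P? xs complete =
    map′ (λ a → let (x , _ , px) = find a in x , px)
         (λ (x , px) → lose (complete px) px)
         (any? P? xs)

  ∃-unique? : ∀ {n} {P : List (Fin n) → Set} → U.Decidable P →
              (∀ {xs} → P xs → Unique xs) → Dec (∃ P)
  ∃-unique? {n} P? P⇒unique = ∃-from-list? P? (listsUpTo n)
    (λ {xs} px → ∈-listsUpTo n xs (unique⇒length≤ (P⇒unique px)))

  unique? : ∀ {n} → U.Decidable (Unique {A = Fin n})
  unique? = DecUnique.unique? Fin._≟_

module _ {n : ℕ} (E : EdgeSet n) where

  regular? : ∀ k → Dec (Regular E k)
  regular? k = Fin.all? (λ v → degree E v ℕ.≟ k)

  connected? : Dec (Connected E)
  connected? = Fin.all? λ u → Fin.all? λ v → ∃-unique?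
    (λ p → (unique? p ×-dec linked? (adj? E) p)
           ×-dec Maybe.≡-dec Fin._≟_ (head p) (just u)
           ×-dec Maybe.≡-dec Fin._≟_ (last p) (just v))
    (proj₁ ∘ proj₁)

  acyclic? : Dec (Acyclic E)
  acyclic? = Fin.all? λ x → ¬? (∃-unique?
    (λ xs → unique? (x ∷ xs)
            ×-dec (2 ℕ.≤? length xs)
            ×-dec linked? (adj? E) (x ∷ xs ∷ʳ x))
    (λ { ((_ ∷ u) , _) → u }))

  isTree? : Dec (IsTree E)
  isTree? = connected? ×-dec acyclic?

τ : ∀ {n} → EdgeSet n → ℕ
τ E = length (filter isTree? (subsets E))

Orbit : ∀ {A : Set} → (A → A) → ℕ → Rel A 0ℓ
Orbit f b x y = ∃ λ (k : Fin b) → iterate f x (toℕ k) ≡ y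

-- ρ sends a neighbour u of v to the neighbour following u in the cyclic
-- order around v; its values at non-neighbours are junk.
RotationSystem : ℕ → Set
RotationSystem n = Vec (Vec (Fin n) n) n

next : ∀ {n} → RotationSystem n → Fin n → Fin n → Fin n
next ρ v u = Vec.lookup (Vec.lookup ρ v) u

module _ {n : ℕ} (E : EdgeSet n) (ρ : RotationSystem n) where

  -- At every vertex v, next ρ v is a cyclic permutation of the neighbours
  -- of v. (Fewer than n iterations suffice, as v has fewer than n neighbours.)
  IsRotation : Set
  IsRotation = ∀ v u → Adj E v u →
    Adj E v (next ρ v u) × (∀ w → Adj E v w → Orbit (next ρ v) n u w)

  darts : List (Fin n × Fin n)
  darts = E ++ map swap E

  faceStep : Fin n × Fin n → Fin n × Fin n
  faceStep (u , v) = v , next ρ v u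

  SameFace : Rel (Fin n × Fin n) 0ℓ
  SameFace = Orbit faceStep (length darts)

  sameFace? : Decidable SameFace
  sameFace? d e = Fin.any? λ k →
    Product.≡-dec Fin._≟_ Fin._≟_ (iterate faceStep d (toℕ k)) e

  -- The number of faces, i.e. of orbits of faceStep on darts.
  faces : ℕ
  faces = length (deduplicate sameFace? darts)

  -- For connected E with at least one edge: ρ describes a cellular embedding
  -- in the closed orientable surface with Euler characteristic
  -- n - ∣E∣ + faces = 2 - 2h.
  HasGenus : ℕ → Set
  HasGenus h = n ℕ.+ faces ℕ.+ 2 ℕ.* h ≡ length E ℕ.+ 2

-- A connected graph embeds in the orientable surface of genus g if and only
-- if it has a cellular embedding in the one of genus h for some h ≤ g, and
-- cellular embeddings are, up to homeomorphism, rotation systems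
-- (Heffter–Edmonds).
Embeddable : ∀ {n} → ℕ → EdgeSet n → Set
Embeddable g E = ∃ λ ρ → IsRotation E ρ ×
  ∃ λ (h : Fin (suc g)) → HasGenus E ρ (toℕ h)

private
  vectors : ∀ {A : Set} → List A → ∀ k → List (Vec A k)
  vectors xs zero    = [] ∷ []
  vectors xs (suc k) = cartesianProductWith _∷_ xs (vectors xs k)

  ∈-vectors : ∀ {A : Set} {xs : List A} → (∀ x → x ∈ xs) →
              ∀ {k} (v : Vec A k) → v ∈ vectors xs k
  ∈-vectors all []      = here refl
  ∈-vectors all (x ∷ v) = ∈-cartesianProductWith⁺ _∷_ (all x) (∈-vectors all v)

  isRotation? : ∀ {n} (E : EdgeSet n) → U.Decidable (IsRotation E)
  isRotation? E ρ = Fin.all? λ v → Fin.all? λ u → adj? E v u →-dec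
    (adj? E v (next ρ v u) ×-dec Fin.all? λ w → adj? E v w →-dec
      Fin.any? λ k → iterate (next ρ v) u (toℕ k) Fin.≟ w)

embeddable? : ∀ {n} g (E : EdgeSet n) → Dec (Embeddable g E)
embeddable? {n} g E = ∃-from-list?
  (λ ρ → isRotation? E ρ ×-dec Fin.any? λ h → _ ℕ.≟ _)
  (vectors (vectors (allFin n) n) n)
  (λ {ρ} _ → ∈-vectors (∈-vectors ∈-allFin) ρ)

𝒳 : (n k g : ℕ) → List (EdgeSet n)
𝒳 n k g =
  filter (λ E → connected? E ×-dec regular? E k ×-dec embeddable? g E)
         (simpleGraphs n)

open import Algebra.Definitions.RawSemiring ℚ.+-*-rawSemiring
  using () renaming (_^_ to infixr 8 _^ℚ_)

private

  <⇒≱ : ∀ {p q} → p ℚ.< q → ¬ (q ℚ.≤ p)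
  <⇒≱ p<q q≤p = ℚ.<-irrefl refl (ℚ.<-≤-trans p<q q≤p)

  *-mono-≤ : ∀ {a b c d} → 0ℚ ℚ.≤ a → a ℚ.≤ b → 0ℚ ℚ.≤ c → c ℚ.≤ d → a ℚ.* c ℚ.≤ b ℚ.* d
  *-mono-≤ {a} {b} {c} {d} 0≤a a≤b 0≤c c≤d = ℚ.≤-trans
    (ℚ.*-monoʳ-≤-nonNeg c {{ℚ.nonNegative 0≤c}} a≤b)
    (ℚ.*-monoˡ-≤-nonNeg b {{ℚ.nonNegative (ℚ.≤-trans 0≤a a≤b)}} c≤d)

  0≤* : ∀ {a b} → 0ℚ ℚ.≤ a → 0ℚ ℚ.≤ b → 0ℚ ℚ.≤ a ℚ.* b
  0≤* 0≤a 0≤b = *-mono-≤ ℚ.≤-refl 0≤a ℚ.≤-refl 0≤b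

  0≤1 : 0ℚ ℚ.≤ 1ℚ
  0≤1 = ℚ.nonNegative⁻¹ 1ℚ

  0<1 : 0ℚ ℚ.< 1ℚ
  0<1 = ℚ.positive⁻¹ 1ℚ

  p<p+1 : ∀ p → p ℚ.< p ℚ.+ 1ℚ
  p<p+1 p = subst (ℚ._< p ℚ.+ 1ℚ) (ℚ.+-identityʳ p) (ℚ.+-monoʳ-< p 0<1)

  ^-nonNeg : ∀ {x} n → 0ℚ ℚ.≤ x → 0ℚ ℚ.≤ x ^ℚ n
  ^-nonNeg zero    0≤x = 0≤1
  ^-nonNeg (suc n) 0≤x = 0≤* 0≤x (^-nonNeg n 0≤x)

  ^-mono-≤ : ∀ {x y} n → 0ℚ ℚ.≤ x → x ℚ.≤ y → x ^ℚ n ℚ.≤ y ^ℚ n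
  ^-mono-≤ zero    0≤x x≤y = ℚ.≤-refl
  ^-mono-≤ (suc n) 0≤x x≤y = *-mono-≤ 0≤x x≤y (^-nonNeg n 0≤x) (^-mono-≤ n 0≤x x≤y)

  ^-cancel-< : ∀ {x y} n → 0ℚ ℚ.≤ y → x ^ℚ n ℚ.< y ^ℚ n → x ℚ.< y
  ^-cancel-< n 0≤y lt =
    ℚ.≰⇒> (λ y≤x → <⇒≱ lt (^-mono-≤ n 0≤y y≤x))

  1≤^ : ∀ {x} n → 1ℚ ℚ.≤ x → 1ℚ ℚ.≤ x ^ℚ n
  1≤^ zero    1≤x = ℚ.≤-refl
  1≤^ (suc n) 1≤x = *-mono-≤ 0≤1 1≤x 0≤1 (1≤^ n 1≤x)

  x≤^ : ∀ {x} n .{{_ : NonZero n}} → 1ℚ ℚ.≤ x → x ℚ.≤ x ^ℚ n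
  x≤^ {x} (suc n) 1≤x = subst (ℚ._≤ x ℚ.* x ^ℚ n) (ℚ.*-identityʳ x)
    (*-mono-≤ (ℚ.≤-trans 0≤1 1≤x) ℚ.≤-refl 0≤1 (1≤^ n 1≤x))

  0^ : ∀ n .{{_ : NonZero n}} → 0ℚ ^ℚ n ≡ 0ℚ
  0^ (suc n) = ℚ.*-zeroˡ (0ℚ ^ℚ n)

  large : ∀ q n .{{_ : NonZero n}} → ∃ λ B → 0ℚ ℚ.≤ B × q ℚ.< B ^ℚ n
  large q n = B , ℚ.≤-trans 0≤1 1≤B , ℚ.<-≤-trans q<B (x≤^ n 1≤B)
    where
    B = ℚ.∣ q ∣ ℚ.+ 1ℚ
    1≤B : 1ℚ ℚ.≤ B
    1≤B = subst (ℚ._≤ B) (ℚ.+-identityˡ 1ℚ) (ℚ.+-monoˡ-≤ 1ℚ (ℚ.0≤∣p∣ q))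
    q≤∣q∣ : q ℚ.≤ ℚ.∣ q ∣
    q≤∣q∣ with ℚ.≤-total 0ℚ q
    ... | inj₁ 0≤q = ℚ.≤-reflexive (sym (ℚ.0≤p⇒∣p∣≡p 0≤q))
    ... | inj₂ q≤0 = ℚ.≤-trans q≤0 (ℚ.0≤∣p∣ q)
    q<B : q ℚ.< B
    q<B = ℚ.≤-<-trans q≤∣q∣ (p<p+1 ℚ.∣ q ∣)

  -- Powers are Lipschitz on [0 , B].
  lipschitz : ∀ {B} → 0ℚ ℚ.≤ B → ∀ n → ∃ λ K → 0ℚ ℚ.≤ K ×
    (∀ x d → 0ℚ ℚ.≤ x → 0ℚ ℚ.≤ d → x ℚ.+ d ℚ.≤ B →
      (x ℚ.+ d) ^ℚ n ℚ.≤ x ^ℚ n ℚ.+ d ℚ.* K)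
  lipschitz 0≤B zero = 0ℚ , ℚ.≤-refl , λ x d _ _ _ → ℚ.≤-reflexive
    (sym (trans (cong (1ℚ ℚ.+_) (ℚ.*-zeroʳ d)) (ℚ.+-identityʳ 1ℚ)))
  lipschitz {B} 0≤B (suc n) with lipschitz 0≤B n
  ... | K , 0≤K , bound = K′ , 0≤K′ , bound′
    where
    open ℚSolver.+-*-Solver
    K′ = B ^ℚ n ℚ.+ B ℚ.* K
    0≤K′ : 0ℚ ℚ.≤ K′
    0≤K′ = subst (ℚ._≤ K′) (ℚ.+-identityˡ 0ℚ) (ℚ.+-mono-≤ (^-nonNeg n 0≤B) (0≤* 0≤B 0≤K))
    bound′ : ∀ x d → 0ℚ ℚ.≤ x → 0ℚ ℚ.≤ d → x ℚ.+ d ℚ.≤ B →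
      (x ℚ.+ d) ^ℚ suc n ℚ.≤ x ^ℚ suc n ℚ.+ d ℚ.* K′
    bound′ x d 0≤x 0≤d x+d≤B = begin
      y ℚ.* y ^ℚ n                                    ≤⟨ ℚ.*-monoˡ-≤-nonNeg y {{ℚ.nonNegative 0≤y}} (bound x d 0≤x 0≤d x+d≤B) ⟩
      y ℚ.* (x ^ℚ n ℚ.+ d ℚ.* K)                      ≡⟨ solve 4 (λ x d K p → (x :+ d) :* (p :+ d :* K) := x :* p :+ d :* (p :+ (x :+ d) :* K)) refl x d K (x ^ℚ n) ⟩
      x ℚ.* x ^ℚ n ℚ.+ d ℚ.* (x ^ℚ n ℚ.+ y ℚ.* K)     ≤⟨ ℚ.+-monoʳ-≤ (x ℚ.* x ^ℚ n) (ℚ.*-monoˡ-≤-nonNeg d {{ℚ.nonNegative 0≤d}}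
                                                          (ℚ.+-mono-≤ (^-mono-≤ n 0≤x x≤B) (ℚ.*-monoʳ-≤-nonNeg K {{ℚ.nonNegative 0≤K}} x+d≤B))) ⟩
      x ℚ.* x ^ℚ n ℚ.+ d ℚ.* K′                       ∎
      where
      open ℚ.≤-Reasoning
      y = x ℚ.+ d
      x≤y : x ℚ.≤ y
      x≤y = subst (ℚ._≤ y) (ℚ.+-identityʳ x) (ℚ.+-monoʳ-≤ x 0≤d)
      0≤y = ℚ.≤-trans 0≤x x≤y
      x≤B = ℚ.≤-trans x≤y x+d≤B

  fromℕ : ℕ → ℚ
  fromℕ zero    = 0ℚ
  fromℕ (suc m) = fromℕ m ℚ.+ 1ℚ

  0≤fromℕ : ∀ m → 0ℚ ℚ.≤ fromℕ m
  0≤fromℕ zero    = ℚ.≤-refl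
  0≤fromℕ (suc m) = ℚ.≤-trans (0≤fromℕ m) (ℚ.<⇒≤ (p<p+1 (fromℕ m)))

  toℚᵘ-fromℕ : ∀ m → ℚ.toℚᵘ (fromℕ m) ℚᵘ.≃ ℚᵘ.mkℚᵘ (+ m) 0
  toℚᵘ-fromℕ zero    = ℚᵘ.≃-refl
  toℚᵘ-fromℕ (suc m) = ℚᵘ.≃-trans (ℚ.toℚᵘ-homo-+ (fromℕ m) 1ℚ)
    (ℚᵘ.≃-trans (ℚᵘ.+-congˡ ℚᵘ.1ℚᵘ (toℚᵘ-fromℕ m))
      (ℚᵘ.*≡* (cong (ℤ._* + 1) (trans (cong (ℤ._+ + 1) (ℤ.*-identityʳ (+ m))) (ℤ.+-comm (+ m) (+ 1))))))

  archimedean : ∀ p → ∃ λ m → p ℚ.≤ fromℕ m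
  archimedean p@(mkℚ a d _) = ℤ.∣ a ∣ , ℚ.toℚᵘ-cancel-≤
    (ℚᵘ.≤-respʳ-≃ (ℚᵘ.≃-sym (toℚᵘ-fromℕ ℤ.∣ a ∣)) (ℚᵘ.*≤* (subst (ℤ._≤ + ℤ.∣ a ∣ ℤ.* + suc d) (sym (ℤ.*-identityʳ a)) (bound a))))
    where
    bound : ∀ a → a ℤ.≤ + ℤ.∣ a ∣ ℤ.* + suc d
    bound (+ m)       = subst (+ m ℤ.≤_) (ℤ.pos-* m (suc d)) (ℤ.+≤+ (ℕ.m≤m*n m (suc d)))
    bound (ℤ.-[1+ m ]) = ℤ.-≤+

  abstract
    -- Between any two non-negative rationals there is an n-th power.
    dense-^ : ∀ n .{{_ : NonZero n}} {q r} → 0ℚ ℚ.≤ q → q ℚ.< r →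
              ∃ λ c → 0ℚ ℚ.≤ c × q ℚ.< c ^ℚ n × c ^ℚ n ℚ.< r
    dense-^ n {q} {r} 0≤q q<r
      with B , 0≤B , q<Bⁿ ← large q n
      with K , 0≤K , bound ← lipschitz (ℚ.≤-trans 0≤B (ℚ.<⇒≤ (p<p+1 B))) n
      = result (search (proj₁ M) (ℚ.<-≤-trans q<Bⁿ (^-mono-≤ n 0≤B B≤x[M])))
      where
      open ℚSolver.+-*-Solver
      e t δ : ℚ
      e = r ℚ.- q
      0<e : 0ℚ ℚ.< e
      0<e = subst (ℚ._< e) (ℚ.+-inverseʳ q) (ℚ.+-monoˡ-< (ℚ.- q) q<r)
      t = K ℚ.+ 1ℚ ℚ.+ e
      K<t : K ℚ.< t
      K<t = ℚ.<-trans (p<p+1 K)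
        (subst (ℚ._< t) (ℚ.+-identityʳ _) (ℚ.+-monoʳ-< (K ℚ.+ 1ℚ) 0<e))
      0<t : 0ℚ ℚ.< t
      0<t = ℚ.≤-<-trans 0≤K K<t
      e≤t : e ℚ.≤ t
      e≤t = subst (ℚ._≤ t) (ℚ.+-identityˡ e)
        (ℚ.+-monoˡ-≤ e (ℚ.≤-trans 0≤K (ℚ.<⇒≤ (p<p+1 K))))
      instance
        t>0 : ℚ.Positive t
        t>0 = ℚ.positive 0<t
        t≢0 : ℚ.NonZero t
        t≢0 = ℚ.pos⇒nonZero t
        e>0 : ℚ.Positive e
        e>0 = ℚ.positive 0<e
        1/t>0 : ℚ.Positive (ℚ.1/ t)
        1/t>0 = ℚ.1/pos⇒pos t
      δ = e ℚ.* ℚ.1/ t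
      instance
        δ>0 : ℚ.Positive δ
        δ>0 = ℚ.pos*pos⇒pos e (ℚ.1/ t)
        δ≢0 : ℚ.NonZero δ
        δ≢0 = ℚ.pos⇒nonZero δ
        δ≥0 : ℚ.NonNegative δ
        δ≥0 = ℚ.pos⇒nonNeg δ
      0≤δ : 0ℚ ℚ.≤ δ
      0≤δ = ℚ.nonNegative⁻¹ δ
      δt≡e : δ ℚ.* t ≡ e
      δt≡e = trans (ℚ.*-assoc e (ℚ.1/ t) t)
        (trans (cong (e ℚ.*_) (ℚ.*-inverseˡ t)) (ℚ.*-identityʳ e))
      δK<e : δ ℚ.* K ℚ.< e
      δK<e = subst (δ ℚ.* K ℚ.<_) δt≡e (ℚ.*-monoʳ-<-pos δ K<t)
      δ≤1 : δ ℚ.≤ 1ℚ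
      δ≤1 = ℚ.*-cancelʳ-≤-pos t
        (subst₂ ℚ._≤_ (sym δt≡e) (sym (ℚ.*-identityˡ t)) e≤t)
      x : ℕ → ℚ
      x i = fromℕ i ℚ.* δ
      0≤x : ∀ i → 0ℚ ℚ.≤ x i
      0≤x i = 0≤* (0≤fromℕ i) 0≤δ
      x-suc : ∀ i → x (suc i) ≡ x i ℚ.+ δ
      x-suc i = solve 2 (λ a d → (a :+ con 1ℚ) :* d := a :* d :+ d) refl (fromℕ i) δ
      M : ∃ λ m → B ℚ.* ℚ.1/ δ ℚ.≤ fromℕ m
      M = archimedean (B ℚ.* ℚ.1/ δ)
      B≤x[M] : B ℚ.≤ x (proj₁ M)
      B≤x[M] = subst (ℚ._≤ x (proj₁ M))
        (trans (ℚ.*-assoc B (ℚ.1/ δ) δ) (trans (cong (B ℚ.*_) (ℚ.*-inverseˡ δ)) (ℚ.*-identityʳ B)))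
        (ℚ.*-monoʳ-≤-nonNeg δ (proj₂ M))
      search : ∀ m → q ℚ.< x m ^ℚ n → ∃ λ i → x i ^ℚ n ℚ.≤ q × q ℚ.< x (suc i) ^ℚ n
      search zero lt = ⊥-elim (<⇒≱ lt
        (subst (ℚ._≤ q) (sym (trans (cong (_^ℚ n) (ℚ.*-zeroˡ δ)) (0^ n))) 0≤q))
      search (suc m) lt with q ℚ.<? x m ^ℚ n
      ... | yes q<xᵐ = search m q<xᵐ
      ... | no  q≮xᵐ = m , ℚ.≮⇒≥ q≮xᵐ , lt
      result : (∃ λ i → x i ^ℚ n ℚ.≤ q × q ℚ.< x (suc i) ^ℚ n) →
               ∃ λ c → 0ℚ ℚ.≤ c × q ℚ.< c ^ℚ n × c ^ℚ n ℚ.< r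
      result (i , xᵢ≤q , q<xᵢ₊₁) = x (suc i) , 0≤x (suc i) , q<xᵢ₊₁ , (begin-strict
        x (suc i) ^ℚ n            ≡⟨ cong (_^ℚ n) (x-suc i) ⟩
        (x i ℚ.+ δ) ^ℚ n          ≤⟨ bound (x i) δ (0≤x i) 0≤δ (ℚ.+-mono-≤ (ℚ.<⇒≤ xᵢ<B) δ≤1) ⟩
        x i ^ℚ n ℚ.+ δ ℚ.* K      ≤⟨ ℚ.+-monoˡ-≤ (δ ℚ.* K) xᵢ≤q ⟩
        q ℚ.+ δ ℚ.* K             <⟨ ℚ.+-monoʳ-< q δK<e ⟩
        q ℚ.+ e                   ≡⟨ solve 2 (λ q r → q :+ (r :- q) := r) refl q r ⟩
        r                         ∎)
        where
        open ℚ.≤-Reasoning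
        xᵢ<B : x i ℚ.< B
        xᵢ<B = ^-cancel-< n 0≤B (ℚ.≤-<-trans xᵢ≤q q<Bⁿ)

  ^-mono-< : ∀ {x y} n .{{_ : NonZero n}} → 0ℚ ℚ.≤ x → x ℚ.< y → x ^ℚ n ℚ.< y ^ℚ n
  ^-mono-< {x} {y} (suc n) 0≤x x<y = ℚ.≤-<-trans
    (ℚ.*-monoˡ-≤-nonNeg x {{ℚ.nonNegative 0≤x}} (^-mono-≤ n 0≤x (ℚ.<⇒≤ x<y)))
    (ℚ.*-monoˡ-<-pos (y ^ℚ n) {{ℚ.positive (0<^ n)}} x<y)
    where
    0<y = ℚ.≤-<-trans 0≤x x<y
    0<^ : ∀ m → 0ℚ ℚ.< y ^ℚ m
    0<^ zero    = 0<1
    0<^ (suc m) = ℚ.positive⁻¹ _ {{ℚ.pos*pos⇒pos y {{ℚ.positive 0<y}} (y ^ℚ m) {{ℚ.positive (0<^ m)}}}}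

record ℝ≥0 : Set₁ where
  field
    -- L q stands for q < x, and U q for x < q.
    L U      : ℚ → Set
    negative : ∀ {q} → q ℚ.< 0ℚ → L q
    bounded  : ∃ U
    L-down   : ∀ {q r} → q ℚ.< r → L r → L q
    L-open   : ∀ {q} → L q → ∃ λ r → q ℚ.< r × L r
    U-up     : ∀ {q r} → q ℚ.< r → U q → U r
    U-open   : ∀ {r} → U r → ∃ λ q → q ℚ.< r × U q
    disjoint : ∀ {q} → L q → U q → ⊥
    located  : ∀ {q r} → q ℚ.< r → L q ⊎ U r

open ℝ≥0

infix 4 _≤ᴿ_ _<ᴿ_ ∣_-_∣<_
infixr 8 _^ᴿ_
infixl 6 _⊔ᴿ_

_≤ᴿ_ : ℝ≥0 → ℝ≥0 → Set
x ≤ᴿ y = ∀ {q} → L x q → L y q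

_<ᴿ_ : ℝ≥0 → ℝ≥0 → Set
x <ᴿ y = ∃ λ q → U x q × L y q

-- Two reals are less than ε apart if and only if some open interval with
-- rational end points a, b and length less than ε contains both.
∣_-_∣<_ : ℝ≥0 → ℝ≥0 → ℚ → Set
∣ x - y ∣< ε = ∃₂ λ a b →
  b ℚ.- a ℚ.< ε × (L x a × U x b) × (L y a × U y b)

_⟶_ : ((n : ℕ) .{{_ : NonZero n}} → ℝ≥0) → ℝ≥0 → Set
s ⟶ ℓ = ∀ ε → 0ℚ ℚ.< ε →
  ∃ λ N → ∀ n .{{_ : NonZero n}} → N ℕ.≤ n → ∣ s n - ℓ ∣< ε

0ᴿ : ℝ≥0
0ᴿ = record
  { L        = ℚ._< 0ℚ
  ; U        = 0ℚ ℚ.<_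
  ; negative = λ q<0 → q<0
  ; bounded  = 1ℚ , 0<1
  ; L-down   = ℚ.<-trans
  ; L-open   = ℚ.<-dense
  ; U-up     = λ q<r 0<q → ℚ.<-trans 0<q q<r
  ; U-open   = λ 0<r → let (q , 0<q , q<r) = ℚ.<-dense 0<r in q , q<r , 0<q
  ; disjoint = ℚ.<-asym
  ; located  = λ {q} {r} q<r → loc q<r (q ℚ.<? 0ℚ)
  }
  where
  loc : ∀ {q r} → q ℚ.< r → Dec (q ℚ.< 0ℚ) → q ℚ.< 0ℚ ⊎ 0ℚ ℚ.< r
  loc q<r (yes q<0) = inj₁ q<0
  loc q<r (no  q≮0) = inj₂ (ℚ.≤-<-trans (ℚ.≮⇒≥ q≮0) q<r)

_⊔ᴿ_ : ℝ≥0 → ℝ≥0 → ℝ≥0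
x ⊔ᴿ y = record
  { L        = λ q → L x q ⊎ L y q
  ; U        = λ q → U x q × U y q
  ; negative = λ q<0 → inj₁ (negative x q<0)
  ; bounded  = let (a , xa) = bounded x ; (b , yb) = bounded y in common xa yb
  ; L-down   = λ { q<r (inj₁ l) → inj₁ (L-down x q<r l)
                 ; q<r (inj₂ l) → inj₂ (L-down y q<r l) }
  ; L-open   = λ { (inj₁ l) → let (r , q<r , l′) = L-open x l in r , q<r , inj₁ l′
                 ; (inj₂ l) → let (r , q<r , l′) = L-open y l in r , q<r , inj₂ l′ }
  ; U-up     = λ q<r (u , v) → U-up x q<r u , U-up y q<r v
  ; U-open   = λ (u , v) → let (a , a<r , u′) = U-open x u
                               (b , b<r , v′) = U-open y v
                           in open′ a<r b<r u′ v′
  ; disjoint = λ { (inj₁ l) (u , _) → disjoint x l u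
                 ; (inj₂ l) (_ , v) → disjoint y l v }
  ; located  = λ q<r → loc (located x q<r) (located y q<r)
  }
  where
  weaken : ∀ z {a b} → a ℚ.≤ b → U z a → U z b
  weaken z {a} {b} a≤b u with a ℚ.<? b
  ... | yes a<b = U-up z a<b u
  ... | no  a≮b = subst (U z) (ℚ.≤-antisym a≤b (ℚ.≮⇒≥ a≮b)) u
  common : ∀ {a b} → U x a → U y b → ∃ λ c → U x c × U y c
  common {a} {b} u v =
    a ℚ.⊔ b , weaken x (ℚ.p≤p⊔q a b) u , weaken y (ℚ.p≤q⊔p a b) v
  open′ : ∀ {a b r} → a ℚ.< r → b ℚ.< r → U x a → U y b → ∃ λ c → c ℚ.< r × U x c × U y c
  open′ {a} {b} a<r b<r u v with ℚ.≤-total a b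
  ... | inj₁ a≤b = b , b<r , weaken x a≤b u , v
  ... | inj₂ b≤a = a , a<r , u , weaken y b≤a v
  loc : ∀ {A B C D : Set} → A ⊎ B → C ⊎ D → (A ⊎ C) ⊎ (B × D)
  loc (inj₁ a) _        = inj₁ (inj₁ a)
  loc (inj₂ _) (inj₁ c) = inj₁ (inj₂ c)
  loc (inj₂ b) (inj₂ d) = inj₂ (b , d)

-- The supremum in [0 , ∞) of a finite set; that of the empty set is 0.
sup : List ℝ≥0 → ℝ≥0
sup = foldr _⊔ᴿ_ 0ᴿ

-- The n-th root of a, for a ≥ 0 (for a < 0 the definition gives 0).
root : (n : ℕ) .{{_ : NonZero n}} → ℚ → ℝ≥0
root n a = record
  { L        = λ q → 0ℚ ℚ.≤ q → q ^ℚ n ℚ.< a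
  ; U        = λ q → 0ℚ ℚ.< q × a ℚ.< q ^ℚ n
  ; negative = λ q<0 0≤q → ⊥-elim (<⇒≱ q<0 0≤q)
  ; bounded  = bnd
  ; L-down   = λ q<r l 0≤q → ℚ.≤-<-trans (^-mono-≤ n 0≤q (ℚ.<⇒≤ q<r))
                                          (l (ℚ.≤-trans 0≤q (ℚ.<⇒≤ q<r)))
  ; L-open   = λ {q} l → L-op l (0ℚ ℚ.≤? q)
  ; U-up     = λ q<r (0<q , u) → ℚ.<-trans 0<q q<r ,
                 ℚ.<-≤-trans u (^-mono-≤ n (ℚ.<⇒≤ 0<q) (ℚ.<⇒≤ q<r))
  ; U-open   = U-op
  ; disjoint = λ l (0<q , u) → ℚ.<-asym u (l (ℚ.<⇒≤ 0<q))
  ; located  = λ {q} q<r → loc q<r (0ℚ ℚ.≤? q) (q ^ℚ n ℚ.<? a)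
  }
  where
  bnd : ∃ λ q → 0ℚ ℚ.< q × a ℚ.< q ^ℚ n
  bnd with large a n
  ... | B , 0≤B , a<B = B ℚ.+ 1ℚ , ℚ.≤-<-trans 0≤B (p<p+1 B) ,
    ℚ.<-≤-trans a<B (^-mono-≤ n 0≤B (ℚ.<⇒≤ (p<p+1 B)))
  L-op : ∀ {q} → (0ℚ ℚ.≤ q → q ^ℚ n ℚ.< a) → Dec (0ℚ ℚ.≤ q) →
         ∃ λ r → q ℚ.< r × (0ℚ ℚ.≤ r → r ^ℚ n ℚ.< a)
  L-op l (yes 0≤q) with dense-^ n (^-nonNeg n 0≤q) (l 0≤q)
  ... | c , 0≤c , q<c , c<a = c , ^-cancel-< n 0≤c q<c , λ _ → c<a
  L-op l (no  0≰q) with ℚ.<-dense (ℚ.≰⇒> 0≰q)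
  ... | r , q<r , r<0 = r , q<r , λ 0≤r → ⊥-elim (<⇒≱ r<0 0≤r)
  U-op : ∀ {r} → 0ℚ ℚ.< r × a ℚ.< r ^ℚ n → ∃ λ q → q ℚ.< r × 0ℚ ℚ.< q × a ℚ.< q ^ℚ n
  U-op {r} (0<r , a<r) with dense-^ n (ℚ.p≤q⊔p a 0ℚ) a⁺<r
    where
    a⁺<r : a ℚ.⊔ 0ℚ ℚ.< r ^ℚ n
    a⁺<r with ℚ.⊔-sel a 0ℚ
    ... | inj₁ eq = subst (ℚ._< r ^ℚ n) (sym eq) a<r
    ... | inj₂ eq = subst (ℚ._< r ^ℚ n) (trans (0^ n) (sym eq)) (^-mono-< n ℚ.≤-refl 0<r)
  ... | c , 0≤c , a<c , c<r = c , ^-cancel-< n (ℚ.<⇒≤ 0<r) c<r ,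
    ^-cancel-< n 0≤c (subst (ℚ._< c ^ℚ n) (sym (0^ n)) (ℚ.≤-<-trans (ℚ.p≤q⊔p a 0ℚ) a<c)) ,
    ℚ.≤-<-trans (ℚ.p≤p⊔q a 0ℚ) a<c
  loc : ∀ {q r} → q ℚ.< r → Dec (0ℚ ℚ.≤ q) → Dec (q ^ℚ n ℚ.< a) →
        (0ℚ ℚ.≤ q → q ^ℚ n ℚ.< a) ⊎ (0ℚ ℚ.< r × a ℚ.< r ^ℚ n)
  loc q<r (no  0≰q) _         = inj₁ (λ 0≤q → ⊥-elim (0≰q 0≤q))
  loc q<r (yes 0≤q) (yes q<a) = inj₁ (λ _ → q<a)
  loc q<r (yes 0≤q) (no  q≮a) =
    inj₂ (ℚ.≤-<-trans 0≤q q<r , ℚ.≤-<-trans (ℚ.≮⇒≥ q≮a) (^-mono-< n 0≤q q<r))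

_^ᴿ_ : ℝ≥0 → (n : ℕ) .{{_ : NonZero n}} → ℝ≥0
x ^ᴿ n = record
  { L        = λ q → 0ℚ ℚ.≤ q → ∃ λ a → 0ℚ ℚ.≤ a × L x a × q ℚ.< a ^ℚ n
  ; U        = λ q → ∃ λ b → U x b × b ^ℚ n ℚ.< q
  ; negative = λ q<0 0≤q → ⊥-elim (<⇒≱ q<0 0≤q)
  ; bounded  = let (b , u) = bounded x in b ^ℚ n ℚ.+ 1ℚ , b , u , p<p+1 (b ^ℚ n)
  ; L-down   = λ q<r l 0≤q →
      let (a , 0≤a , la , r<a) = l (ℚ.≤-trans 0≤q (ℚ.<⇒≤ q<r))
      in a , 0≤a , la , ℚ.<-trans q<r r<a
  ; L-open   = λ {q} l → L-op l (0ℚ ℚ.≤? q)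
  ; U-up     = λ q<r (b , u , b<q) → b , u , ℚ.<-trans b<q q<r
  ; U-open   = λ (b , u , b<r) →
      let (q , b<q , q<r) = ℚ.<-dense b<r in q , q<r , b , u , b<q
  ; disjoint = λ l (b , u , b<q) →
      let (a , 0≤a , la , q<a) = l (ℚ.≤-trans (^-nonNeg n (U⇒0≤ u)) (ℚ.<⇒≤ b<q))
      in <⇒≱ (ℚ.<-trans b<q q<a) (^-mono-≤ n 0≤a (L⇒≤U la u))
  ; located  = λ {q} q<r → loc q<r (0ℚ ℚ.≤? q)
  }
  where
  U⇒0≤ : ∀ {b} → U x b → 0ℚ ℚ.≤ b
  U⇒0≤ u = ℚ.≮⇒≥ (λ b<0 → disjoint x (negative x b<0) u)
  L⇒≤U : ∀ {a b} → L x a → U x b → a ℚ.≤ b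
  L⇒≤U l u = ℚ.≮⇒≥ (λ b<a → disjoint x l (U-up x b<a u))
  Lₙ Uₙ : ℚ → Set
  Lₙ q = 0ℚ ℚ.≤ q → ∃ λ a → 0ℚ ℚ.≤ a × L x a × q ℚ.< a ^ℚ n
  Uₙ q = ∃ λ b → U x b × b ^ℚ n ℚ.< q
  L-op : ∀ {q} → Lₙ q → Dec (0ℚ ℚ.≤ q) → ∃ λ r → q ℚ.< r × Lₙ r
  L-op l (yes 0≤q) with l 0≤q
  ... | a , 0≤a , la , q<a with ℚ.<-dense q<a
  ...   | r , q<r , r<a = r , q<r , λ _ → a , 0≤a , la , r<a
  L-op l (no  0≰q) with ℚ.<-dense (ℚ.≰⇒> 0≰q)
  ... | r , q<r , r<0 = r , q<r , λ 0≤r → ⊥-elim (<⇒≱ r<0 0≤r)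
  loc : ∀ {q r} → q ℚ.< r → Dec (0ℚ ℚ.≤ q) → Lₙ q ⊎ Uₙ r
  loc q<r (no  0≰q) = inj₁ (λ 0≤q → ⊥-elim (0≰q 0≤q))
  loc q<r (yes 0≤q) with dense-^ n 0≤q q<r
  ... | c , 0≤c , q<c , c<r with dense-^ n 0≤q q<c
  ...   | d , 0≤d , q<d , d<c with located x (^-cancel-< n 0≤c d<c)
  ...     | inj₁ l = inj₁ (λ _ → d , 0≤d , l , q<d)
  ...     | inj₂ u = inj₂ (c , u , c<r)

-- σₖ for k ≥ 3, written as the square root of
-- σₖ² = (k - 1)^(2(k - 1)) / (k(k - 2))^(k - 2).
σ : (k : ℕ) .{{_ : NonZero (k ℕ.∸ 2)}} → ℝ≥0
σ k = root 2 (ℚ._/_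
  (+ ((k ℕ.∸ 1) ℕ.^ (2 ℕ.* (k ℕ.∸ 1))))
  ((k ℕ.* (k ℕ.∸ 2)) ℕ.^ (k ℕ.∸ 2))
  {{denominator≢0 k}})
  where
  denominator≢0 : ∀ k .{{_ : NonZero (k ℕ.∸ 2)}} →
                  NonZero ((k ℕ.* (k ℕ.∸ 2)) ℕ.^ (k ℕ.∸ 2))
  denominator≢0 k@(suc m) =
    ℕ.m^n≢0 (k ℕ.* (m ℕ.∸ 1)) (m ℕ.∸ 1) {{ℕ.m*n≢0 k (m ℕ.∸ 1)}}

τ^1/ : (n : ℕ) .{{_ : NonZero n}} → EdgeSet n → ℝ≥0
τ^1/ n G = root n (+ τ G / 1)

{-# OPTIONS --safe #-}

module Submission where

-- For a random walk with transition matrix P that is killed outside a set of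
-- vertices, det (I - P) is the probability that arrows drawn from P at these
-- vertices form no cycle (the matrix-tree theorem). Eliminating the vertices
-- one by one shows that this determinant can only grow when the walk is lifted
-- to a partial cover: if W covers G at most K times, then D G ^ K ≤ D W.
--
-- By Euler's formula all but boundedly many faces of a 6-regular graph of
-- genus g are triangles, so from almost every dart one can develop an m × m
-- box of the triangular lattice into the graph. These boxes form a partial
-- cover, whence τ(G) ≤ const · A(m) ^ (n / m²), where A(m) counts the acyclic
-- choices of arrows on the box. Conversely the circulant graph with steps
-- 1, m, m + 1 is a triangulation of the torus. It contains n / (m + 1)²
-- disjoint boxes separated by corridors, and fixing the arrows in the
-- corridors gives τ ≥ A(m) ^ (n / (m + 1)²). As m grows the two bounds meet,
-- which determines the limit for g ≥ 1. On the sphere there are no such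
-- graphs.
--
-- The limit is at most A(m) ^ (1 / m²) for every m. This is compared with
-- σ₃² = 16 / 3 by bounding the probability of escaping from a vertex of the
-- box to the vertices before it in lexicographic order by that in a window
-- of five later vertices, 961 / 1092 < 8 / 9.

open import Defs
open import Data.List.Base using (map)
open import Data.Nat.Base using (ℕ; NonZero; zero; suc)
open import Data.Empty using (⊥; ⊥-elim)
open import Data.Fin.Base as Fin using (Fin; zero; toℕ; fromℕ<; suc)
import Data.Fin.Properties as Fin
import Data.List.Membership.DecPropositional as DecMembership
open import Data.List.Membership.Propositional using (_∈_; _∉_; find)
open import Data.List.Membership.Propositional.Properties using (∈-++⁺ˡ; ∈-++⁺ʳ; ∈-++⁻; ∈-map⁺; ∈-∃++; ∈-map⁻; ∈-filter⁺; ∈-filter⁻; ∈-allFin; ∈-cartesianProduct⁺; ∈-cartesianProduct⁻; ∈-upTo⁺; ∈-upTo⁻)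
open import Data.List.Relation.Unary.All as All using (All; []; _∷_)
import Data.List.Relation.Unary.All.Properties as All
open import Data.List.Relation.Unary.AllPairs as AllPairs using (AllPairs; []; _∷_)
open import Data.List.Relation.Unary.Any using (here; there)
open import Data.List.Relation.Unary.Unique.Propositional using (Unique)
import Data.List.Relation.Unary.Unique.Propositional.Properties as Unique
open import Data.Nat.GeneralisedArithmetic using (iterate)
import Data.Nat.Properties as ℕ
open import Data.Product.Base using (∃; ∃₂; _×_; _,_; proj₁; proj₂; swap)
import Data.Rational.Properties as ℚ
open import Data.Sum.Base using (_⊎_; inj₁; inj₂)
open import Function.Base using (_∘_; id)
open import Relation.Binary.Definitions using (DecidableEquality; tri<; tri≈; tri>)
open import Relation.Binary.PropositionalEquality using (_≡_; refl; sym; trans; cong; cong₂; module ≡-Reasoning; subst; subst₂; _≢_)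
open import Relation.Nullary using (yes; no; does; ¬_; Dec; contradiction)
open import Relation.Nullary.Decidable using (¬?; _×-dec_; _⊎-dec_; decidable-stable; from-yes)

-- A graph of genus g need not split into large disjoint boxes, and a box developed into it may even
-- overlap itself. The cover deals with both: nearly every one of the 6n darts gets its own copy of
-- the box, and a vertex lies below at most 6m² points, since such a point is determined by its
-- position in the box and by the dart at the vertex that its frame has become. As 6n / 6m² = n /
-- m², this is as good as a perfect tiling. The estimate has only one direction, because the walk
-- killed at the rim of a box returns less often; the opposite bound calls for a graph in which the
-- boxes really are disjoint.
--
-- No formula for the limit enters. The same numbers A(m) occur in both bounds, with exponents 1 /
-- m² and 1 / (m + 1)² whose ratio tends to 1, and this makes the limit a located cut. All bounds
-- are inequalities between integer powers up to a constant factor, which is lost against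
-- exponential growth as the number of vertices increases.
--
-- The target 8 / 9 comes from 16 / 3 = 6 · 8 / 9: each vertex of a box contributes its six arrows
-- times an escape probability.

module Determinant where

  open import Data.List.Base using (List; []; _∷_; _++_)
  open import Data.List.Relation.Binary.Permutation.Propositional as Perm using (_↭_; prep)
  open import Data.Rational.Base using (ℚ; 0ℚ; 1ℚ; _+_; _*_; _-_)
  open import Data.Rational.Solver using (module +-*-Solver)
  open +-*-Solver

  -- The determinant of I - p under rank-one updates.

  Matrix : Set → Set
  Matrix V = V → V → ℚ

  infixl 6 _⊕_⊗_

  _⊕_⊗_ : ∀ {V} → Matrix V → (V → ℚ) → (V → ℚ) → Matrix V
  (p ⊕ u ⊗ a) x y = p x y + u x * a y

  row col : ∀ {V} → V → Matrix V → V → ℚ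
  row v p y = p v y
  col v p x = p x v

  -- D vs p is the determinant of the restriction of I - p to the rows and
  -- columns vs, expanded along the first of them.
  D : ∀ {V} → List V → Matrix V → ℚ
  D []       p = 1ℚ
  D (v ∷ vs) p = D vs (p ⊕ col v p ⊗ row v p) - p v v * D vs p

  D-cong : ∀ {V} (vs : List V) {p p′ : Matrix V} →
           (∀ {x y} → x ∈ vs → y ∈ vs → p x y ≡ p′ x y) → D vs p ≡ D vs p′
  D-cong []       eq = refl
  D-cong (v ∷ vs) eq = cong₂ _-_
    (D-cong vs λ x y → cong₂ _+_ (eq (there x) (there y)) (cong₂ _*_ (eq (there x) (here refl)) (eq (here refl) (there y))))
    (cong₂ _*_ (eq (here refl) (here refl)) (D-cong vs λ x y → eq (there x) (there y)))

  D-≗ : ∀ {V} (vs : List V) {p p′ : Matrix V} → (∀ x y → p x y ≡ p′ x y) → D vs p ≡ D vs p′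
  D-≗ vs eq = D-cong vs λ {x} {y} _ _ → eq x y

  D-transpose : ∀ {V} (vs : List V) (p : Matrix V) → D vs (λ x y → p y x) ≡ D vs p
  D-transpose []       p = refl
  D-transpose (v ∷ vs) p = cong₂ (λ s t → s - p v v * t)
    (trans (D-≗ vs λ x y → cong (p y x +_) (ℚ.*-comm (p v x) (p y v)))
           (D-transpose vs (p ⊕ col v p ⊗ row v p)))
    (D-transpose vs p)

  -- A rank-one update changes a determinant by a form that is bilinear in the column `u` and the
  -- row `a`. Linearity in `a` is proved by induction along the list and linearity in `u` then
  -- follows by transposition; the induction step uses both for the tail.
  Affineʳ : ∀ {V} → List V → Set
  Affineʳ {V} vs = ∀ (p : Matrix V) u a b s t →
    D vs (p ⊕ u ⊗ λ y → s * a y + t * b y) ≡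
    D vs p + s * (D vs (p ⊕ u ⊗ a) - D vs p) + t * (D vs (p ⊕ u ⊗ b) - D vs p)

  Affineˡ : ∀ {V} → List V → Set
  Affineˡ {V} vs = ∀ (p : Matrix V) u w a s t →
    D vs (p ⊕ (λ x → s * u x + t * w x) ⊗ a) ≡
    D vs p + s * (D vs (p ⊕ u ⊗ a) - D vs p) + t * (D vs (p ⊕ w ⊗ a) - D vs p)

  affineʳ⇒affineˡ : ∀ {V} (vs : List V) → Affineʳ vs → Affineˡ vs
  affineʳ⇒affineˡ vs aff p u w a s t = begin
    D vs (p ⊕ (λ x → s * u x + t * w x) ⊗ a) ≡⟨ flip-⊗ _ ⟨
    D vs (pᵀ ⊕ a ⊗ (λ x → s * u x + t * w x)) ≡⟨ aff pᵀ a u w s t ⟩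
    D vs pᵀ + s * (D vs (pᵀ ⊕ a ⊗ u) - D vs pᵀ) + t * (D vs (pᵀ ⊕ a ⊗ w) - D vs pᵀ)
      ≡⟨ cong₂ (λ d e → d + s * (e - d) + t * (D vs (pᵀ ⊕ a ⊗ w) - d)) (D-transpose vs p) (flip-⊗ u) ⟩
    D vs p + s * (D vs (p ⊕ u ⊗ a) - D vs p) + t * (D vs (pᵀ ⊕ a ⊗ w) - D vs p)
      ≡⟨ cong (λ e → D vs p + s * (D vs (p ⊕ u ⊗ a) - D vs p) + t * (e - D vs p)) (flip-⊗ w) ⟩
    D vs p + s * (D vs (p ⊕ u ⊗ a) - D vs p) + t * (D vs (p ⊕ w ⊗ a) - D vs p) ∎
    where
    open ≡-Reasoning
    pᵀ = λ x y → p y x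
    flip-⊗ : ∀ u → D vs (pᵀ ⊕ a ⊗ u) ≡ D vs (p ⊕ u ⊗ a)
    flip-⊗ u = trans (D-≗ vs λ x y → cong (p y x +_) (ℚ.*-comm (a x) (u y))) (D-transpose vs (p ⊕ u ⊗ a))

  module _ {V} (vs : List V) (affʳ : Affineʳ vs) where

    private
      affˡ : Affineˡ vs
      affˡ = affineʳ⇒affineˡ vs affʳ

      B : Matrix V → (V → ℚ) → (V → ℚ) → ℚ
      B p u a = D vs (p ⊕ u ⊗ a) - D vs p

    private
      addʳ : ∀ p u a b c → D vs (p ⊕ u ⊗ (λ y → a y + c * b y)) ≡
             D vs (p ⊕ u ⊗ a) + c * (D vs (p ⊕ u ⊗ b) - D vs p)
      addʳ p u a b c = begin
        D vs (p ⊕ u ⊗ (λ y → a y + c * b y)) ≡⟨ D-≗ vs (λ x y → cong (λ t → p x y + u x * (t + c * b y)) (sym (ℚ.*-identityˡ (a y)))) ⟩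
        D vs (p ⊕ u ⊗ (λ y → 1ℚ * a y + c * b y)) ≡⟨ affʳ p u a b 1ℚ c ⟩
        D vs p + 1ℚ * B p u a + c * B p u b ≡⟨ solve 4 (λ d e f c → d :+ con 1ℚ :* (e :- d) :+ c :* f := e :+ c :* f) refl (D vs p) (D vs (p ⊕ u ⊗ a)) (B p u b) c ⟩
        D vs (p ⊕ u ⊗ a) + c * B p u b ∎
        where open ≡-Reasoning

      addˡ : ∀ p u w a c → D vs (p ⊕ (λ x → u x + c * w x) ⊗ a) ≡
             D vs (p ⊕ u ⊗ a) + c * (D vs (p ⊕ w ⊗ a) - D vs p)
      addˡ p u w a c = begin
        D vs (p ⊕ (λ x → u x + c * w x) ⊗ a) ≡⟨ D-≗ vs (λ x y → cong (λ t → p x y + (t + c * w x) * a y) (sym (ℚ.*-identityˡ (u x)))) ⟩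
        D vs (p ⊕ (λ x → 1ℚ * u x + c * w x) ⊗ a) ≡⟨ affˡ p u w a 1ℚ c ⟩
        D vs p + 1ℚ * B p u a + c * B p w a ≡⟨ solve 4 (λ d e f c → d :+ con 1ℚ :* (e :- d) :+ c :* f := e :+ c :* f) refl (D vs p) (D vs (p ⊕ u ⊗ a)) (B p w a) c ⟩
        D vs (p ⊕ u ⊗ a) + c * B p w a ∎
        where open ≡-Reasoning

      mergeʳ : ∀ p u a b → D vs (p ⊕ u ⊗ a ⊕ u ⊗ b) ≡ D vs (p ⊕ u ⊗ a) + B p u b
      mergeʳ p u a b = trans
        (D-≗ vs λ x y → solve 4 (λ p u a b → p :+ u :* a :+ u :* b := p :+ u :* (a :+ con 1ℚ :* b)) refl (p x y) (u x) (a y) (b y))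
        (trans (addʳ p u a b 1ℚ) (cong (D vs (p ⊕ u ⊗ a) +_) (ℚ.*-identityˡ _)))

      mergeˡ : ∀ p u w a → D vs (p ⊕ u ⊗ a ⊕ w ⊗ a) ≡ D vs (p ⊕ u ⊗ a) + B p w a
      mergeˡ p u w a = trans
        (D-≗ vs λ x y → solve 4 (λ p u w a → p :+ u :* a :+ w :* a := p :+ (u :+ con 1ℚ :* w) :* a) refl (p x y) (u x) (w x) (a y))
        (trans (addˡ p u w a 1ℚ) (cong (D vs (p ⊕ u ⊗ a) +_) (ℚ.*-identityˡ _)))

    -- The right-hand side shows that the determinant with one more row and
    -- column is again affine in a.
    D-∷-⊕ : ∀ v p u a → let w = col v p ; b = row v p in
      D (v ∷ vs) (p ⊕ u ⊗ a) ≡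
        D vs (p ⊕ w ⊗ b ⊕ u ⊗ a)
        + a v * (D vs (p ⊕ u ⊗ b) - D vs p)
        + u v * (D vs (p ⊕ w ⊗ a) - D vs p)
        - p v v * D vs (p ⊕ u ⊗ a)
        - u v * a v * D vs p
    D-∷-⊕ v p u a = begin
      D vs (p₁ ⊕ (λ x → w x + u x * a v) ⊗ (λ y → b y + u v * a y)) - (p v v + u v * a v) * D vs p₁
        ≡⟨ cong (_- (p v v + u v * a v) * D vs p₁) expand ⟩
      (d + av * (dub - dp)) + uv * (dwa - dp + av * (dua - dp)) - (pvv + uv * av) * dua
        -- The product `uv * av * dua`, quadratic in `a`, occurs with both signs and cancels.
        ≡⟨ solve 8 (λ d dub dwa dua dp pvv uv av →
             (d :+ av :* (dub :- dp)) :+ uv :* (dwa :- dp :+ av :* (dua :- dp)) :- (pvv :+ uv :* av) :* dua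
             := d :+ av :* (dub :- dp) :+ uv :* (dwa :- dp) :- pvv :* dua :- uv :* av :* dp)
             refl d dub dwa dua dp pvv uv av ⟩
      _ ∎
      where
      open ≡-Reasoning
      w = col v p
      b = row v p
      p₁ = p ⊕ u ⊗ a
      w′ = λ x → w x + a v * u x
      pvv = p v v
      uv = u v
      av = a v
      d   = D vs (p ⊕ w ⊗ b ⊕ u ⊗ a)
      dub = D vs (p ⊕ u ⊗ b)
      dwa = D vs (p ⊕ w ⊗ a)
      dua = D vs (p ⊕ u ⊗ a)
      dp  = D vs p
      e₁ : D vs (p₁ ⊕ w ⊗ b) ≡ d
      e₁ = D-≗ vs λ x y → solve 3 (λ p s t → p :+ s :+ t := p :+ t :+ s) refl (p x y) (u x * a y) (w x * b y)
      e₂ : D vs (p₁ ⊕ w′ ⊗ b) ≡ d + av * (dub - dp)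
      e₂ = begin
        D vs (p₁ ⊕ w′ ⊗ b) ≡⟨ addˡ p₁ w u b av ⟩
        D vs (p₁ ⊕ w ⊗ b) + av * (D vs (p₁ ⊕ u ⊗ b) - D vs p₁) ≡⟨ cong₂ (λ s t → s + av * (t - D vs p₁)) e₁ (mergeʳ p u a b) ⟩
        d + av * (dua + (dub - dp) - dua) ≡⟨ cong (λ t → d + av * t) (solve 2 (λ s t → s :+ t :- s := t) refl dua (dub - dp)) ⟩
        d + av * (dub - dp) ∎
      e₃ : D vs (p₁ ⊕ w′ ⊗ a) - dua ≡ dwa - dp + av * (dua - dp)
      e₃ = begin
        D vs (p₁ ⊕ w′ ⊗ a) - dua ≡⟨ cong (_- dua) (mergeˡ p u w′ a) ⟩
        dua + (D vs (p ⊕ w′ ⊗ a) - dp) - dua ≡⟨ cong (λ t → dua + (t - dp) - dua) (addˡ p w u a av) ⟩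
        dua + (dwa + av * (dua - dp) - dp) - dua ≡⟨ solve 4 (λ dua dwa av dp → dua :+ (dwa :+ av :* (dua :- dp) :- dp) :- dua := dwa :- dp :+ av :* (dua :- dp)) refl dua dwa av dp ⟩
        dwa - dp + av * (dua - dp) ∎
      expand : D vs (p₁ ⊕ (λ x → w x + u x * a v) ⊗ (λ y → b y + u v * a y)) ≡
               (d + av * (dub - dp)) + uv * (dwa - dp + av * (dua - dp))
      expand = begin
        D vs (p₁ ⊕ (λ x → w x + u x * a v) ⊗ (λ y → b y + u v * a y))
          ≡⟨ D-≗ vs (λ x y → cong (λ t → p₁ x y + (w x + t) * (b y + u v * a y)) (ℚ.*-comm (u x) (a v))) ⟩
        D vs (p₁ ⊕ w′ ⊗ (λ y → b y + uv * a y))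
          ≡⟨ addʳ p₁ w′ b a uv ⟩
        D vs (p₁ ⊕ w′ ⊗ b) + uv * (D vs (p₁ ⊕ w′ ⊗ a) - D vs p₁)
          ≡⟨ cong₂ (λ s t → s + uv * t) e₂ e₃ ⟩
        (d + av * (dub - dp)) + uv * (dwa - dp + av * (dua - dp)) ∎

  affineʳ : ∀ {V} (vs : List V) → Affineʳ vs
  affineʳ [] p u a b s t = solve 2 (λ s t → con 1ℚ := con 1ℚ :+ s :* (con 1ℚ :- con 1ℚ) :+ t :* (con 1ℚ :- con 1ℚ)) refl s t
  affineʳ (v ∷ vs) p u a b s t = begin
    D (v ∷ vs) (p ⊕ u ⊗ c)
      ≡⟨ D-∷-⊕ vs aff v p u c ⟩
    D vs (q ⊕ u ⊗ c) + c v * dub′ + u v * (D vs (p ⊕ w ⊗ c) - dp) - p v v * D vs (p ⊕ u ⊗ c) - u v * c v * dp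
      ≡⟨ cong₂ (λ k l → k + c v * dub′ + u v * (D vs (p ⊕ w ⊗ c) - dp) - p v v * l - u v * c v * dp) (aff q u a b s t) (aff p u a b s t) ⟩
    qc + c v * dub′ + u v * (D vs (p ⊕ w ⊗ c) - dp) - p v v * pc - u v * c v * dp
      ≡⟨ cong (λ k → qc + c v * dub′ + u v * (k - dp) - p v v * pc - u v * c v * dp) (aff p w a b s t) ⟩
    qc + c v * dub′ + u v * (wc - dp) - p v v * pc - u v * c v * dp
      ≡⟨ solve 15 (λ dq dqa dqb av bv s t d uv dp dwa dwb dua dub pvv →
          (dq :+ s :* (dqa :- dq) :+ t :* (dqb :- dq)) :+ (s :* av :+ t :* bv) :* d
            :+ uv :* (dp :+ s :* (dwa :- dp) :+ t :* (dwb :- dp) :- dp)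
            :- pvv :* (dp :+ s :* (dua :- dp) :+ t :* (dub :- dp)) :- uv :* (s :* av :+ t :* bv) :* dp
          := dq :- pvv :* dp
            :+ s :* (dqa :+ av :* d :+ uv :* (dwa :- dp) :- pvv :* dua :- uv :* av :* dp :- (dq :- pvv :* dp))
            :+ t :* (dqb :+ bv :* d :+ uv :* (dwb :- dp) :- pvv :* dub :- uv :* bv :* dp :- (dq :- pvv :* dp)))
          refl (D vs q) (D vs (q ⊕ u ⊗ a)) (D vs (q ⊕ u ⊗ b)) (a v) (b v) s t dub′ (u v) dp
          (D vs (p ⊕ w ⊗ a)) (D vs (p ⊕ w ⊗ b)) (D vs (p ⊕ u ⊗ a)) (D vs (p ⊕ u ⊗ b)) (p v v) ⟩
    D₀ + s * (Eₐ - D₀) + t * (E_b - D₀)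
      ≡⟨ cong₂ (λ k l → D₀ + s * (k - D₀) + t * (l - D₀)) (D-∷-⊕ vs aff v p u a) (D-∷-⊕ vs aff v p u b) ⟨
    D₀ + s * (D (v ∷ vs) (p ⊕ u ⊗ a) - D₀) + t * (D (v ∷ vs) (p ⊕ u ⊗ b) - D₀) ∎
    where
    open ≡-Reasoning
    aff : Affineʳ vs
    aff = affineʳ vs
    c = λ y → s * a y + t * b y
    w = col v p
    r = row v p
    q = p ⊕ w ⊗ r
    dp = D vs p
    dub′ = D vs (p ⊕ u ⊗ r) - dp
    D₀ = D (v ∷ vs) p
    Eₐ E_b qc pc wc : ℚ
    Eₐ = D vs (q ⊕ u ⊗ a) + a v * dub′ + u v * (D vs (p ⊕ w ⊗ a) - dp) - p v v * D vs (p ⊕ u ⊗ a) - u v * a v * dp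
    E_b = D vs (q ⊕ u ⊗ b) + b v * dub′ + u v * (D vs (p ⊕ w ⊗ b) - dp) - p v v * D vs (p ⊕ u ⊗ b) - u v * b v * dp
    qc = D vs q + s * (D vs (q ⊕ u ⊗ a) - D vs q) + t * (D vs (q ⊕ u ⊗ b) - D vs q)
    pc = dp + s * (D vs (p ⊕ u ⊗ a) - dp) + t * (D vs (p ⊕ u ⊗ b) - dp)
    wc = dp + s * (D vs (p ⊕ w ⊗ a) - dp) + t * (D vs (p ⊕ w ⊗ b) - dp)

  D-scale : ∀ {V} (vs : List V) p u a s → D vs (p ⊕ u ⊗ (λ y → s * a y)) ≡ D vs p + s * (D vs (p ⊕ u ⊗ a) - D vs p)
  D-scale vs p u a s = begin
    D vs (p ⊕ u ⊗ (λ y → s * a y)) ≡⟨ D-≗ vs (λ x y → cong (λ t → p x y + u x * t) (solve 2 (λ k l → k := k :+ con 0ℚ :* l) refl (s * a y) (a y))) ⟩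
    D vs (p ⊕ u ⊗ (λ y → s * a y + 0ℚ * a y)) ≡⟨ affineʳ vs p u a a s 0ℚ ⟩
    D vs p + s * (D vs (p ⊕ u ⊗ a) - D vs p) + 0ℚ * (D vs (p ⊕ u ⊗ a) - D vs p) ≡⟨ solve 3 (λ k l m → k :+ l :+ con 0ℚ :* m := k :+ l) refl (D vs p) (s * (D vs (p ⊕ u ⊗ a) - D vs p)) (D vs (p ⊕ u ⊗ a) - D vs p) ⟩
    D vs p + s * (D vs (p ⊕ u ⊗ a) - D vs p) ∎
    where open ≡-Reasoning

  -- By `D-∷-⊕` both sides become the same expression in minors over `vs`, up to the order of two
  -- rank-one updates. Together with `D-↭` this leaves the order of elimination free in everything
  -- that follows.
  D-swap : ∀ {V} v w (vs : List V) p → D (v ∷ w ∷ vs) p ≡ D (w ∷ v ∷ vs) p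
  D-swap v w vs p = begin
    D (v ∷ w ∷ vs) p
      ≡⟨ cong (_- p v v * (q - p w w * d)) (D-∷-⊕ vs (affineʳ vs) w p (col v p) (row v p)) ⟩
    D vs (p ⊕ col w p ⊗ row w p ⊕ col v p ⊗ row v p) + pvw * (vw - d) + pwv * (wv - d) - pww * r - pwv * pvw * d - pvv * (q - pww * d)
      ≡⟨ cong (λ k → k + pvw * (vw - d) + pwv * (wv - d) - pww * r - pwv * pvw * d - pvv * (q - pww * d))
           (D-≗ vs λ x y → solve 3 (λ p s t → p :+ s :+ t := p :+ t :+ s) refl (p x y) (p x w * p w y) (p x v * p v y)) ⟩
    e + pvw * (vw - d) + pwv * (wv - d) - pww * r - pwv * pvw * d - pvv * (q - pww * d)
      ≡⟨ solve 10 (λ e pvw pwv pvv pww vw wv q r d →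
           e :+ pvw :* (vw :- d) :+ pwv :* (wv :- d) :- pww :* r :- pwv :* pvw :* d :- pvv :* (q :- pww :* d)
           := e :+ pwv :* (wv :- d) :+ pvw :* (vw :- d) :- pvv :* q :- pvw :* pwv :* d :- pww :* (r :- pvv :* d))
           refl e pvw pwv pvv pww vw wv q r d ⟩
    e + pwv * (wv - d) + pvw * (vw - d) - pvv * q - pvw * pwv * d - pww * (r - pvv * d)
      ≡⟨ cong (_- p w w * (r - p v v * d)) (D-∷-⊕ vs (affineʳ vs) v p (col w p) (row w p)) ⟨
    D (w ∷ v ∷ vs) p ∎
    where
    open ≡-Reasoning
    pvw = p v w
    pwv = p w v
    pvv = p v v
    pww = p w w
    d = D vs p
    e = D vs (p ⊕ col v p ⊗ row v p ⊕ col w p ⊗ row w p)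
    vw = D vs (p ⊕ col v p ⊗ row w p)
    wv = D vs (p ⊕ col w p ⊗ row v p)
    q = D vs (p ⊕ col w p ⊗ row w p)
    r = D vs (p ⊕ col v p ⊗ row v p)

  D-∷-cong : ∀ {V} (v : V) (vs ws : List V) → (∀ p → D vs p ≡ D ws p) → ∀ p → D (v ∷ vs) p ≡ D (v ∷ ws) p
  D-∷-cong v vs ws eq p = cong₂ (λ s t → s - p v v * t) (eq _) (eq p)

  D-↭ : ∀ {V} {vs ws : List V} → vs ↭ ws → ∀ p → D vs p ≡ D ws p
  D-↭ Perm.refl         p = refl
  D-↭ (prep {xs} {ys} v σ) p = D-∷-cong v xs ys (D-↭ σ) p
  D-↭ (Perm.swap {xs} {ys} v w σ) p =
    trans (D-swap v w xs p) (D-∷-cong w (v ∷ xs) (v ∷ ys) (D-∷-cong v xs ys (D-↭ σ)) p)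
  D-↭ (Perm.trans σ τ)  p = trans (D-↭ σ p) (D-↭ τ p)

  D-map : ∀ {V W : Set} (g : V → W) vs (p : Matrix W) → D (Data.List.Base.map g vs) p ≡ D vs (λ x y → p (g x) (g y))
  D-map g []       p = refl
  D-map g (v ∷ vs) p = cong₂ (λ s t → s - p (g v) (g v) * t) (D-map g vs _) (D-map g vs p)

  D-++ : ∀ {V} (vs ws : List V) p →
         (∀ {x y} → x ∈ vs → y ∈ ws → p x y ≡ 0ℚ) → (∀ {x y} → x ∈ ws → y ∈ vs → p x y ≡ 0ℚ) →
         D (vs ++ ws) p ≡ D vs p * D ws p
  D-++ []       ws p _  _  = sym (ℚ.*-identityˡ _)
  D-++ (v ∷ vs) ws p z₁ z₂ = begin
    D (vs ++ ws) q - p v v * D (vs ++ ws) p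
      ≡⟨ cong₂ (λ s t → s - p v v * t)
           (D-++ vs ws q (λ {x} x∈ y → zero+0* (z₁ (there x∈) y) (inj₂′ {a = p x v} {b = p v _} (z₁ (here refl) y))) (λ x y → zero+0* (z₂ x (there y)) (inj₁′ (z₂ x (here refl)))))
           (D-++ vs ws p (λ x → z₁ (there x)) (λ x y → z₂ x (there y))) ⟩
    D vs q * D ws q - p v v * (D vs p * D ws p)
      ≡⟨ cong (λ k → D vs q * k - p v v * (D vs p * D ws p))
           (D-cong ws λ {x} {y} x∈ _ → trans (cong (p x y +_) (inj₁′ {b = p v y} (z₂ x∈ (here refl)))) (ℚ.+-identityʳ (p x y))) ⟩
    D vs q * D ws p - p v v * (D vs p * D ws p)
      ≡⟨ solve 4 (λ a b c d → a :* d :- b :* (c :* d) := (a :- b :* c) :* d) refl (D vs q) (p v v) (D vs p) (D ws p) ⟩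
    (D vs q - p v v * D vs p) * D ws p ∎
    where
    open ≡-Reasoning
    q = p ⊕ col v p ⊗ row v p
    inj₁′ : ∀ {a b} → a ≡ 0ℚ → a * b ≡ 0ℚ
    inj₁′ {b = b} refl = ℚ.*-zeroˡ b
    inj₂′ : ∀ {a b} → b ≡ 0ℚ → a * b ≡ 0ℚ
    inj₂′ {a} refl = ℚ.*-zeroʳ a
    zero+0* : ∀ {a b} → a ≡ 0ℚ → b ≡ 0ℚ → a + b ≡ 0ℚ
    zero+0* refl refl = refl

-- Substochastic matrices: elimination, covers and determinant inequalities.

module Elimination where

  open Determinant
  open import Data.List.Base using (List; []; _∷_; _++_; length; concatMap)
  open import Data.List.Relation.Binary.Permutation.Propositional as Perm using (_↭_; prep)
  open import Data.List.Relation.Binary.Permutation.Propositional.Properties using (++-comm)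
  open import Data.Nat.Base as ℕ using (ℕ; zero; suc; NonZero)
  open import Data.Rational.Base hiding (NonZero)
  open import Algebra.Definitions.RawSemiring ℚ.+-*-rawSemiring using (_^_)
  open import Data.Rational.Solver using (module +-*-Solver)
  open +-*-Solver

  Σ : ∀ {A : Set} → List A → (A → ℚ) → ℚ
  Σ []       f = 0ℚ
  Σ (x ∷ xs) f = f x + Σ xs f

  ≤-from-+ : ∀ {a b} d → 0ℚ ≤ d → a + d ≡ b → a ≤ b
  ≤-from-+ {a} {b} d 0≤d eq = subst₂ _≤_ (ℚ.+-identityʳ a) eq (ℚ.+-monoʳ-≤ a 0≤d)

  0≤-diff : ∀ {a b} → a ≤ b → 0ℚ ≤ b - a
  0≤-diff {a} {b} a≤b = subst (_≤ b - a) (ℚ.+-inverseʳ a) (ℚ.+-monoˡ-≤ (- a) a≤b)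

  *-monoˡ : ∀ {a b} c → 0ℚ ≤ c → a ≤ b → c * a ≤ c * b
  *-monoˡ c 0≤c = ℚ.*-monoˡ-≤-nonNeg c {{nonNegative 0≤c}}

  *-monoʳ : ∀ {a b} c → 0ℚ ≤ c → a ≤ b → a * c ≤ b * c
  *-monoʳ c 0≤c = ℚ.*-monoʳ-≤-nonNeg c {{nonNegative 0≤c}}

  *-mono : ∀ {a b c d} → 0ℚ ≤ c → 0ℚ ≤ b → a ≤ b → c ≤ d → a * c ≤ b * d
  *-mono {b = b} {c} 0≤c 0≤b a≤b c≤d = ℚ.≤-trans (*-monoʳ c 0≤c a≤b) (*-monoˡ b 0≤b c≤d)

  0≤* : ∀ {a b} → 0ℚ ≤ a → 0ℚ ≤ b → 0ℚ ≤ a * b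
  0≤* {a} {b} 0≤a 0≤b = subst (_≤ a * b) (ℚ.*-zeroʳ a) (*-monoˡ a 0≤a 0≤b)

  0≤+ : ∀ {a b} → 0ℚ ≤ a → 0ℚ ≤ b → 0ℚ ≤ a + b
  0≤+ {a} {b} 0≤a 0≤b = subst (_≤ a + b) (ℚ.+-identityʳ 0ℚ) (ℚ.+-mono-≤ 0≤a 0≤b)

  0≤1 : 0ℚ ≤ 1ℚ
  0≤1 = ℚ.nonNegative⁻¹ 1ℚ

  a≤a+b : ∀ {a b} → 0ℚ ≤ b → a ≤ a + b
  a≤a+b {b = b} 0≤b = ≤-from-+ b 0≤b refl

  0≤^ : ∀ {x} n → 0ℚ ≤ x → 0ℚ ≤ x ^ n
  0≤^ zero    0≤x = 0≤1
  0≤^ (suc n) 0≤x = 0≤* 0≤x (0≤^ n 0≤x)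

  ^≤1 : ∀ {x} n → 0ℚ ≤ x → x ≤ 1ℚ → x ^ n ≤ 1ℚ
  ^≤1 zero    0≤x x≤1 = ℚ.≤-refl
  ^≤1 (suc n) 0≤x x≤1 = *-mono (0≤^ n 0≤x) 0≤1 x≤1 (^≤1 n 0≤x x≤1)

  ^-antimono : ∀ {x m n} → 0ℚ ≤ x → x ≤ 1ℚ → m ℕ.≤ n → x ^ n ≤ x ^ m
  ^-antimono {n = n} 0≤x x≤1 ℕ.z≤n = ^≤1 n 0≤x x≤1
  ^-antimono {x} 0≤x x≤1 (ℕ.s≤s m≤n) = *-monoˡ x 0≤x (^-antimono 0≤x x≤1 m≤n)

  *-^ : ∀ x y n → (x * y) ^ n ≡ x ^ n * y ^ n
  *-^ x y zero    = refl
  *-^ x y (suc n) = trans (cong (x * y *_) (*-^ x y n))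
    (solve 4 (λ x y a b → x :* y :* (a :* b) := x :* a :* (y :* b)) refl x y (x ^ n) (y ^ n))

  ^-+ : ∀ x k l → x ^ (k ℕ.+ l) ≡ x ^ k * x ^ l
  ^-+ x zero    l = sym (ℚ.*-identityˡ _)
  ^-+ x (suc k) l = trans (cong (x *_) (^-+ x k l)) (sym (ℚ.*-assoc x _ _))

  ^-* : ∀ x m n → x ^ (m ℕ.* n) ≡ (x ^ n) ^ m
  ^-* x zero    n = refl
  ^-* x (suc m) n = trans (^-+ x n (m ℕ.* n)) (cong (x ^ n *_) (^-* x m n))

  inverse : ∀ {q} → 0ℚ < q → ∃ λ t → 0ℚ ≤ t × t * q ≡ 1ℚ
  inverse {q} 0<q = 1/q , ℚ.<⇒≤ (ℚ.positive⁻¹ 1/q {{ℚ.1/pos⇒pos q}}) , ℚ.*-inverseˡ q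
    where
    instance
      q>0 : Positive q
      q>0 = positive 0<q
      q≢0 : Data.Rational.Base.NonZero q
      q≢0 = ℚ.pos⇒nonZero q
    1/q = 1/ q

  module _ {A : Set} where

    Σ-+* : ∀ (xs : List A) f c g → Σ xs (λ x → f x + c * g x) ≡ Σ xs f + c * Σ xs g
    Σ-+* []       f c g = sym (trans (ℚ.+-identityˡ _) (ℚ.*-zeroʳ c))
    Σ-+* (x ∷ xs) f c g = trans (cong (f x + c * g x +_) (Σ-+* xs f c g))
      (solve 5 (λ a b c d e → a :+ c :* b :+ (d :+ c :* e) := a :+ d :+ c :* (b :+ e)) refl (f x) (g x) c (Σ xs f) (Σ xs g))

    Σ-scale : ∀ (xs : List A) c g → Σ xs (λ x → c * g x) ≡ c * Σ xs g
    Σ-scale []       c g = sym (ℚ.*-zeroʳ c)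
    Σ-scale (x ∷ xs) c g = trans (cong (c * g x +_) (Σ-scale xs c g)) (sym (ℚ.*-distribˡ-+ c (g x) (Σ xs g)))

    0≤Σ : ∀ (xs : List A) {f} → (∀ x → 0ℚ ≤ f x) → 0ℚ ≤ Σ xs f
    0≤Σ []       0≤f = ℚ.≤-refl
    0≤Σ (x ∷ xs) 0≤f = 0≤+ (0≤f x) (0≤Σ xs 0≤f)

    term≤Σ : ∀ {xs : List A} {f y} → (∀ x → 0ℚ ≤ f x) → y ∈ xs → f y ≤ Σ xs f
    term≤Σ {x ∷ xs} 0≤f (here refl) = a≤a+b (0≤Σ xs 0≤f)
    term≤Σ {x ∷ xs} {f} 0≤f (there y∈) = ℚ.≤-trans (term≤Σ 0≤f y∈)
      (subst (_≤ f x + Σ xs f) (ℚ.+-identityˡ _) (ℚ.+-monoˡ-≤ (Σ xs f) (0≤f x)))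

    Σ-++ : ∀ (xs ys : List A) f → Σ (xs ++ ys) f ≡ Σ xs f + Σ ys f
    Σ-++ []       ys f = sym (ℚ.+-identityˡ _)
    Σ-++ (x ∷ xs) ys f = trans (cong (f x +_) (Σ-++ xs ys f)) (sym (ℚ.+-assoc (f x) _ _))

  -- The walk observed only off `v`: the update adds the excursions through `v`, with `t` = 1 / (1 -
  -- p v v) the geometric series of the stays there. This value is imposed by an equation wherever
  -- it is needed, which avoids division.
  elim : ∀ {V} → V → ℚ → Matrix V → Matrix V
  elim v t p = p ⊕ col v p ⊗ λ y → t * p v y

  module _ {V : Set} where

    -- The Schur complement. `D` is affine in the size of a rank-one update, and multiplying its
    -- value at size 1 / (1 - p v v) by the pivot gives exactly the recursion that defines `D`.
    D-elim : ∀ (v : V) vs p t → t * (1ℚ - p v v) ≡ 1ℚ → D (v ∷ vs) p ≡ (1ℚ - p v v) * D vs (elim v t p)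
    D-elim v vs p t eq = sym (begin
      (1ℚ - p v v) * D vs (elim v t p) ≡⟨ cong ((1ℚ - p v v) *_) (D-scale vs p (col v p) (row v p) t) ⟩
      (1ℚ - p v v) * (d + t * (e - d)) ≡⟨ solve 4 (λ m d t e → (con 1ℚ :- m) :* (d :+ t :* (e :- d)) := (con 1ℚ :- m) :* d :+ (t :* (con 1ℚ :- m)) :* (e :- d)) refl (p v v) d t e ⟩
      (1ℚ - p v v) * d + t * (1ℚ - p v v) * (e - d) ≡⟨ cong (λ k → (1ℚ - p v v) * d + k * (e - d)) eq ⟩
      (1ℚ - p v v) * d + 1ℚ * (e - d) ≡⟨ solve 3 (λ m d e → (con 1ℚ :- m) :* d :+ con 1ℚ :* (e :- d) := e :- m :* d) refl (p v v) d e ⟩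
      e - p v v * d ∎)
      where
      open ≡-Reasoning
      d = D vs p
      e = D vs (p ⊕ col v p ⊗ row v p)

    -- The defect of a row sum over `vs` is the probability that the walk leaves `vs` and is killed.
    record Substochastic (vs : List V) (p : Matrix V) : Set where
      constructor substochastic
      field
        entries : ∀ x y → 0ℚ ≤ p x y
        rows   : ∀ x → Σ vs (p x) ≤ 1ℚ

    open Substochastic

    tailˢ : ∀ {v vs p} → Substochastic (v ∷ vs) p → Substochastic vs p
    tailˢ {v} {vs} {p} s = substochastic (entries s) λ x → ℚ.≤-trans
      (subst (_≤ p x v + Σ vs (p x)) (ℚ.+-identityˡ _) (ℚ.+-monoˡ-≤ _ (entries s x v))) (rows s x)

    dropˢ : ∀ {v w vs p} → Substochastic (v ∷ w ∷ vs) p → Substochastic (v ∷ vs) p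
    dropˢ {v} {w} {vs} {p} s = substochastic (entries s) λ x → ℚ.≤-trans
      (ℚ.+-monoʳ-≤ (p x v) (subst (_≤ p x w + Σ vs (p x)) (ℚ.+-identityˡ _) (ℚ.+-monoˡ-≤ _ (entries s x w)))) (rows s x)

    diag≤1 : ∀ {v vs p} → Substochastic (v ∷ vs) p → p v v ≤ 1ℚ
    diag≤1 {v} {vs} {p} s = ℚ.≤-trans (a≤a+b (0≤Σ vs (entries s v))) (rows s v)

    -- The row of `v` has at most 1 - p v v left for `vs`. Divided by the pivot this is at most 1,
    -- so the mass that arrives at `v` is passed on without increase.
    elimˢ : ∀ {v vs p t} → Substochastic (v ∷ vs) p → 0ℚ ≤ t → t * (1ℚ - p v v) ≡ 1ℚ → Substochastic vs (elim v t p)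
    elimˢ {v} {vs} {p} {t} s 0≤t eq = substochastic
      (λ x y → 0≤+ (entries s x y) (0≤* (entries s x v) (0≤* 0≤t (entries s v y))))
      λ x → begin
        Σ vs (elim v t p x) ≡⟨ trans (Σ-+* vs (p x) (p x v) _) (cong (λ k → Σ vs (p x) + p x v * k) (Σ-scale vs t (p v))) ⟩
        Σ vs (p x) + p x v * (t * Σ vs (p v)) ≤⟨ ≤-from-+ (p x v * (t * (1ℚ - (p v v + Σ vs (p v))))) (0≤* (entries s x v) (0≤* 0≤t (0≤-diff (rows s v))))
                                                      (solve 5 (λ a k t m r → a :+ k :* (t :* r) :+ k :* (t :* (con 1ℚ :- (m :+ r))) := a :+ k :* (t :* (con 1ℚ :- m))) refl (Σ vs (p x)) (p x v) t (p v v) (Σ vs (p v))) ⟩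
        Σ vs (p x) + p x v * (t * (1ℚ - p v v)) ≡⟨ cong (λ k → Σ vs (p x) + p x v * k) eq ⟩
        Σ vs (p x) + p x v * 1ℚ ≡⟨ solve 2 (λ a k → a :+ k :* con 1ℚ := k :+ a) refl (Σ vs (p x)) (p x v) ⟩
        p x v + Σ vs (p x) ≤⟨ rows s x ⟩
        1ℚ ∎
      where open ℚ.≤-Reasoning

    -- A row of sum 1 that is concentrated on the diagonal makes I - p singular.
    D-absorbing : ∀ {v vs p} → Substochastic (v ∷ vs) p → 1ℚ - p v v ≡ 0ℚ → ∀ ws → (∀ {x} → x ∈ ws → x ∈ vs) → D (v ∷ ws) p ≡ 0ℚ
    D-absorbing {v} {vs} {p} s eq ws sub = begin
      D ws (p ⊕ col v p ⊗ row v p) - p v v * D ws p ≡⟨ cong₂ (λ a b → a - b * D ws p) (D-cong ws λ {x} {y} _ y∈ → trans (cong (λ k → p x y + p x v * k) (off y∈)) (solve 2 (λ a b → a :+ b :* con 0ℚ := a) refl (p x y) (p x v))) pvv≡1 ⟩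
      D ws p - 1ℚ * D ws p ≡⟨ solve 1 (λ d → d :- con 1ℚ :* d := con 0ℚ) refl (D ws p) ⟩
      0ℚ ∎
      where
      open ≡-Reasoning
      pvv≡1 : p v v ≡ 1ℚ
      pvv≡1 = trans (solve 1 (λ m → m := con 1ℚ :- (con 1ℚ :- m)) refl (p v v)) (cong (λ k → 1ℚ - k) eq)
      Σ≤0 : Σ vs (p v) ≤ 0ℚ
      Σ≤0 = subst₂ _≤_ (solve 1 (λ r → con (- 1ℚ) :+ (con 1ℚ :+ r) := r) refl (Σ vs (p v))) refl
        (ℚ.+-monoʳ-≤ (- 1ℚ) (subst (λ k → k + Σ vs (p v) ≤ 1ℚ) pvv≡1 (rows s v)))
      off : ∀ {y} → y ∈ ws → p v y ≡ 0ℚ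
      off y∈ = ℚ.≤-antisym (ℚ.≤-trans (term≤Σ (entries s v) (sub y∈)) Σ≤0) (entries s v _)

    diag-cases : ∀ {v vs p} → Substochastic (v ∷ vs) p → 0ℚ < 1ℚ - p v v ⊎ 1ℚ - p v v ≡ 0ℚ
    diag-cases {v} {vs} {p} s with 0ℚ ℚ.<? 1ℚ - p v v

    ... | yes 0<q = inj₁ 0<q
    ... | no  0≮q = inj₂ (ℚ.≤-antisym (ℚ.≮⇒≥ 0≮q) (0≤-diff (diag≤1 s)))

    -- The determinant is the product of the pivots met during elimination. They are nonnegative,
    -- and a vanishing pivot makes the whole determinant vanish by `D-absorbing`.
    0≤D : ∀ {vs p} → Substochastic vs p → 0ℚ ≤ D vs p
    0≤D {[]}     s = 0≤1
    0≤D {v ∷ vs} {p} s with diag-cases s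
    ... | inj₂ eq  = ℚ.≤-reflexive (sym (D-absorbing s eq vs λ x∈ → x∈))
    ... | inj₁ 0<q with t , 0≤t , eq ← inverse 0<q =
      subst (0ℚ ≤_) (sym (D-elim v vs p t eq)) (0≤* (ℚ.<⇒≤ 0<q) (0≤D (elimˢ s 0≤t eq)))

  module Cover {V W : Set} (fib : V → List W) (K : ℕ) {{_ : NonZero K}} where

    open Substochastic

    -- An inequality rather than an equality, so that the lifted walk may be killed where the walk
    -- below continues; this is what makes the cover partial.
    Dominates : List V → Matrix V → Matrix W → Set
    Dominates vs N M = ∀ {x w y} → x ∈ vs → w ∈ fib x → y ∈ vs → Σ (fib y) (M w) ≤ N x y

    module _ (v : V) (vs : List V) (N : Matrix V) (t : ℚ) (0≤t : 0ℚ ≤ t) (inv : t * (1ℚ - N v v) ≡ 1ℚ) (N≥0 : ∀ x y → 0ℚ ≤ N x y)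
             (0≤q : 0ℚ ≤ 1ℚ - N v v) (0<q : 0ℚ < 1ℚ - N v v)
             (X : ℚ) (0≤X : 0ℚ ≤ X)
             (X≤ : ∀ M → Substochastic (concatMap fib vs) M → Dominates vs (elim v t N) M → X ≤ D (concatMap fib vs) M) where

      private
        b : V → ℚ
        b y = t * N v y

      -- One elimination below corresponds to one for each point above `v`. Here `b y` is the
      -- probability that the walk below, on leaving `v`, goes to `y`, and mass on the remaining
      -- points `ws` of the fibre is counted as delivered to `fib y` at this rate. The first
      -- hypothesis keeps each pivot at least 1 - N v v; the other two say that the delivered mass
      -- does not exceed its bound, and they survive each elimination. When `ws` is empty, the last
      -- one is domination by `elim v t N`.
      eliminate-fibre : ∀ ws M → Substochastic (ws ++ concatMap fib vs) M →
        (∀ {w} → w ∈ ws → Σ ws (M w) ≤ N v v) →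
        (∀ {w y} → w ∈ ws → y ∈ vs → Σ (fib y) (M w) + Σ ws (M w) * b y ≤ b y) →
        (∀ {x w y} → x ∈ vs → w ∈ fib x → y ∈ vs → Σ (fib y) (M w) + Σ ws (M w) * b y ≤ elim v t N x y) →
        (1ℚ - N v v) ^ length ws * X ≤ D (ws ++ concatMap fib vs) M
      eliminate-fibre [] M s _ _ dom = subst (_≤ _) (sym (ℚ.*-identityˡ X))
        (X≤ M s λ {x} {w} {y} x∈ w∈ y∈ → subst (_≤ elim v t N x y)
          (solve 2 (λ a b → a :+ con 0ℚ :* b := a) refl (Σ (fib y) (M w)) (b y)) (dom x∈ w∈ y∈))
      eliminate-fibre (w₁ ∷ ws) M s inside own other = begin
        q * q ^ length ws * X ≡⟨ ℚ.*-assoc q _ X ⟩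
        q * (q ^ length ws * X) ≤⟨ *-mono (0≤* (0≤^ (length ws) 0≤q) 0≤X) 0≤q₁ q≤q₁ IH ⟩
        (1ℚ - m) * D (ws ++ concatMap fib vs) M′ ≡⟨ D-elim w₁ (ws ++ concatMap fib vs) M u eq ⟨
        D (w₁ ∷ ws ++ concatMap fib vs) M ∎
        where
        open ℚ.≤-Reasoning
        q = 1ℚ - N v v
        m = M w₁ w₁
        R₁ = Σ ws (M w₁)
        r₁≤a : m + R₁ ≤ N v v
        r₁≤a = inside (here refl)
        m≤a : m ≤ N v v
        m≤a = ℚ.≤-trans (a≤a+b (0≤Σ ws (entries s w₁))) r₁≤a
        q≤q₁ : q ≤ 1ℚ - m
        q≤q₁ = ℚ.+-monoʳ-≤ 1ℚ (ℚ.neg-antimono-≤ m≤a)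
        0≤q₁ : 0ℚ ≤ 1ℚ - m
        0≤q₁ = ℚ.≤-trans 0≤q q≤q₁
        I = inverse (ℚ.<-≤-trans 0<q q≤q₁)
        u = proj₁ I
        0≤u = proj₁ (proj₂ I)
        eq = proj₂ (proj₂ I)
        M′ = elim w₁ u M
        r₁≤1 : m + R₁ ≤ 1ℚ
        r₁≤1 = ℚ.≤-trans r₁≤a (≤-from-+ q 0≤q (solve 1 (λ n → n :+ (con 1ℚ :- n) := con 1ℚ) refl (N v v)))
        Σ′ : ∀ zs w → Σ zs (M′ w) ≡ Σ zs (M w) + M w w₁ * (u * Σ zs (M w₁))
        Σ′ zs w = trans (Σ-+* zs (M w) (M w w₁) _) (cong (λ k → Σ zs (M w) + M w w₁ * k) (Σ-scale zs u (M w₁)))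
        inside′ : ∀ {w} → w ∈ ws → Σ ws (M′ w) ≤ N v v
        inside′ {w} w∈ = begin
          Σ ws (M′ w) ≡⟨ Σ′ ws w ⟩
          R₀ + k * (u * R₁) ≤⟨ ≤-from-+ (k * (u * (1ℚ - (m + R₁)))) (0≤* (entries s w w₁) (0≤* 0≤u (0≤-diff r₁≤1)))
            (solve 5 (λ R₀ k u R₁ m → R₀ :+ k :* (u :* R₁) :+ k :* (u :* (con 1ℚ :- (m :+ R₁))) := R₀ :+ k :* (u :* (con 1ℚ :- m))) refl R₀ k u R₁ m) ⟩
          R₀ + k * (u * (1ℚ - m)) ≡⟨ cong (λ z → R₀ + k * z) eq ⟩
          R₀ + k * 1ℚ ≡⟨ solve 2 (λ R₀ k → R₀ :+ k :* con 1ℚ := k :+ R₀) refl R₀ k ⟩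
          k + R₀ ≤⟨ inside (there w∈) ⟩
          N v v ∎
          where
          R₀ = Σ ws (M w)
          k = M w w₁
        -- The mass on `w₁` is exchanged for what `w₁` passes on, which by `own` is worth at most
        -- `b y` per unit.
        decrease : ∀ w {y} → y ∈ vs → Σ (fib y) (M′ w) + Σ ws (M′ w) * b y ≤ Σ (fib y) (M w) + (M w w₁ + Σ ws (M w)) * b y
        decrease w {y} y∈ = begin
          Σ (fib y) (M′ w) + Σ ws (M′ w) * b y ≡⟨ cong₂ (λ c r → c + r * b y) (Σ′ (fib y) w) (Σ′ ws w) ⟩
          c + k * (u * c₁) + (R₀ + k * (u * R₁)) * β ≤⟨ ≤-from-+ (k * (u * (β - (c₁ + (m + R₁) * β)))) (0≤* (entries s w w₁) (0≤* 0≤u (0≤-diff (own (here refl) y∈))))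
            (solve 8 (λ c k u c₁ R₀ R₁ β m → c :+ k :* (u :* c₁) :+ (R₀ :+ k :* (u :* R₁)) :* β :+ k :* (u :* (β :- (c₁ :+ (m :+ R₁) :* β)))
                      := c :+ R₀ :* β :+ k :* β :* (u :* (con 1ℚ :- m))) refl c k u c₁ R₀ R₁ β m) ⟩
          c + R₀ * β + k * β * (u * (1ℚ - m)) ≡⟨ cong (λ z → c + R₀ * β + k * β * z) eq ⟩
          c + R₀ * β + k * β * 1ℚ ≡⟨ solve 4 (λ c R₀ β k → c :+ R₀ :* β :+ k :* β :* con 1ℚ := c :+ (k :+ R₀) :* β) refl c R₀ β k ⟩
          c + (k + R₀) * β ∎
          where
          c = Σ (fib y) (M w)
          c₁ = Σ (fib y) (M w₁)
          R₀ = Σ ws (M w)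
          k = M w w₁
          β = b y
        IH : q ^ length ws * X ≤ D (ws ++ concatMap fib vs) M′
        IH = eliminate-fibre ws M′ (elimˢ s 0≤u eq) inside′
          (λ {w} w∈ y∈ → ℚ.≤-trans (decrease w y∈) (own (there w∈) y∈))
          (λ {x} {w} x∈ w∈ y∈ → ℚ.≤-trans (decrease w y∈) (other x∈ w∈ y∈))

    -- Eliminating `v` costs the pivot `q` below, and at most `length (fib v)` pivots above, each at
    -- least `q`. Since `q` is at most 1, the power with exponent `K` is a lower bound for small
    -- fibres too.
    D-cover : ∀ vs N M → Substochastic vs N → Substochastic (concatMap fib vs) M → Dominates vs N M →
              (∀ {x} → x ∈ vs → length (fib x) ℕ.≤ K) → D vs N ^ K ≤ D (concatMap fib vs) M
    D-cover [] N M _ _ _ _ = ^≤1 K 0≤1 ℚ.≤-refl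
    D-cover (v ∷ vs) N M sN sM dom len with diag-cases sN
    ... | inj₂ q≡0 = subst (_≤ D (concatMap fib (v ∷ vs)) M)
          (sym (trans (cong (_^ K) (D-absorbing sN q≡0 vs λ x∈ → x∈)) (0^ K))) (0≤D sM)
      where
      0^ : ∀ n .{{_ : NonZero n}} → 0ℚ ^ n ≡ 0ℚ
      0^ (suc n) = ℚ.*-zeroˡ (0ℚ ^ n)
    ... | inj₁ 0<q with t , 0≤t , eq ← inverse 0<q = begin
        D (v ∷ vs) N ^ K ≡⟨ cong (_^ K) (D-elim v vs N t eq) ⟩
        (q * D vs N′) ^ K ≡⟨ *-^ q (D vs N′) K ⟩
        q ^ K * X ≤⟨ *-monoʳ X 0≤X (^-antimono (ℚ.<⇒≤ 0<q) q≤1 (len (here refl))) ⟩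
        q ^ length (fib v) * X ≤⟨ eliminate-fibre v vs N t 0≤t eq (entries sN) (ℚ.<⇒≤ 0<q) 0<q X 0≤X
                                               (λ M′ sM′ dom′ → D-cover vs N′ M′ sN′ sM′ dom′ (λ x∈ → len (there x∈)))
                                               (fib v) M sM (λ w∈ → dom (here refl) w∈ (here refl)) own other ⟩
        D (concatMap fib (v ∷ vs)) M ∎
      where
      open ℚ.≤-Reasoning
      q = 1ℚ - N v v
      N′ = elim v t N
      sN′ = elimˢ sN 0≤t eq
      X = D vs N′ ^ K
      0≤X = 0≤^ K (0≤D sN′)
      q≤1 : q ≤ 1ℚ
      q≤1 = ≤-from-+ (N v v) (entries sN v v) (solve 1 (λ n → con 1ℚ :- n :+ n := con 1ℚ) refl (N v v))
      own : ∀ {w y} → w ∈ fib v → y ∈ vs → Σ (fib y) (M w) + Σ (fib v) (M w) * (t * N v y) ≤ t * N v y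
      own {w} {y} w∈ y∈ = begin
        Σ (fib y) (M w) + Σ (fib v) (M w) * (t * N v y) ≤⟨ ℚ.+-mono-≤ (dom (here refl) w∈ (there y∈)) (*-monoʳ _ (0≤* 0≤t (entries sN v y)) (dom (here refl) w∈ (here refl))) ⟩
        N v y + N v v * (t * N v y) ≡⟨ cong (λ k → k + N v v * (t * N v y)) (trans (sym (ℚ.*-identityˡ (N v y))) (cong (_* N v y) (sym eq))) ⟩
        t * (1ℚ - N v v) * N v y + N v v * (t * N v y) ≡⟨ solve 3 (λ t m n → t :* (con 1ℚ :- m) :* n :+ m :* (t :* n) := t :* n) refl t (N v v) (N v y) ⟩
        t * N v y ∎
      other : ∀ {x w y} → x ∈ vs → w ∈ fib x → y ∈ vs → Σ (fib y) (M w) + Σ (fib v) (M w) * (t * N v y) ≤ N′ x y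
      other x∈ w∈ y∈ = ℚ.+-mono-≤ (dom (there x∈) w∈ (there y∈)) (*-monoʳ _ (0≤* 0≤t (entries sN v _)) (dom (there x∈) w∈ (here refl)))

  -- The cover with singleton fibres and `K` = 1.
  D-antimono : ∀ {V} (vs : List V) {p p′} → Substochastic vs p → Substochastic vs p′ →
               (∀ x y → p x y ≤ p′ x y) → D vs p′ ≤ D vs p
  D-antimono vs {p} {p′} s s′ p≤p′ = subst₂ _≤_ (ℚ.*-identityʳ (D vs p′)) (cong (λ ws → D ws p) (concatMap-[-]′ vs))
    (Cover.D-cover (λ v → v ∷ []) 1 vs p′ p s′ (subst (λ ws → Substochastic ws p) (sym (concatMap-[-]′ vs)) s)
      (λ { {x} {y = y} _ (here refl) _ → subst (_≤ p′ x y) (sym (ℚ.+-identityʳ (p x y))) (p≤p′ x y) })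
      (λ _ → ℕ.s≤s ℕ.z≤n))
    where
    concatMap-[-]′ : ∀ {A : Set} (xs : List A) → concatMap (λ x → x ∷ []) xs ≡ xs
    concatMap-[-]′ []       = refl
    concatMap-[-]′ (x ∷ xs) = cong (x ∷_) (concatMap-[-]′ xs)

  module _ {V : Set} where

    open Substochastic

    private
      drop-diag : ∀ {v : V} {vs p d} → Substochastic (v ∷ vs) p → 0ℚ ≤ d → (1ℚ - p v v) * d ≤ d
      drop-diag {v} {p = p} {d} s 0≤d = ≤-from-+ (p v v * d) (0≤* (entries s v v) 0≤d)
        (solve 2 (λ m d → (con 1ℚ :- m) :* d :+ m :* d := d) refl (p v v) d)

    D-∷≤ : ∀ {v : V} {vs p} → Substochastic (v ∷ vs) p → D (v ∷ vs) p ≤ D vs p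
    D-∷≤ {v} {vs} {p} s with diag-cases s
    ... | inj₂ eq = subst (_≤ D vs p) (sym (D-absorbing s eq vs λ x∈ → x∈)) (0≤D (tailˢ s))
    ... | inj₁ 0<q with t , 0≤t , eq ← inverse 0<q = begin
      D (v ∷ vs) p ≡⟨ D-elim v vs p t eq ⟩
      (1ℚ - p v v) * D vs (elim v t p) ≤⟨ drop-diag s (0≤D (elimˢ s 0≤t eq)) ⟩
      D vs (elim v t p) ≤⟨ D-antimono vs (tailˢ s) (elimˢ s 0≤t eq) (λ x y → a≤a+b (0≤* (entries s x v) (0≤* 0≤t (entries s v y)))) ⟩
      D vs p ∎
      where open ℚ.≤-Reasoning

    -- Koteljanskii's inequality, known for M-matrices. Eliminating a vertex of `S` multiplies both
    -- sides by the square of its pivot; once `S` is exhausted, a two by two matrix remains and the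
    -- sides differ by `p x y * p y x`.
    D-koteljanskii : ∀ (S : List V) x y {p} → Substochastic (S ++ x ∷ y ∷ []) p →
      D (S ++ x ∷ y ∷ []) p * D S p ≤ D (S ++ x ∷ []) p * D (S ++ y ∷ []) p
    D-koteljanskii [] x y {p} s = ≤-from-+ (p x y * p y x) (0≤* (entries s x y) (entries s y x))
      (solve 4 (λ a b c d → (con 1ℚ :- (d :+ b :* c) :* con 1ℚ :- a :* (con 1ℚ :- d :* con 1ℚ)) :* con 1ℚ :+ c :* b
         := (con 1ℚ :- a :* con 1ℚ) :* (con 1ℚ :- d :* con 1ℚ)) refl (p x x) (p y x) (p x y) (p y y))
    D-koteljanskii (v ∷ S) x y {p} s with diag-cases s
    ... | inj₂ eq = ℚ.≤-reflexive (trans (trans (cong (D (v ∷ S ++ x ∷ y ∷ []) p *_) (zeroᴰ S (λ z∈ → ∈-++⁺ˡ z∈))) (ℚ.*-zeroʳ (D (v ∷ S ++ x ∷ y ∷ []) p)))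
        (sym (trans (cong (_* D (v ∷ S ++ y ∷ []) p) (zeroᴰ (S ++ x ∷ []) sub)) (ℚ.*-zeroˡ (D (v ∷ S ++ y ∷ []) p)))))
      where
      zeroᴰ : ∀ ws → (∀ {z} → z ∈ ws → z ∈ S ++ x ∷ y ∷ []) → D (v ∷ ws) p ≡ 0ℚ
      zeroᴰ = D-absorbing s eq
      sub : ∀ {z} → z ∈ S ++ x ∷ [] → z ∈ S ++ x ∷ y ∷ []
      sub z∈ with ∈-++⁻ S z∈
      ... | inj₁ z∈S = ∈-++⁺ˡ z∈S
      ... | inj₂ (here refl) = ∈-++⁺ʳ S (here refl)
    ... | inj₁ 0<q with t , 0≤t , eq ← inverse 0<q = begin
      D (v ∷ S ++ x ∷ y ∷ []) p * D (v ∷ S) p ≡⟨ cong₂ _*_ (D-elim v (S ++ x ∷ y ∷ []) p t eq) (D-elim v S p t eq) ⟩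
      q * D (S ++ x ∷ y ∷ []) p′ * (q * D S p′) ≡⟨ regroup q _ _ ⟩
      q * q * (D (S ++ x ∷ y ∷ []) p′ * D S p′) ≤⟨ *-monoˡ (q * q) (0≤* (ℚ.<⇒≤ 0<q) (ℚ.<⇒≤ 0<q)) (D-koteljanskii S x y (elimˢ s 0≤t eq)) ⟩
      q * q * (D (S ++ x ∷ []) p′ * D (S ++ y ∷ []) p′) ≡⟨ regroup q _ _ ⟨
      q * D (S ++ x ∷ []) p′ * (q * D (S ++ y ∷ []) p′) ≡⟨ cong₂ _*_ (D-elim v (S ++ x ∷ []) p t eq) (D-elim v (S ++ y ∷ []) p t eq) ⟨
      D (v ∷ S ++ x ∷ []) p * D (v ∷ S ++ y ∷ []) p ∎
      where
      open ℚ.≤-Reasoning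
      q = 1ℚ - p v v
      p′ = elim v t p
      regroup : ∀ q a b → q * a * (q * b) ≡ q * q * (a * b)
      regroup = solve 3 (λ q a b → q :* a :* (q :* b) := q :* q :* (a :* b)) refl

    substochastic-↭ : ∀ {vs ws : List V} {p} → vs ↭ ws → Substochastic vs p → Substochastic ws p
    substochastic-↭ {vs} {ws} {p} σ s = substochastic (entries s) λ x → subst (_≤ 1ℚ) (Σ-↭ σ (p x)) (rows s x)
      where
      Σ-↭ : ∀ {vs ws : List V} → vs ↭ ws → ∀ f → Σ vs f ≡ Σ ws f
      Σ-↭ Perm.refl f = refl
      Σ-↭ (prep x σ) f = cong (f x +_) (Σ-↭ σ f)
      Σ-↭ (Perm.swap {xs} {ys} x y σ) f = trans (solve 3 (λ a b c → a :+ (b :+ c) := b :+ (a :+ c)) refl (f x) (f y) (Σ xs f)) (cong (λ k → f y + (f x + k)) (Σ-↭ σ f))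
      Σ-↭ (Perm.trans σ τ) f = trans (Σ-↭ σ f) (Σ-↭ τ f)

    -- The ratio D (x ∷ L) / D L is the probability of escaping from x to the
    -- complement of L; it decreases as L grows.
    D-window : ∀ x (R S : List V) {p c} → 0ℚ ≤ c → Substochastic (x ∷ R ++ S) p →
               D (x ∷ S) p ≤ c * D S p → D (x ∷ R ++ S) p ≤ c * D (R ++ S) p
    D-window x []      S 0≤c s h = h
    D-window x (y ∷ R) S {p} {c} 0≤c s h with 0ℚ ℚ.<? D L p
      where L = R ++ S
    ... | yes 0<D = ℚ.*-cancelʳ-≤-pos (D L p) {{positive 0<D}} (begin
      D (x ∷ y ∷ L) p * D L p ≡⟨ cong (_* D L p) (D-↭ xyL p) ⟩
      D (L ++ x ∷ y ∷ []) p * D L p ≤⟨ D-koteljanskii L x y (substochastic-↭ xyL s) ⟩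
      D (L ++ x ∷ []) p * D (L ++ y ∷ []) p ≡⟨ cong₂ _*_ (D-↭ (++-comm L (x ∷ [])) p) (D-↭ (++-comm L (y ∷ [])) p) ⟩
      D (x ∷ L) p * D (y ∷ L) p ≤⟨ *-monoʳ _ (0≤D (tailˢ s)) (D-window x R S 0≤c (dropˢ s) h) ⟩
      c * D L p * D (y ∷ L) p ≡⟨ solve 3 (λ c l y → c :* l :* y := c :* y :* l) refl c (D L p) (D (y ∷ L) p) ⟩
      c * D (y ∷ L) p * D L p ∎)
      where
      open ℚ.≤-Reasoning
      L = R ++ S
      xyL : x ∷ y ∷ L ↭ L ++ x ∷ y ∷ []
      xyL = ++-comm (x ∷ y ∷ []) L
    -- `D L p` cannot be cancelled here, but it bounds the determinants of the longer lists, so the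
    -- left side is at most 0.
    ... | no 0≮D = ℚ.≤-trans (D-∷≤ s) (ℚ.≤-trans (ℚ.≤-trans (D-∷≤ (tailˢ s)) (ℚ.≮⇒≥ 0≮D)) (0≤* 0≤c (0≤D (tailˢ s))))

-- Counting with repetition-free lists; orbits of an injective map.

module FiniteLists where

  open import Data.List.Base using (List; []; _∷_; _++_; length; map; concatMap; cartesianProduct)
  open import Data.List.Properties using (length-++; length-map)
  open import Data.List.Relation.Binary.Permutation.Propositional using (_↭_; prep; ↭-sym; ↭-trans; ↭-refl)
  open import Data.List.Relation.Binary.Permutation.Propositional.Properties using (shift)
  open import Data.Nat.Base using (ℕ; zero; suc; _+_; _≤_; _<_; z≤n; s≤s; s≤s⁻¹; NonZero; _%_; _/_; _*_; _∸_; >-nonZero)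
  open import Data.Nat.DivMod using (m≡m%n+[m/n]*n; m%n<n)

  module _ {A : Set} where

    remove-middle : ∀ {x y : A} as {bs} → y ∈ as ++ x ∷ bs → x ≢ y → y ∈ as ++ bs
    remove-middle as y∈ x≢y with ∈-++⁻ as y∈
    ... | inj₁ y∈as = ∈-++⁺ˡ y∈as
    ... | inj₂ (here refl) = ⊥-elim (x≢y refl)
    ... | inj₂ (there y∈bs) = ∈-++⁺ʳ as y∈bs

    unique-suffix : ∀ (as : List A) {bs} → Unique (as ++ bs) → Unique bs
    unique-suffix []       u       = u
    unique-suffix (a ∷ as) (_ ∷ u) = unique-suffix as u

    length-middle : ∀ (as : List A) {x bs} → length (as ++ x ∷ bs) ≡ suc (length (as ++ bs))
    length-middle []       = refl
    length-middle (a ∷ as) = cong suc (length-middle as)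

    unique-⊆⇒length≤ : ∀ {xs ys : List A} → Unique xs → (∀ {x} → x ∈ xs → x ∈ ys) → length xs ≤ length ys
    unique-⊆⇒length≤ {[]} [] sub = z≤n
    unique-⊆⇒length≤ {x ∷ xs} (x∉ ∷ u) sub with as , bs , refl ← ∈-∃++ (sub (here refl)) =
      subst (suc (length xs) ≤_) (sym (length-middle as))
        (s≤s (unique-⊆⇒length≤ u λ y∈ → remove-middle as (sub (there y∈)) (All.lookup x∉ y∈)))

    -- The equality case of the pigeonhole principle. It turns the surjectivity of a rotation on the
    -- neighbours of a vertex into injectivity, and shows that six iterates which meet all six
    -- neighbours are distinct.
    ⊆-length≤⇒unique : DecidableEquality A → ∀ {xs ys : List A} → Unique xs → (∀ {x} → x ∈ xs → x ∈ ys) →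
                       length ys ≤ length xs → Unique ys × (∀ {y} → y ∈ ys → y ∈ xs)
    ⊆-length≤⇒unique _≟_ {xs} {[]} u sub len = [] , λ ()
    ⊆-length≤⇒unique _≟_ {[]} {y ∷ ys} u sub ()
    ⊆-length≤⇒unique _≟_ {x ∷ xs} {ys@(_ ∷ _)} (x∉ ∷ u) sub len with as , bs , eq ← ∈-∃++ (sub (here refl)) = result
      where
      len′ : length (as ++ bs) ≤ length xs
      len′ = s≤s⁻¹ (subst (_≤ suc (length xs)) (trans (cong length eq) (length-middle as)) len)
      rec = ⊆-length≤⇒unique _≟_ {xs} {as ++ bs} u (λ y∈ → remove-middle as (subst (_ ∈_) eq (sub (there y∈))) (All.lookup x∉ y∈)) len′
      x∉as++bs : x ∉ as ++ bs
      x∉as++bs x∈ = All.lookup x∉ (proj₂ rec x∈) refl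
      insert : ∀ as {bs} → Unique (as ++ bs) → x ∉ as ++ bs → Unique (as ++ x ∷ bs)
      insert [] {bs} u x∉ = All.tabulate (λ {z} z∈ eq → x∉ (subst (_∈ bs) (sym eq) z∈)) ∷ u
      insert (a ∷ as) {bs} (a∉ ∷ u) x∉ = All.tabulate fresh ∷ insert as u (λ x∈ → x∉ (there x∈))
        where
        fresh : ∀ {z} → z ∈ as ++ x ∷ bs → a ≢ z
        fresh {z} z∈ refl with ∈-++⁻ as z∈
        ... | inj₁ z∈as = All.lookup a∉ (∈-++⁺ˡ z∈as) refl
        ... | inj₂ (here refl) = x∉ (here refl)
        ... | inj₂ (there z∈bs) = All.lookup a∉ (∈-++⁺ʳ as z∈bs) refl
      result : Unique ys × (∀ {y} → y ∈ ys → y ∈ x ∷ xs)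
      result = subst Unique (sym eq) (insert as (proj₁ rec) x∉as++bs) , back
        where
        back : ∀ {y} → y ∈ ys → y ∈ x ∷ xs
        back {y} y∈ with ∈-++⁻ as (subst (y ∈_) eq y∈)
        ... | inj₁ y∈as = there (proj₂ rec (∈-++⁺ˡ y∈as))
        ... | inj₂ (here refl) = here refl
        ... | inj₂ (there y∈bs) = there (proj₂ rec (∈-++⁺ʳ as y∈bs))

    unique-⊆⊇⇒length≡ : ∀ {xs ys : List A} → Unique xs → Unique ys →
      (∀ {x} → x ∈ xs → x ∈ ys) → (∀ {x} → x ∈ ys → x ∈ xs) → length xs ≡ length ys
    unique-⊆⊇⇒length≡ u v sub sup = ℕ.≤-antisym (unique-⊆⇒length≤ u sub) (unique-⊆⇒length≤ v sup)

  module _ {A B : Set} where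

    unique-map⁺ : ∀ (f : A → B) {xs} → (∀ {x y} → x ∈ xs → y ∈ xs → f x ≡ f y → x ≡ y) → Unique xs → Unique (map f xs)
    unique-map⁺ f {[]} inj [] = []
    unique-map⁺ f {x ∷ xs} inj (x∉ ∷ u) =
      All.map⁺ (All.tabulate λ y∈ eq → All.lookup x∉ y∈ (inj (here refl) (there y∈) eq)) ∷
      unique-map⁺ f (λ x∈ y∈ → inj (there x∈) (there y∈)) u

    unique-map⁻ : ∀ (f : A → B) {xs} → Unique (map f xs) → ∀ {x y} → x ∈ xs → y ∈ xs → f x ≡ f y → x ≡ y
    unique-map⁻ f (x∉ ∷ u) (here refl) (here refl) eq = refl
    unique-map⁻ f (x∉ ∷ u) (here refl) (there y∈) eq = ⊥-elim (All.lookup x∉ (∈-map⁺ f y∈) eq)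
    unique-map⁻ f (x∉ ∷ u) (there x∈) (here refl) eq = ⊥-elim (All.lookup x∉ (∈-map⁺ f x∈) (sym eq))
    unique-map⁻ f (x∉ ∷ u) (there x∈) (there y∈) eq = unique-map⁻ f u x∈ y∈ eq

  module _ {A : Set} where

    unique-⊆⊇⇒↭ : ∀ {xs ys : List A} → Unique xs → Unique ys → (∀ {x} → x ∈ xs → x ∈ ys) → (∀ {x} → x ∈ ys → x ∈ xs) → xs ↭ ys
    unique-⊆⊇⇒↭ {[]} {[]} _ _ _ _ = ↭-refl
    unique-⊆⊇⇒↭ {[]} {y ∷ ys} _ _ _ sup with () ← sup (here refl)
    unique-⊆⊇⇒↭ {x ∷ xs} {ys} (x∉ ∷ u) v sub sup with as , bs , refl ← ∈-∃++ (sub (here refl)) =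
      ↭-trans (prep x (unique-⊆⊇⇒↭ u (unique-middle as v) (λ z∈ → remove-middle as (sub (there z∈)) (All.lookup x∉ z∈)) back)) (↭-sym (shift x as bs))
      where
      unique-middle : ∀ as {bs} → Unique (as ++ x ∷ bs) → Unique (as ++ bs)
      unique-middle [] (_ ∷ u) = u
      unique-middle (a ∷ as) (a∉ ∷ u) = All.tabulate (λ z∈ → All.lookup a∉ (insert as z∈)) ∷ unique-middle as u
        where
        insert : ∀ as {bs z} → z ∈ as ++ bs → z ∈ as ++ x ∷ bs
        insert as z∈ with ∈-++⁻ as z∈
        ... | inj₁ z∈as = ∈-++⁺ˡ z∈as
        ... | inj₂ z∈bs = ∈-++⁺ʳ as (there z∈bs)
      fresh : ∀ as {bs} → Unique (as ++ x ∷ bs) → x ∉ as ++ bs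
      fresh [] (x∉ ∷ _) x∈ = All.lookup x∉ x∈ refl
      fresh (a ∷ as) {bs} (a∉ ∷ u) (here refl) = All.lookup a∉ (∈-++⁺ʳ as (here refl)) refl
      fresh (a ∷ as) (a∉ ∷ u) (there x∈) = fresh as u x∈
      back : ∀ {z} → z ∈ as ++ bs → z ∈ xs
      back {z} z∈ with sup {z} (widen z∈)
        where
        widen : ∀ {z} → z ∈ as ++ bs → z ∈ as ++ x ∷ bs
        widen z∈ with ∈-++⁻ as z∈
        ... | inj₁ z∈as = ∈-++⁺ˡ z∈as
        ... | inj₂ z∈bs = ∈-++⁺ʳ as (there z∈bs)
      ... | here refl = ⊥-elim (fresh as v z∈)
      ... | there z∈xs = z∈xs

  module _ {A B : Set} where

    ∈-concatMap⁺ : ∀ (f : A → List B) {x xs b} → x ∈ xs → b ∈ f x → b ∈ concatMap f xs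
    ∈-concatMap⁺ f {xs = _ ∷ xs} (here refl) b∈ = ∈-++⁺ˡ b∈
    ∈-concatMap⁺ f {xs = y ∷ xs} (there x∈) b∈ = ∈-++⁺ʳ (f y) (∈-concatMap⁺ f x∈ b∈)

    ∈-concatMap⁻ : ∀ (f : A → List B) xs {b} → b ∈ concatMap f xs → ∃ λ x → x ∈ xs × b ∈ f x
    ∈-concatMap⁻ f (x ∷ xs) b∈ with ∈-++⁻ (f x) b∈
    ... | inj₁ b∈fx = x , here refl , b∈fx
    ... | inj₂ b∈xs with y , y∈ , b∈fy ← ∈-concatMap⁻ f xs b∈xs = y , there y∈ , b∈fy

    concatMap-unique : ∀ (f : A → List B) {R : A → A → Set} {xs} → AllPairs R xs → (∀ {x} → x ∈ xs → Unique (f x)) →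
      (∀ {x y} → x ∈ xs → y ∈ xs → R x y → ∀ {b} → b ∈ f x → b ∈ f y → ⊥) → Unique (concatMap f xs)
    concatMap-unique f {xs = []} [] uf disj = []
    concatMap-unique f {xs = x ∷ xs} (Rx ∷ ap) uf disj = Unique.++⁺ (uf (here refl))
      (concatMap-unique f ap (λ x∈ → uf (there x∈)) (λ x∈ y∈ → disj (there x∈) (there y∈)))
      λ { (b∈ , b∈′) → let (y , y∈ , b∈fy) = ∈-concatMap⁻ f xs b∈′ in disj (here refl) (there y∈) (All.lookup Rx y∈) b∈ b∈fy }

    length-concatMap : ∀ (f : A → List B) k xs → (∀ {x} → x ∈ xs → length (f x) ≡ k) → length (concatMap f xs) ≡ length xs * k
    length-concatMap f k []       eq = refl
    length-concatMap f k (x ∷ xs) eq = trans (length-++ (f x)) (cong₂ _+_ (eq (here refl)) (length-concatMap f k xs (λ x∈ → eq (there x∈))))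

  length-cartesianProduct : ∀ {A B : Set} (xs : List A) (ys : List B) → length (cartesianProduct xs ys) ≡ length xs * length ys
  length-cartesianProduct []       ys = refl
  length-cartesianProduct (x ∷ xs) ys = trans (length-++ (map (x ,_) ys)) (cong₂ _+_ (length-map (x ,_) ys) (length-cartesianProduct xs ys))

  module Orbits {A : Set} (_≟_ : DecidableEquality A) (f : A → A) (xs : List A)
    (closed : ∀ {x} → x ∈ xs → f x ∈ xs)
    (injective : ∀ {x y} → x ∈ xs → y ∈ xs → f x ≡ f y → x ≡ y) where

    iterate-suc : ∀ x k → iterate f x (suc k) ≡ f (iterate f x k)
    iterate-suc x zero    = refl
    iterate-suc x (suc k) = iterate-suc (f x) k

    iterate-+ : ∀ x j k → iterate f x (j + k) ≡ iterate f (iterate f x j) k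
    iterate-+ x zero    k = refl
    iterate-+ x (suc j) k = iterate-+ (f x) j k

    iterate-∈ : ∀ {x} k → x ∈ xs → iterate f x k ∈ xs
    iterate-∈ zero    x∈ = x∈
    iterate-∈ (suc k) x∈ = iterate-∈ k (closed x∈)

    iterate-injective : ∀ k {x y} → x ∈ xs → y ∈ xs → iterate f x k ≡ iterate f y k → x ≡ y
    iterate-injective zero    x∈ y∈ eq = eq
    iterate-injective (suc k) x∈ y∈ eq = injective x∈ y∈ (iterate-injective k (closed x∈) (closed y∈) eq)

    trajectory : A → ℕ → List A
    trajectory x zero    = []
    trajectory x (suc k) = x ∷ trajectory (f x) k

    length-trajectory : ∀ x k → length (trajectory x k) ≡ k
    length-trajectory x zero    = refl
    length-trajectory x (suc k) = cong suc (length-trajectory (f x) k)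

    ∈-trajectory⁻ : ∀ {x y} k → y ∈ trajectory x k → ∃ λ i → i < k × iterate f x i ≡ y
    ∈-trajectory⁻ (suc k) (here refl) = 0 , s≤s z≤n , refl
    ∈-trajectory⁻ (suc k) (there y∈) with i , i<k , eq ← ∈-trajectory⁻ k y∈ = suc i , s≤s i<k , eq

    ∈-trajectory⁺ : ∀ x {i} k → i < k → iterate f x i ∈ trajectory x k
    ∈-trajectory⁺ x {zero}  (suc k) _ = here refl
    ∈-trajectory⁺ x {suc i} (suc k) (s≤s i<k) = there (∈-trajectory⁺ (f x) k i<k)

    open import Data.List.Membership.DecPropositional _≟_ using (_∈?_)

    return-or-unique : ∀ k {x} → x ∈ xs → (∃ λ p → 0 < p × p < k × iterate f x p ≡ x) ⊎ Unique (trajectory x k)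
    return-or-unique zero    x∈ = inj₂ []
    return-or-unique (suc k) {x} x∈ with x ∈? trajectory (f x) k
    ... | yes x∈t with i , i<k , eq ← ∈-trajectory⁻ k x∈t = inj₁ (suc i , s≤s z≤n , s≤s i<k , eq)
    ... | no x∉t with return-or-unique k (closed x∈)
    ...   | inj₁ (p , 0<p , p<k , eq) = inj₁ (p , 0<p , ℕ.m≤n⇒m≤1+n p<k , injective (iterate-∈ p x∈) x∈ (trans (sym (iterate-suc x p)) eq))
    ...   | inj₂ u = inj₂ (All.tabulate (λ y∈ eq → x∉t (subst (_∈ trajectory (f x) k) (sym eq) y∈)) ∷ u)

    return : ∀ {x} → x ∈ xs → ∃ λ p → 0 < p × p ≤ length xs × iterate f x p ≡ x
    return {x} x∈ with return-or-unique (suc (length xs)) x∈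
    ... | inj₁ (p , 0<p , p<k , eq) = p , 0<p , s≤s⁻¹ p<k , eq
    ... | inj₂ u = ⊥-elim (ℕ.<-irrefl refl (subst (_≤ length xs) (length-trajectory x (suc (length xs)))
        (unique-⊆⇒length≤ u λ y∈ → let (i , _ , eq) = ∈-trajectory⁻ (suc (length xs)) y∈ in subst (_∈ xs) eq (iterate-∈ i x∈))))

    iterate-*-period : ∀ x p m → iterate f x p ≡ x → iterate f x (m * p) ≡ x
    iterate-*-period x p zero    eq = refl
    iterate-*-period x p (suc m) eq = trans (iterate-+ x p (m * p)) (trans (cong (λ z → iterate f z (m * p)) eq) (iterate-*-period x p m eq))

    iterate-mod : ∀ x p {{_ : NonZero p}} k → iterate f x p ≡ x → iterate f x k ≡ iterate f x (k % p)
    iterate-mod x p k eq = begin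
      iterate f x k ≡⟨ cong (iterate f x) (trans (m≡m%n+[m/n]*n k p) (ℕ.+-comm (k % p) _)) ⟩
      iterate f x (k / p * p + k % p) ≡⟨ iterate-+ x (k / p * p) (k % p) ⟩
      iterate f (iterate f x (k / p * p)) (k % p) ≡⟨ cong (λ z → iterate f z (k % p)) (iterate-*-period x p (k / p) eq) ⟩
      iterate f x (k % p) ∎
      where open ≡-Reasoning

    shorten : ∀ {x} → x ∈ xs → ∀ k → ∃ λ i → i < length xs × iterate f x i ≡ iterate f x k
    shorten {x} x∈ k with p , 0<p , p≤ , eq ← return x∈ =
      let instance nz = >-nonZero 0<p in k % p , ℕ.<-≤-trans (m%n<n k p) p≤ , sym (iterate-mod x p k eq)

    -- Orbits that meet coincide: from the common point, `k * p ∸ k` further steps lead to `y`,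
    -- where `p` is a period of `y`. `shorten` then brings the exponent below the bound that
    -- `SameFace` demands.
    backwards : ∀ {x y} → x ∈ xs → y ∈ xs → ∀ j k → iterate f x j ≡ iterate f y k → ∃ λ i → i < length xs × iterate f x i ≡ y
    backwards {x} {y} x∈ y∈ j k eq with p , 0<p , p≤ , ret ← return y∈ = result
      where
      m = k * p
      k≤m : k ≤ m
      k≤m = subst (_≤ k * p) (ℕ.*-identityʳ k) (ℕ.*-monoʳ-≤ k 0<p)
      back : iterate f x (j + (m ∸ k)) ≡ y
      back = begin
        iterate f x (j + (m ∸ k)) ≡⟨ iterate-+ x j (m ∸ k) ⟩
        iterate f (iterate f x j) (m ∸ k) ≡⟨ cong (λ z → iterate f z (m ∸ k)) eq ⟩
        iterate f (iterate f y k) (m ∸ k) ≡⟨ iterate-+ y k (m ∸ k) ⟨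
        iterate f y (k + (m ∸ k)) ≡⟨ cong (iterate f y) (ℕ.m+[n∸m]≡n k≤m) ⟩
        iterate f y m ≡⟨ iterate-*-period y p k ret ⟩
        y ∎
        where open ≡-Reasoning
      result : ∃ λ i → i < length xs × iterate f x i ≡ y
      result with i , i< , e ← shorten x∈ (j + (m ∸ k)) = i , i< , trans e back

    unique-trajectory : ∀ {x} → x ∈ xs → ∀ k → (∀ {p} → 0 < p → p < k → iterate f x p ≢ x) → Unique (trajectory x k)
    unique-trajectory x∈ k none with return-or-unique k x∈
    ... | inj₁ (p , 0<p , p<k , eq) = ⊥-elim (none 0<p p<k eq)
    ... | inj₂ u = u

-- Acyclic choices of arrows and their determinant.

module MatrixTree where

  open Determinant
  open Elimination
  open FiniteLists
  open import Data.Bool.Base using (if_then_else_)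
  import Data.Integer.Base as ℤ
  import Data.Integer.Properties as ℤ
  open import Data.List.Base using (List; []; _∷_; _++_; length; map; concatMap)
  open import Data.List.Properties using (length-++; length-map)
  open import Data.List.Relation.Binary.Pointwise.Base as Pointwise using (Pointwise; []; _∷_)
  open import Data.Nat.Base as ℕ using (ℕ; zero; suc)
  open import Data.Rational.Base hiding (NonZero)
  open import Algebra.Definitions.RawSemiring ℚ.+-*-rawSemiring using (_^_)
  import Data.Rational.Unnormalised.Base as ℚᵘ
  import Data.Rational.Unnormalised.Properties as ℚᵘ
  open import Data.Rational.Solver using (module +-*-Solver)
  open +-*-Solver

  ι : ℕ → ℚ
  ι k = ℤ.+ k / 1

  private
    toℚᵘ-ι : ∀ k → toℚᵘ (ι k) ℚᵘ.≃ ℚᵘ.mkℚᵘ (ℤ.+ k) 0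
    toℚᵘ-ι k = ℚ.toℚᵘ-fromℚᵘ (ℚᵘ.mkℚᵘ (ℤ.+ k) 0)

  ι-+ : ∀ a b → ι (a ℕ.+ b) ≡ ι a + ι b
  ι-+ a b = ℚ.toℚᵘ-injective (ℚᵘ.≃-trans (toℚᵘ-ι (a ℕ.+ b)) (ℚᵘ.≃-sym (ℚᵘ.≃-trans (ℚ.toℚᵘ-homo-+ (ι a) (ι b))
    (ℚᵘ.≃-trans (ℚᵘ.+-cong (toℚᵘ-ι a) (toℚᵘ-ι b))
      (ℚᵘ.*≡* (cong (ℤ._* ℤ.+ 1) (cong₂ ℤ._+_ (ℤ.*-identityʳ (ℤ.+ a)) (ℤ.*-identityʳ (ℤ.+ b)))))))))

  ι-* : ∀ a b → ι (a ℕ.* b) ≡ ι a * ι b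
  ι-* zero    b = sym (ℚ.*-zeroˡ (ι b))
  ι-* (suc a) b = begin
    ι (b ℕ.+ a ℕ.* b) ≡⟨ ι-+ b (a ℕ.* b) ⟩
    ι b + ι (a ℕ.* b) ≡⟨ cong (_+_ (ι b)) (ι-* a b) ⟩
    ι b + ι a * ι b ≡⟨ solve 2 (λ a b → b :+ a :* b := (con 1ℚ :+ a) :* b) refl (ι a) (ι b) ⟩
    (1ℚ + ι a) * ι b ≡⟨ cong (_* ι b) (sym (ι-+ 1 a)) ⟩
    ι (suc a) * ι b ∎
    where open ≡-Reasoning

  ι-^ : ∀ a n → ι (a ℕ.^ n) ≡ ι a ^ n
  ι-^ a zero    = refl
  ι-^ a (suc n) = trans (ι-* a (a ℕ.^ n)) (cong (ι a *_) (ι-^ a n))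

  0≤ι : ∀ k → 0ℚ ≤ ι k
  0≤ι zero    = ℚ.≤-refl
  0≤ι (suc k) = subst (0ℚ ≤_) (sym (ι-+ 1 k)) (0≤+ 0≤1 (0≤ι k))

  ι-mono : ∀ {a b} → a ℕ.≤ b → ι a ≤ ι b
  ι-mono {a} {b} a≤b = ≤-from-+ (ι (b ℕ.∸ a)) (0≤ι (b ℕ.∸ a)) (trans (sym (ι-+ a (b ℕ.∸ a))) (cong ι (ℕ.m+[n∸m]≡n a≤b)))

  ι-mono-< : ∀ {a b} → a ℕ.< b → ι a < ι b
  ι-mono-< {a} {b} a<b = ℚ.<-≤-trans (subst (ι a <_) (trans (ℚ.+-comm (ι a) 1ℚ) (sym (ι-+ 1 a)))
    (subst (_< ι a + 1ℚ) (ℚ.+-identityʳ (ι a)) (ℚ.+-monoʳ-< (ι a) (ℚ.positive⁻¹ 1ℚ)))) (ι-mono a<b)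

  ι-cancel-≤ : ∀ {a b} → ι a ≤ ι b → a ℕ.≤ b
  ι-cancel-≤ ιa≤ιb = ℕ.≮⇒≥ λ b<a → ℚ.<-irrefl refl (ℚ.<-≤-trans (ι-mono-< b<a) ιa≤ιb)

  ⅙ : ℚ
  ⅙ = ℤ.+ 1 / 6

  module _ {A : Set} where

    Σ-cong : ∀ (xs : List A) {f g} → (∀ {x} → x ∈ xs → f x ≡ g x) → Σ xs f ≡ Σ xs g
    Σ-cong []       eq = refl
    Σ-cong (x ∷ xs) eq = cong₂ _+_ (eq (here refl)) (Σ-cong xs (λ x∈ → eq (there x∈)))

    Σ-mono : ∀ (xs : List A) {f g} → (∀ {x} → x ∈ xs → f x ≤ g x) → Σ xs f ≤ Σ xs g
    Σ-mono []       f≤g = ℚ.≤-refl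
    Σ-mono (x ∷ xs) f≤g = ℚ.+-mono-≤ (f≤g (here refl)) (Σ-mono xs (λ x∈ → f≤g (there x∈)))

    Σ-const : ∀ (xs : List A) c → Σ xs (λ _ → c) ≡ ι (length xs) * c
    Σ-const []       c = sym (ℚ.*-zeroˡ c)
    Σ-const (x ∷ xs) c = begin
      c + Σ xs (λ _ → c) ≡⟨ cong (_+_ c) (Σ-const xs c) ⟩
      c + ι (length xs) * c ≡⟨ solve 2 (λ c l → c :+ l :* c := (con 1ℚ :+ l) :* c) refl c (ι (length xs)) ⟩
      (1ℚ + ι (length xs)) * c ≡⟨ cong (_* c) (sym (ι-+ 1 (length xs))) ⟩
      ι (suc (length xs)) * c ∎
      where open ≡-Reasoning

    Σ-map : ∀ {B : Set} (g : B → A) xs f → Σ (map g xs) f ≡ Σ xs (f ∘ g)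
    Σ-map g []       f = refl
    Σ-map g (x ∷ xs) f = cong (f (g x) +_) (Σ-map g xs f)

    Σ-+ : ∀ (xs : List A) f g → Σ xs (λ x → f x + g x) ≡ Σ xs f + Σ xs g
    Σ-+ xs f g = trans (Σ-cong xs λ {x} _ → cong (f x +_) (sym (ℚ.*-identityˡ (g x))))
      (trans (Σ-+* xs f 1ℚ g) (cong (Σ xs f +_) (ℚ.*-identityˡ (Σ xs g))))

  Σ-swap : ∀ {A B : Set} (xs : List A) (ys : List B) (f : A → B → ℚ) → Σ xs (λ x → Σ ys (f x)) ≡ Σ ys (λ y → Σ xs (λ x → f x y))
  Σ-swap []       ys f = sym (trans (Σ-const ys 0ℚ) (ℚ.*-zeroʳ (ι (length ys))))
  Σ-swap (x ∷ xs) ys f = trans (cong (Σ ys (f x) +_) (Σ-swap xs ys f)) (sym (Σ-+ ys (f x) _))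

  D-Σ : ∀ {V B : Set} (vs : List V) p u (ys : List B) (a : B → V → ℚ) →
        D vs (p ⊕ u ⊗ λ z → Σ ys (λ y → a y z)) ≡ D vs p + Σ ys (λ y → D vs (p ⊕ u ⊗ a y) - D vs p)
  D-Σ vs p u [] a = trans (D-≗ vs λ x z → solve 2 (λ k l → k :+ l :* con 0ℚ := k) refl (p x z) (u x)) (sym (ℚ.+-identityʳ (D vs p)))
  D-Σ vs p u (y ∷ ys) a = begin
    D vs (p ⊕ u ⊗ λ z → a y z + S z)
      ≡⟨ D-≗ vs (λ x z → cong₂ (λ k l → p x z + u x * (k + l)) (sym (ℚ.*-identityˡ (a y z))) (sym (ℚ.*-identityˡ (S z)))) ⟩
    D vs (p ⊕ u ⊗ λ z → 1ℚ * a y z + 1ℚ * S z)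
      ≡⟨ affineʳ vs p u (a y) S 1ℚ 1ℚ ⟩
    d + 1ℚ * (e - d) + 1ℚ * (D vs (p ⊕ u ⊗ S) - d)
      ≡⟨ cong (λ k → d + 1ℚ * (e - d) + 1ℚ * (k - d)) (D-Σ vs p u ys a) ⟩
    d + 1ℚ * (e - d) + 1ℚ * (d + R - d)
      ≡⟨ solve 3 (λ d e r → d :+ con 1ℚ :* (e :- d) :+ con 1ℚ :* (d :+ r :- d) := d :+ (e :- d :+ r)) refl d e R ⟩
    d + (e - d + R) ∎
    where
    open ≡-Reasoning
    S = λ z → Σ ys (λ y → a y z)
    d = D vs p
    e = D vs (p ⊕ u ⊗ a y)
    R = Σ ys (λ y → D vs (p ⊕ u ⊗ a y) - d)

  module AcyclicChoices {V : Set} (_≟_ : DecidableEquality V) where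

    replace : V → V → V → V
    replace v y z = if does (z ≟ v) then y else z

    replace-≡ : ∀ v y → replace v y v ≡ y
    replace-≡ v y with v ≟ v
    ... | yes _ = refl
    ... | no v≢v = ⊥-elim (v≢v refl)

    replace-≢ : ∀ {v y z} → z ≢ v → replace v y z ≡ z
    replace-≢ {v} {y} {z} z≢v with z ≟ v
    ... | yes z≡v = ⊥-elim (z≢v z≡v)
    ... | no _ = refl

    sixth : V → V → ℚ
    sixth z y = if does (z ≟ y) then ⅙ else 0ℚ

    sixth-≡ : ∀ z → sixth z z ≡ ⅙
    sixth-≡ z with z ≟ z
    ... | yes _ = refl
    ... | no z≢z = ⊥-elim (z≢z refl)

    sixth-≢ : ∀ {z y} → z ≢ y → sixth z y ≡ 0ℚ
    sixth-≢ {z} {y} z≢y with z ≟ y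
    ... | yes z≡y = ⊥-elim (z≢y z≡y)
    ... | no _ = refl

    0≤sixth : ∀ z y → 0ℚ ≤ sixth z y
    0≤sixth z y with z ≟ y
    ... | yes _ = ℚ.nonNegative⁻¹ ⅙
    ... | no _  = ℚ.≤-refl

    -- One step of the random walk that follows a uniformly random entry of
    -- out x, which has length 6.
    step : (V → List V) → Matrix V
    step out x y = Σ (out x) (λ z → sixth z y)

    Σ-sixth≤ : ∀ z {vs} → Unique vs → Σ vs (sixth z) ≤ ⅙
    Σ-sixth≤ z {[]} [] = ℚ.nonNegative⁻¹ ⅙
    Σ-sixth≤ z {v ∷ vs} (v∉ ∷ u) with z ≟ v
    ... | no _ = subst (_≤ ⅙) (sym (ℚ.+-identityˡ _)) (Σ-sixth≤ z u)
    ... | yes refl = ℚ.≤-reflexive (trans (cong (⅙ +_)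
      (trans (Σ-cong vs λ {x} x∈ → sixth-≢ (All.lookup v∉ x∈)) (trans (Σ-const vs 0ℚ) (ℚ.*-zeroʳ (ι (length vs)))))) (ℚ.+-identityʳ ⅙))

    step-substochastic : ∀ {out} → (∀ x → length (out x) ≡ 6) → ∀ {vs} → Unique vs → Substochastic vs (step out)
    step-substochastic {out} six {vs} u = substochastic
      (λ x y → 0≤Σ (out x) (λ z → 0≤sixth z y))
      λ x → begin
        Σ vs (λ y → Σ (out x) (λ z → sixth z y)) ≡⟨ Σ-swap vs (out x) (λ y z → sixth z y) ⟩
        Σ (out x) (λ z → Σ vs (sixth z)) ≤⟨ Σ-mono (out x) (λ {z} _ → Σ-sixth≤ z u) ⟩
        Σ (out x) (λ _ → ⅙) ≡⟨ Σ-const (out x) ⅙ ⟩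
        ι (length (out x)) * ⅙ ≡⟨ cong (λ k → ι k * ⅙) (six x) ⟩
        1ℚ ∎
      where open ℚ.≤-Reasoning

    module _ (out : V → List V) where

      extend : (V → V) → V → (V → List (List V)) → V → List (List V)
      extend r v rest y = if does (r y ≟ v) then [] else map (y ∷_) (rest y)

      -- The choices of one y ∈ out x for every x in vs such that following
      -- x ↦ r y leads out of vs. Once y has been chosen for v, the vertex v is
      -- contracted into r y.
      acyclic : List V → (V → V) → List (List V)
      acyclic []       r = [] ∷ []
      acyclic (v ∷ vs) r = concatMap (extend r v λ y → acyclic vs (replace v (r y) ∘ r)) (out v)

      #acyclic : List V → (V → V) → ℕ
      #acyclic vs r = length (acyclic vs r)

      ι-concatMap : ∀ {A B : Set} (f : A → List B) xs → ι (length (concatMap f xs)) ≡ Σ xs (λ x → ι (length (f x)))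
      ι-concatMap f []       = refl
      ι-concatMap f (x ∷ xs) = trans (cong ι (length-++ (f x))) (trans (ι-+ (length (f x)) _) (cong (ι (length (f x)) +_) (ι-concatMap f xs)))

      -- Contraction of `v` redirects the mass on `v` to `y`, which off `v` is a rank-one update.
      -- The factor 6 undoes the weight contained in `sixth`.
      step-replace : ∀ v y (r : V → V) x {z} → z ≢ v →
        step (map (replace v y ∘ r) ∘ out) x z ≡ step (map r ∘ out) x z + step (map r ∘ out) x v * (ι 6 * sixth y z)
      step-replace v y r x {z} z≢v = begin
        Σ (map (replace v y ∘ r) (out x)) (λ w → sixth w z) ≡⟨ Σ-map (replace v y ∘ r) (out x) _ ⟩
        Σ (out x) (λ w → sixth (replace v y (r w)) z) ≡⟨ Σ-cong (out x) (λ {w} _ → pointwise (r w)) ⟩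
        Σ (out x) (λ w → sixth (r w) z + ι 6 * sixth y z * sixth (r w) v) ≡⟨ Σ-+* (out x) (λ w → sixth (r w) z) (ι 6 * sixth y z) (λ w → sixth (r w) v) ⟩
        Σ (out x) (λ w → sixth (r w) z) + ι 6 * sixth y z * Σ (out x) (λ w → sixth (r w) v)
          ≡⟨ cong₂ (λ k l → k + ι 6 * sixth y z * l) (sym (Σ-map r (out x) _)) (sym (Σ-map r (out x) _)) ⟩
        step (map r ∘ out) x z + ι 6 * sixth y z * step (map r ∘ out) x v
          ≡⟨ cong (step (map r ∘ out) x z +_) (ℚ.*-comm (ι 6 * sixth y z) _) ⟩
        step (map r ∘ out) x z + step (map r ∘ out) x v * (ι 6 * sixth y z) ∎
        where
        open ≡-Reasoning
        pointwise : ∀ w → sixth (replace v y w) z ≡ sixth w z + ι 6 * sixth y z * sixth w v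
        pointwise w with w ≟ v
        ... | yes refl = begin
          sixth y z ≡⟨ solve 1 (λ s → s := con 0ℚ :+ con (ι 6) :* s :* con ⅙) refl (sixth y z) ⟩
          0ℚ + ι 6 * sixth y z * ⅙ ≡⟨ cong (_+ ι 6 * sixth y z * ⅙) (sixth-≢ (λ w≡z → z≢v (sym w≡z))) ⟨
          sixth w z + ι 6 * sixth y z * ⅙ ∎
        ... | no _ = solve 2 (λ s t → s := s :+ t :* con 0ℚ) refl (sixth w z) (ι 6 * sixth y z)

      -- The matrix-tree theorem.
      #acyclic≡D : (∀ x → length (out x) ≡ 6) → ∀ {vs} → Unique vs → ∀ r →
                   ι (#acyclic vs r) ≡ ι 6 ^ length vs * D vs (step (map r ∘ out))
      #acyclic≡D six {[]} _ r = refl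
      #acyclic≡D six {v ∷ vs} (v∉ ∷ u) r = begin
        ι (#acyclic (v ∷ vs) r)
          ≡⟨ ι-concatMap (extend r v λ y → acyclic vs (replace v (r y) ∘ r)) (out v) ⟩
        Σ (out v) (λ y → ι (length (extend r v (λ y → acyclic vs (replace v (r y) ∘ r)) y)))
          -- Each of the six choices is given a sixth of `d`, so that the sum is the affine
          -- expansion `D-Σ` of the recursion for `D`. The last term cancels this share for a choice
          -- that closes a loop at `v`, which has no acyclic completion.
          ≡⟨ Σ-cong (out v) (λ {y} _ → summand y) ⟩
        Σ (out v) (λ y → ι 6 ^ suc (length vs) * (⅙ * d + (D vs (p ⊕ col v p ⊗ sixth (r y)) - d) + (- d) * sixth (r y) v))
          ≡⟨ Σ-scale (out v) (ι 6 ^ suc (length vs)) _ ⟩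
        ι 6 ^ suc (length vs) * Σ (out v) (λ y → ⅙ * d + (D vs (p ⊕ col v p ⊗ sixth (r y)) - d) + (- d) * sixth (r y) v)
          ≡⟨ cong (ι 6 ^ suc (length vs) *_) total ⟩
        ι 6 ^ suc (length vs) * D (v ∷ vs) p ∎
        where
        open ≡-Reasoning
        p = step (map r ∘ out)
        d = D vs p
        6^ = ι 6 ^ length vs
        summand : ∀ y → ι (length (extend r v (λ y → acyclic vs (replace v (r y) ∘ r)) y)) ≡
                  ι 6 ^ suc (length vs) * (⅙ * d + (D vs (p ⊕ col v p ⊗ sixth (r y)) - d) + (- d) * sixth (r y) v)
        summand y with r y ≟ v
        ... | yes ry≡v = sym (begin
          ι 6 * 6^ * (⅙ * d + (D vs (p ⊕ col v p ⊗ sixth (r y)) - d) + (- d) * ⅙)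
            ≡⟨ cong (λ k → ι 6 * 6^ * (⅙ * d + (k - d) + (- d) * ⅙)) (D-cong vs λ {x} {z} _ z∈ →
                 trans (cong (λ k → p x z + p x v * k) (sixth-≢ (λ eq → All.lookup v∉ z∈ (trans (sym ry≡v) eq))))
                       (solve 2 (λ a b → a :+ b :* con 0ℚ := a) refl (p x z) (p x v))) ⟩
          ι 6 * 6^ * (⅙ * d + (d - d) + (- d) * ⅙)
            ≡⟨ solve 2 (λ k d → con (ι 6) :* k :* (con ⅙ :* d :+ (d :- d) :+ (:- d) :* con ⅙) := con 0ℚ) refl 6^ d ⟩
          0ℚ ∎)
        ... | no ry≢v = begin
          ι (length (map (y ∷_) (acyclic vs r′))) ≡⟨ cong ι (length-map (y ∷_) (acyclic vs r′)) ⟩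
          ι (#acyclic vs r′) ≡⟨ #acyclic≡D six u r′ ⟩
          6^ * D vs (step (map r′ ∘ out)) ≡⟨ cong (6^ *_) (D-cong vs λ {x} {z} _ z∈ → step-replace v (r y) r x (λ z≡v → All.lookup v∉ z∈ (sym z≡v))) ⟩
          6^ * D vs (p ⊕ col v p ⊗ (λ z → ι 6 * sixth (r y) z)) ≡⟨ cong (6^ *_) (D-scale vs p (col v p) (sixth (r y)) (ι 6)) ⟩
          6^ * (d + ι 6 * (e - d)) ≡⟨ solve 3 (λ k d e → k :* (d :+ con (ι 6) :* (e :- d)) := con (ι 6) :* k :* (con ⅙ :* d :+ (e :- d) :+ (:- d) :* con 0ℚ)) refl 6^ d e ⟩
          ι 6 * 6^ * (⅙ * d + (e - d) + (- d) * 0ℚ) ∎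
          where
          r′ = replace v (r y) ∘ r
          e = D vs (p ⊕ col v p ⊗ sixth (r y))
        total : Σ (out v) (λ y → ⅙ * d + (D vs (p ⊕ col v p ⊗ sixth (r y)) - d) + (- d) * sixth (r y) v) ≡ D (v ∷ vs) p
        total = begin
          Σ (out v) (λ y → ⅙ * d + B y + (- d) * sixth (r y) v)
            ≡⟨ Σ-+* (out v) (λ y → ⅙ * d + B y) (- d) (λ y → sixth (r y) v) ⟩
          Σ (out v) (λ y → ⅙ * d + B y) + (- d) * Σ (out v) (λ y → sixth (r y) v)
            ≡⟨ cong₂ (λ k l → k + (- d) * l) (trans (Σ-+ (out v) (λ _ → ⅙ * d) B) (cong (_+ Σ (out v) B) const)) (sym (Σ-map r (out v) _)) ⟩
          d + Σ (out v) B + (- d) * p v v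
            ≡⟨ cong (_+ (- d) * p v v) (sym (trans (D-cong vs λ {x} {z} _ _ → cong (λ k → p x z + p x v * k) (Σ-map r (out v) _)) (D-Σ vs p (col v p) (out v) (λ y → sixth (r y))))) ⟩
          D vs (p ⊕ col v p ⊗ row v p) + (- d) * p v v
            ≡⟨ solve 3 (λ e d m → e :+ (:- d) :* m := e :- m :* d) refl (D vs (p ⊕ col v p ⊗ row v p)) d (p v v) ⟩
          D (v ∷ vs) p ∎
          where
          B = λ y → D vs (p ⊕ col v p ⊗ sixth (r y)) - d
          const : Σ (out v) (λ _ → ⅙ * d) ≡ d
          const = begin
            Σ (out v) (λ _ → ⅙ * d) ≡⟨ Σ-const (out v) (⅙ * d) ⟩
            ι (length (out v)) * (⅙ * d) ≡⟨ cong (λ k → ι k * (⅙ * d)) (six v) ⟩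
            ι 6 * (⅙ * d) ≡⟨ solve 1 (λ d → con (ι 6) :* (con ⅙ :* d) := d) refl d ⟩
            d ∎

      -- A lower bound by fixing the arrow `tgt c` at every `c` in `cs` and keeping all choices in
      -- `bs`. The ranks fall along fixed arrows, also after contractions, so these close no cycle;
      -- `r′` follows them to their ends, which the last hypothesis keeps outside `bs`.
      collapse : ∀ cs bs r (tgt : V → V) (rank : V → ℕ) →
        (∀ {c} → c ∈ cs → tgt c ∈ out c × rank (r (tgt c)) ℕ.< rank c × r (tgt c) ∉ bs) →
        ∃ λ r′ → (∀ z → r z ∉ cs → r′ z ≡ r z) × (∀ z → r z ∈ cs → r′ z ∉ bs) × #acyclic bs r′ ℕ.≤ #acyclic (cs ++ bs) r
      collapse [] bs r tgt rank h = r , (λ z _ → refl) , (λ z ()) , ℕ.≤-refl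
      collapse (c ∷ cs) bs r tgt rank h = r′ , keep′ , leave′ , ℕ.≤-trans (proj₂ (proj₂ (proj₂ rec))) more
        where
        r₁ = replace c (r (tgt c)) ∘ r
        hc = h (here refl)
        tc≢c : r (tgt c) ≢ c
        tc≢c eq = ℕ.<-irrefl (cong rank eq) (proj₁ (proj₂ hc))
        h′ : ∀ {c′} → c′ ∈ cs → tgt c′ ∈ out c′ × rank (r₁ (tgt c′)) ℕ.< rank c′ × r₁ (tgt c′) ∉ bs
        h′ {c′} c′∈ with h (there c′∈) | r (tgt c′) ≟ c
        ... | a , b , d | no _ = a , b , d
        ... | a , b , d | yes eq = a , ℕ.<-trans (proj₁ (proj₂ hc)) (subst (λ k → rank k ℕ.< rank c′) eq b) , proj₂ (proj₂ hc)
        rec = collapse cs bs r₁ tgt rank h′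
        r′ = proj₁ rec
        keep = proj₁ (proj₂ rec)
        leave = proj₁ (proj₂ (proj₂ rec))
        keep′ : ∀ z → r z ∉ c ∷ cs → r′ z ≡ r z
        keep′ z rz∉ = trans (keep z (subst (_∉ cs) (sym same) (λ rz∈ → rz∉ (there rz∈)))) same
          where
          same : r₁ z ≡ r z
          same = replace-≢ (λ eq → rz∉ (here eq))
        leave₁ : ∀ z → r₁ z ∉ bs → r′ z ∉ bs
        leave₁ z r₁z∉ with (r₁ z) ∈? cs
          where open DecMembership _≟_ using (_∈?_)
        ... | yes r₁z∈ = leave z r₁z∈
        ... | no  r₁z∉cs = subst (_∉ bs) (sym (keep z r₁z∉cs)) r₁z∉
        leave′ : ∀ z → r z ∈ c ∷ cs → r′ z ∉ bs
        leave′ z (here eq) = leave₁ z (subst (_∉ bs) (sym (trans (cong (replace c (r (tgt c))) eq) (replace-≡ c _))) (proj₂ (proj₂ hc)))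
        leave′ z (there rz∈) with r z ≟ c
        ... | yes eq = leave₁ z (subst (_∉ bs) (sym (trans (cong (replace c (r (tgt c))) eq) (replace-≡ c _))) (proj₂ (proj₂ hc)))
        ... | no neq = leave z (subst (_∈ cs) (sym (replace-≢ neq)) rz∈)
        part≤concatMap : ∀ {A B : Set} (f : A → List B) {x xs} → x ∈ xs → length (f x) ℕ.≤ length (concatMap f xs)
        part≤concatMap f {x} {y ∷ xs} (here refl) = subst (length (f x) ℕ.≤_) (sym (length-++ (f x))) (ℕ.m≤m+n _ _)
        part≤concatMap f {x} {y ∷ xs} (there x∈) = ℕ.≤-trans (part≤concatMap f x∈) (subst (length (concatMap f xs) ℕ.≤_) (sym (length-++ (f y))) (ℕ.m≤n+m _ (length (f y))))
        more : #acyclic (cs ++ bs) r₁ ℕ.≤ #acyclic (c ∷ cs ++ bs) r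
        more = ℕ.≤-trans (ℕ.≤-reflexive same) (part≤concatMap (extend r c (λ y → acyclic (cs ++ bs) (replace c (r y) ∘ r))) (proj₁ hc))
          where
          same : #acyclic (cs ++ bs) r₁ ≡ length (extend r c (λ y → acyclic (cs ++ bs) (replace c (r y) ∘ r)) (tgt c))
          same with r (tgt c) ≟ c
          ... | yes eq = ⊥-elim (tc≢c eq)
          ... | no _   = sym (length-map (tgt c ∷_) (acyclic (cs ++ bs) r₁))

      Ranked : (V → ℕ) → (V → V) → List V → List V → Set
      Ranked rank r = Pointwise (λ x y → rank (r y) ℕ.< rank x)

      Chosen : List V → List V → Set
      Chosen = Pointwise (λ x y → y ∈ out x)

      -- Together with `∈⇒ranked`, this replaces the recursive notion of acyclicity by the existence
      -- of a rank that falls along all arrows. The distance to the root is such a rank for a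
      -- spanning tree.
      ranked⇒∈ : ∀ rank {vs fs} r → Chosen vs fs → Ranked rank r vs fs → fs ∈ acyclic vs r
      ranked⇒∈ rank r [] [] = here refl
      ranked⇒∈ rank {v ∷ vs} {y ∷ fs} r (y∈ ∷ ch) (lt ∷ rk) = ∈-concatMap⁺ _ y∈ step∈
        where
        lower : ∀ {vs fs} → Ranked rank r vs fs → Ranked rank (replace v (r y) ∘ r) vs fs
        lower [] = []
        lower {x ∷ _} {y′ ∷ _} (lt′ ∷ rk) = less ∷ lower rk
          where
          less : rank (replace v (r y) (r y′)) ℕ.< rank x
          less with r y′ ≟ v
          ... | yes eq = ℕ.<-trans lt (subst (λ k → rank k ℕ.< rank x) eq lt′)
          ... | no _ = lt′
        step∈ : y ∷ fs ∈ extend r v (λ y → acyclic vs (replace v (r y) ∘ r)) y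
        step∈ with r y ≟ v
        ... | yes eq = ⊥-elim (ℕ.<-irrefl (cong rank eq) lt)
        ... | no _ = ∈-map⁺ (y ∷_) (ranked⇒∈ rank _ ch (lower rk))

      ∈⇒ranked : ∀ {vs} → Unique vs → ∀ r {fs} → fs ∈ acyclic vs r → Chosen vs fs × ∃ λ rank → Ranked rank r vs fs
      ∈⇒ranked {[]} _ r (here refl) = [] , (λ _ → 0) , []
      ∈⇒ranked {v ∷ vs} (v∉ ∷ u) r {fs} fs∈ with ∈-concatMap⁻ _ (out v) fs∈
      ... | y , y∈ , fs∈y = go fs∈y
        where
        go : fs ∈ extend r v (λ y → acyclic vs (replace v (r y) ∘ r)) y → Chosen (v ∷ vs) fs × ∃ λ rank → Ranked rank r (v ∷ vs) fs
        go fs∈y with r y ≟ v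
        go () | yes _
        ... | no ry≢v with ∈-map⁻ (y ∷_) fs∈y
        ... | gs , gs∈ , refl with ∈⇒ranked u (replace v (r y) ∘ r) gs∈
        ... | ch , rank , rk = (y∈ ∷ ch) , rank′ , first ∷ raise v∉ rk
          where
          -- Doubling the ranks leaves an odd value free directly above `r y`, where the contracted
          -- vertex `v` is inserted.
          rank′ : V → ℕ
          rank′ x = if does (x ≟ v) then suc (rank (r y) ℕ.+ rank (r y)) else rank x ℕ.+ rank x
          first : rank′ (r y) ℕ.< rank′ v
          first with r y ≟ v | v ≟ v
          ... | yes eq | _ = ⊥-elim (ry≢v eq)
          ... | no _ | no v≢v = ⊥-elim (v≢v refl)
          ... | no _ | yes _ = ℕ.≤-refl
          raise : ∀ {vs gs} → All (v ≢_) vs → Ranked rank (replace v (r y) ∘ r) vs gs → Ranked rank′ r vs gs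
          raise [] [] = []
          raise {x ∷ _} {z ∷ _} (v≢x ∷ v∉) (lt ∷ rk) = less ∷ raise v∉ rk
            where
            less : rank′ (r z) ℕ.< rank′ x
            less with x ≟ v
            ... | yes eq = ⊥-elim (v≢x (sym eq))
            ... | no _ with r z ≟ v
            ...   | yes _ = subst (ℕ._≤ rank x ℕ.+ rank x) (cong suc (ℕ.+-suc (rank (r y)) (rank (r y)))) (ℕ.+-mono-≤ lt lt)
            ...   | no _ = ℕ.+-mono-< lt lt

      acyclic-unique : (∀ x → Unique (out x)) → ∀ vs r → Unique (acyclic vs r)
      acyclic-unique uout [] r = [] ∷ []
      acyclic-unique uout (v ∷ vs) r = concatMap-unique e (uout v) (λ {y} _ → ue y) (λ _ _ → clash)
        where
        e = extend r v (λ y → acyclic vs (replace v (r y) ∘ r))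
        head-e : ∀ {y fs} → fs ∈ e y → ∃ λ gs → fs ≡ y ∷ gs
        head-e {y} fs∈ with r y ≟ v
        head-e () | yes _
        ... | no _ with gs , _ , eq ← ∈-map⁻ (y ∷_) fs∈ = gs , eq
        ue : ∀ y → Unique (e y)
        ue y with r y ≟ v
        ... | yes _ = []
        ... | no _ = Unique.map⁺ (λ { refl → refl }) (acyclic-unique uout vs _)
        clash : ∀ {y z} → y ≢ z → ∀ {fs} → fs ∈ e y → fs ∈ e z → ⊥
        clash y≢z fs∈y fs∈z with head-e fs∈y | head-e fs∈z
        ... | gs , refl | .gs , refl = y≢z refl

-- Spanning trees as acyclic choices of parents.

module SpanningTree where

  open MatrixTree
  open FiniteLists
  open import Data.Bool.Base using (if_then_else_)
  open import Data.List.Base using (List; []; _∷_; _++_; _∷ʳ_; length; map; filter; head; last; allFin)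
  open import Data.List.Relation.Binary.Pointwise.Base as Pointwise using (Pointwise; []; _∷_)
  open import Data.List.Relation.Unary.Linked as Linked using (Linked; []; [-]; _∷_)
  open import Data.Maybe.Base using (just)
  open import Data.Nat.Base as ℕ using (ℕ; zero; suc; _≤_; _<_; z≤n; s≤s)
  open import Data.Nat.Induction using (<-rec)
  open import Data.Unit.Base using (⊤; tt)
  open import Relation.Binary.Core using (Rel)
  open import Relation.Binary.Construct.Closure.ReflexiveTransitive as Star using (Star; ε; _◅_; _◅◅_)
  open import Level using (0ℓ)

  module _ {A B : Set} (R : A → B → Set) (functional : ∀ {x x′ y} → R x y → R x′ y → x ≡ x′) where

    -- Counting through a relation instead of an injective map. With one relation read in both
    -- directions, trees and choices are equinumerous although no pair of inverse functions is
    -- constructed.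
    relation⇒length≤ : ∀ {xs ys} → Unique xs → (∀ {x} → x ∈ xs → ∃ λ y → y ∈ ys × R x y) → length xs ≤ length ys
    relation⇒length≤ {[]} [] total = z≤n
    relation⇒length≤ {x ∷ xs} {ys} (x∉ ∷ u) total
      with y , y∈ , xRy ← total (here refl)
      with as , bs , refl ← ∈-∃++ y∈ =
      subst (suc (length xs) ≤_) (sym (length-middle as)) (s≤s (relation⇒length≤ u total′))
      where
      total′ : ∀ {x′} → x′ ∈ xs → ∃ λ y′ → y′ ∈ as ++ bs × R x′ y′
      total′ x′∈ with y′ , y′∈ , x′Ry′ ← total (there x′∈) =
        y′ , remove-middle as y′∈ (λ { refl → All.lookup x∉ x′∈ (functional xRy x′Ry′) }) , x′Ry′

  module _ {A : Set} where

    ∈-subsets⇒⊆ : ∀ (E : List A) {T} → T ∈ subsets E → ∀ {e} → e ∈ T → e ∈ E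
    ∈-subsets⇒⊆ [] (here refl) ()
    ∈-subsets⇒⊆ (x ∷ E) T∈ e∈ with ∈-++⁻ (subsets E) T∈
    ... | inj₁ T∈′ = there (∈-subsets⇒⊆ E T∈′ e∈)
    ... | inj₂ T∈′ with S , S∈ , refl ← ∈-map⁻ (x ∷_) T∈′ with e∈
    ...   | here refl = here refl
    ...   | there e∈S = there (∈-subsets⇒⊆ E S∈ e∈S)

    filter∈subsets : ∀ {P : A → Set} (P? : ∀ x → Dec (P x)) E → filter P? E ∈ subsets E
    filter∈subsets P? [] = here refl
    filter∈subsets P? (x ∷ E) with P? x
    ... | yes _ = ∈-++⁺ʳ (subsets E) (∈-map⁺ (x ∷_) (filter∈subsets P? E))
    ... | no _  = ∈-++⁺ˡ (filter∈subsets P? E)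

    private
      ∷-∉-subsets : ∀ {x : A} {E S} → All (x ≢_) E → x ∷ S ∉ subsets E
      ∷-∉-subsets {E = E} x∉ S∈ = All.lookup x∉ (∈-subsets⇒⊆ E S∈ (here refl)) refl

    subsets-unique : ∀ {E : List A} → Unique E → Unique (subsets E)
    subsets-unique {[]} [] = [] ∷ []
    subsets-unique {x ∷ E} (x∉ ∷ u) = Unique.++⁺ (subsets-unique u) (Unique.map⁺ (λ { refl → refl }) (subsets-unique u))
      λ { (S∈ , S∈′) → let (T , _ , eq) = ∈-map⁻ (x ∷_) S∈′ in ∷-∉-subsets x∉ (subst (_∈ subsets E) eq S∈) }

    ∈-subsets⇒unique : ∀ {E : List A} → Unique E → ∀ {T} → T ∈ subsets E → Unique T
    ∈-subsets⇒unique {[]} [] (here refl) = []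
    ∈-subsets⇒unique {x ∷ E} (x∉ ∷ u) T∈ with ∈-++⁻ (subsets E) T∈
    ... | inj₁ T∈′ = ∈-subsets⇒unique u T∈′
    ... | inj₂ T∈′ with S , S∈ , refl ← ∈-map⁻ (x ∷_) T∈′ =
      All.tabulate (λ e∈ → All.lookup x∉ (∈-subsets⇒⊆ E S∈ e∈)) ∷ ∈-subsets⇒unique u S∈

    -- `τ` counts lists of edges, whereas trees are compared through adjacency; this makes the two
    -- notions of equality agree.
    subsets-extensional : ∀ {E : List A} → Unique E → ∀ {S T} → S ∈ subsets E → T ∈ subsets E →
      (∀ {e} → e ∈ S → e ∈ T) → (∀ {e} → e ∈ T → e ∈ S) → S ≡ T
    subsets-extensional {[]} _ (here refl) (here refl) _ _ = refl
    subsets-extensional {x ∷ E} (x∉ ∷ u) S∈ T∈ S⊆T T⊆S with ∈-++⁻ (subsets E) S∈ | ∈-++⁻ (subsets E) T∈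
    ... | inj₁ S∈′ | inj₁ T∈′ = subsets-extensional u S∈′ T∈′ S⊆T T⊆S
    ... | inj₁ S∈′ | inj₂ T∈′ with _ , _ , refl ← ∈-map⁻ (x ∷_) T∈′ = ⊥-elim (All.lookup x∉ (∈-subsets⇒⊆ E S∈′ (T⊆S (here refl))) refl)
    ... | inj₂ S∈′ | inj₁ T∈′ with _ , _ , refl ← ∈-map⁻ (x ∷_) S∈′ = ⊥-elim (All.lookup x∉ (∈-subsets⇒⊆ E T∈′ (S⊆T (here refl))) refl)
    ... | inj₂ S∈′ | inj₂ T∈′ with S₀ , S₀∈ , refl ← ∈-map⁻ (x ∷_) S∈′ | T₀ , T₀∈ , refl ← ∈-map⁻ (x ∷_) T∈′ =
      cong (x ∷_) (subsets-extensional u S₀∈ T₀∈ (λ e∈ → strip S₀∈ e∈ (S⊆T (there e∈))) (λ e∈ → strip T₀∈ e∈ (T⊆S (there e∈))))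
      where
      strip : ∀ {S T e} → S ∈ subsets E → e ∈ S → e ∈ x ∷ T → e ∈ T
      strip S∈ e∈ (here refl) = ⊥-elim (All.lookup x∉ (∈-subsets⇒⊆ E S∈ e∈) refl)
      strip S∈ e∈ (there e∈T) = e∈T

  data Path {V : Set} (R : Rel V 0ℓ) : V → V → List V → Set where
    [_] : ∀ v → Path R v v (v ∷ [])
    _∷_ : ∀ {u w v p} → R u w → Path R w v p → Path R u v (u ∷ p)

  module _ {V : Set} {R : Rel V 0ℓ} where

    path-suffix : ∀ as {bs u w v} → Path R w v (as ++ u ∷ bs) → Path R u v (u ∷ bs)
    path-suffix [] [ v ] = [ v ]
    path-suffix [] (e ∷ p) = e ∷ p
    path-suffix (a ∷ []) (e ∷ p) = path-suffix [] p
    path-suffix (a ∷ as@(_ ∷ _)) (e ∷ p) = path-suffix as p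

    -- Loop erasure.
    simple : DecidableEquality V → ∀ {u v} → Star R u v → ∃ λ p → Unique p × Path R u v p
    simple _≟_ {u} ε = u ∷ [] , [] ∷ [] , [ u ]
    simple _≟_ {u} (e ◅ s) with p , up , path ← simple _≟_ s with u ∈? p
      where open import Data.List.Membership.DecPropositional _≟_ using (_∈?_)
    ... | yes u∈ with as , bs , refl ← ∈-∃++ u∈ = u ∷ bs , unique-suffix as up , path-suffix as path
    ... | no u∉ = u ∷ p , All.tabulate (λ z∈ eq → u∉ (subst (_∈ p) (sym eq) z∈)) ∷ up , e ∷ path

    path-head : ∀ {u v p} → Path R u v p → head p ≡ just u
    path-head [ v ] = refl
    path-head (e ∷ p) = refl

    path-last : ∀ {u v p} → Path R u v p → last p ≡ just v
    path-last [ v ] = refl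
    path-last (e ∷ p@([ _ ])) = refl
    path-last (e ∷ p@(_ ∷ _)) = path-last p

    path-linked : ∀ {u v p} → Path R u v p → Linked R p
    path-linked [ v ] = [-]
    path-linked (e ∷ p@([ _ ])) = e ∷ [-]
    path-linked (e ∷ p@(_ ∷ _)) = e ∷ path-linked p

    path-linked-∷ʳ : ∀ {u v p z} → Path R u v p → R v z → Linked R (p ∷ʳ z)
    path-linked-∷ʳ [ v ] r = r ∷ [-]
    path-linked-∷ʳ (e ∷ p@([ _ ])) r = e ∷ path-linked-∷ʳ p r
    path-linked-∷ʳ (e ∷ p@(_ ∷ _)) r = e ∷ path-linked-∷ʳ p r

    linked⇒star : ∀ {p u v} → Linked R p → head p ≡ just u → last p ≡ just v → Star R u v
    linked⇒star [-] refl refl = ε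
    linked⇒star (e ∷ l) refl eq = e ◅ linked⇒star l refl eq

  path-map : ∀ {V : Set} {R S : Rel V 0ℓ} → (∀ {x y} → R x y → S x y) → ∀ {u v p} → Path R u v p → Path S u v p
  path-map f [ v ] = [ v ]
  path-map f (e ∷ p) = f e ∷ path-map f p

  -- A function that decreases the rank everywhere except at the root describes
  -- a tree: the edges join x to f x.
  module RankedTree {V : Set} (_≟_ : DecidableEquality V) (root : V) (f : V → V) (rank : V → ℕ)
    (decreasing : ∀ {x} → x ≢ root → rank (f x) < rank x) where

    Down : Rel V 0ℓ
    Down x y = x ≢ root × f x ≡ y

    Edge : Rel V 0ℓ
    Edge x y = Down x y ⊎ Down y x

    edge-sym : ∀ {x y} → Edge x y → Edge y x
    edge-sym (inj₁ d) = inj₂ d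
    edge-sym (inj₂ d) = inj₁ d

    down< : ∀ {x y} → Down x y → rank y < rank x
    down< (x≢ , refl) = decreasing x≢

    to-root : ∀ x → Star Edge x root
    to-root x = <-rec (λ k → ∀ x → rank x ≡ k → Star Edge x root) go (rank x) x refl
      where
      go : ∀ k → (∀ {j} → j < k → ∀ x → rank x ≡ j → Star Edge x root) → ∀ x → rank x ≡ k → Star Edge x root
      go k rec x refl with x ≟ root
      ... | yes refl = ε
      ... | no x≢ = inj₁ (x≢ , refl) ◅ rec (decreasing x≢) (f x) refl

    connected : ∀ u v → ∃ λ p → Unique p × Path Edge u v p
    connected u v = simple _≟_ (to-root u ◅◅ Star.reverse edge-sym (to-root v))

    NonBacktracking : List V → Set
    NonBacktracking (a ∷ b ∷ c ∷ l) = a ≢ c × NonBacktracking (b ∷ c ∷ l)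
    NonBacktracking _ = ⊤

    data Ends (z x : V) : List V → Set where
      here  : Ends z x (z ∷ x ∷ [])
      there : ∀ {a b l} → Ends z x (b ∷ l) → Ends z x (a ∷ b ∷ l)

    -- Each vertex has a single edge downwards. A walk that has just come up along it and does not
    -- turn back must therefore continue upwards, and it gains rank up to its end.
    climbs : ∀ {z x a b l} → Ends z x (a ∷ b ∷ l) → Linked Edge (a ∷ b ∷ l) → NonBacktracking (a ∷ b ∷ l) →
             Down b a → Down x z × rank a < rank x
    climbs here _ _ up = up , down< up
    climbs (there {l = []} ()) lk nb up
    climbs (there {l = c ∷ l} en) (_ ∷ inj₁ d ∷ lk) (a≢c , nb) up = ⊥-elim (a≢c (trans (sym (proj₂ up)) (proj₂ d)))
    climbs (there {l = c ∷ l} en) (_ ∷ lk@(inj₂ up′ ∷ _)) (a≢c , nb) up =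
      let (e , lt) = climbs en lk nb up′ in e , ℕ.<-trans (down< up) lt

    descends : ∀ {z x a b l} → Ends z x (a ∷ b ∷ l) → Linked Edge (a ∷ b ∷ l) → NonBacktracking (a ∷ b ∷ l) →
               Down a b → Down x z ⊎ rank x < rank a
    descends here _ _ d = inj₂ (down< d)
    descends (there {l = []} ()) lk nb d
    descends (there {l = c ∷ l} en) (_ ∷ lk@(inj₂ up ∷ _)) (_ , nb) d = inj₁ (proj₁ (climbs en lk nb up))
    descends (there {l = c ∷ l} en) (_ ∷ lk@(inj₁ d′ ∷ _)) (_ , nb) d with descends en lk nb d′
    ... | inj₁ e = inj₁ e
    ... | inj₂ lt = inj₂ (ℕ.<-trans lt (down< d))

    private
      ends-∷ʳ : ∀ y ys x → ∃ λ z → z ∈ y ∷ ys × Ends z x (y ∷ ys ∷ʳ x)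
      ends-∷ʳ y [] x = y , here refl , here
      ends-∷ʳ y (y′ ∷ ys) x with z , z∈ , en ← ends-∷ʳ y′ ys x = z , there z∈ , there en

      nb-∷ʳ : ∀ {a b c l x} → Unique (a ∷ b ∷ c ∷ l) → All (x ≢_) (b ∷ c ∷ l) → NonBacktracking (a ∷ b ∷ c ∷ l ∷ʳ x)
      nb-∷ʳ {l = []} ((_ ∷ a≢c ∷ _) ∷ u) (x≢b ∷ _) = a≢c , (λ eq → x≢b (sym eq)) , tt
      nb-∷ʳ {l = _ ∷ _} ((_ ∷ a≢c ∷ _) ∷ u) (_ ∷ x∉) = a≢c , nb-∷ʳ u x∉

    no-cycle : ∀ {x xs} → Unique (x ∷ xs) → 2 ≤ length xs → ¬ Linked Edge (x ∷ xs ∷ʳ x)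
    no-cycle {x} {y ∷ z ∷ ws} u@(x∉ ∷ (y∉ ∷ _)) (s≤s (s≤s _)) lk
      with e , e∈ , en ← ends-∷ʳ z ws x = first lk
      where
      nb : NonBacktracking (x ∷ y ∷ z ∷ ws ∷ʳ x)
      nb = nb-∷ʳ u x∉
      first : ¬ Linked Edge (x ∷ y ∷ z ∷ ws ∷ʳ x)
      first lk@(inj₂ up ∷ _) = ℕ.<-irrefl refl (proj₂ (climbs (there (there en)) lk nb up))
      -- A cycle that starts downwards either loses rank all the way round, or returns to `x`
      -- upwards. In the second case its first and its last edge both join `x` to `f x`, so a vertex
      -- is repeated.
      first lk@(inj₁ d ∷ _) with descends (there (there en)) lk nb d
      ... | inj₂ lt = ℕ.<-irrefl refl lt
      ... | inj₁ up = All.lookup y∉ e∈ (trans (sym (proj₂ d)) (proj₂ up))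

  module SpanningTrees {n : ℕ} (E : EdgeSet n) (oriented : ∀ {u v} → (u , v) ∈ E → u Fin.< v) (E! : Unique E) (root : Fin n) where

    open AcyclicChoices {Fin n} Fin._≟_

    neighbours : Fin n → List (Fin n)
    neighbours v = filter (adj? E v) (allFin n)

    others : List (Fin n)
    others = filter (λ v → ¬? (v Fin.≟ root)) (allFin n)

    others-unique : Unique others
    others-unique = Unique.filter⁺ (λ v → ¬? (v Fin.≟ root)) (Unique.allFin⁺ n)

    ∈-others : ∀ {x} → x ≢ root → x ∈ others
    ∈-others {x} x≢ = ∈-filter⁺ (λ v → ¬? (v Fin.≟ root)) (∈-allFin x) x≢

    parent : List (Fin n) → List (Fin n) → Fin n → Fin n
    parent (v ∷ vs) (y ∷ fs) x = if does (x Fin.≟ v) then y else parent vs fs x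
    parent _        _        x = root

    parent-pointwise : ∀ {P : Fin n → Fin n → Set} {vs fs} → Pointwise P vs fs → ∀ {x} → x ∈ vs → P x (parent vs fs x)
    parent-pointwise {vs = v ∷ vs} (p ∷ ps) {x} x∈ with x Fin.≟ v
    ... | yes refl = p
    parent-pointwise (p ∷ ps) (here refl) | no x≢v = ⊥-elim (x≢v refl)
    parent-pointwise (p ∷ ps) (there x∈)  | no _ = parent-pointwise ps x∈

    parent-map : ∀ (f : Fin n → Fin n) vs {x} → x ∈ vs → parent vs (map f vs) x ≡ f x
    parent-map f (v ∷ vs) {x} x∈ with x Fin.≟ v
    ... | yes refl = refl
    parent-map f (v ∷ vs) (here refl) | no x≢v = ⊥-elim (x≢v refl)
    parent-map f (v ∷ vs) (there x∈)  | no _ = parent-map f vs x∈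

    parent-extensional : ∀ {P Q : Fin n → Fin n → Set} {vs fs gs} → Unique vs → Pointwise P vs fs → Pointwise Q vs gs →
      (∀ {x} → x ∈ vs → parent vs fs x ≡ parent vs gs x) → fs ≡ gs
    parent-extensional _ [] [] eq = refl
    parent-extensional {vs = v ∷ vs} {y ∷ fs} {z ∷ gs} (v∉ ∷ u) (_ ∷ ps) (_ ∷ qs) eq = cong₂ _∷_ first (parent-extensional u ps qs rest)
      where
      first : y ≡ z
      first with v Fin.≟ v | eq (here refl)
      ... | yes _ | e = e
      ... | no v≢v | _ = ⊥-elim (v≢v refl)
      rest : ∀ {x} → x ∈ vs → parent vs fs x ≡ parent vs gs x
      rest {x} x∈ with x Fin.≟ v | eq (there x∈)
      ... | yes refl | _ = ⊥-elim (All.lookup v∉ x∈ refl)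
      ... | no _ | e = e

    FromParent : (Fin n → Fin n) → Rel (Fin n) 0ℓ
    FromParent f x y = (x ≢ root × f x ≡ y) ⊎ (y ≢ root × f y ≡ x)

    fromParent? : ∀ f x y → Dec (FromParent f x y)
    fromParent? f x y = (¬? (x Fin.≟ root) ×-dec (f x Fin.≟ y)) ⊎-dec (¬? (y Fin.≟ root) ×-dec (f y Fin.≟ x))

    record Codes (fs : List (Fin n)) (T : EdgeSet n) : Set where
      field
        fs∈  : fs ∈ acyclic neighbours others id
        T∈   : T ∈ subsets E
        sound    : ∀ {x y} → Adj T x y → FromParent (parent others fs) x y
        complete : ∀ {x y} → FromParent (parent others fs) x y → Adj T x y

    open Codes

    codes-functionalˡ : ∀ {fs S T} → Codes fs S → Codes fs T → S ≡ T
    codes-functionalˡ c d = subsets-extensional E! (T∈ c) (T∈ d) (transfer c d) (transfer d c)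
      where
      transfer : ∀ {fs S T} → Codes fs S → Codes fs T → ∀ {e} → e ∈ S → e ∈ T
      transfer c d {u , v} e∈ with complete d (sound c (inj₁ e∈))
      ... | inj₁ e∈T = e∈T
      ... | inj₂ e∈T = contradiction (oriented (∈-subsets⇒⊆ E (T∈ d) e∈T)) (ℕ.<-asym (oriented (∈-subsets⇒⊆ E (T∈ c) e∈)))

    -- By induction on the rank for `f`. If the edge from `x` to `f x` were directed the other way
    -- by `g`, then `g (f x)` would be `x`; but `g` and `f` agree at `f x`, which has smaller rank,
    -- and `f (f x)` cannot be `x`.
    codes-functionalʳ : ∀ {fs gs T} → Codes fs T → Codes gs T → fs ≡ gs
    codes-functionalʳ {fs} {gs} c d
      with chf , rank , rk ← ∈⇒ranked neighbours others-unique id (fs∈ c)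
      with chg , _ ← ∈⇒ranked neighbours others-unique id (fs∈ d)
      = parent-extensional others-unique chf chg (λ {x} x∈ → <-rec Same go (rank x) x (proj₂ (∈-filter⁻ (λ v → ¬? (v Fin.≟ root)) {xs = allFin n} x∈)) refl)
      where
      f = parent others fs
      g = parent others gs
      Same : ℕ → Set
      Same k = ∀ x → x ≢ root → rank x ≡ k → f x ≡ g x
      go : ∀ k → (∀ {j} → j < k → Same j) → Same k
      go k rec x x≢ refl with sound d (complete c (inj₁ (x≢ , refl)))
      ... | inj₁ (_ , gx≡fx) = sym gx≡fx
      ... | inj₂ (fx≢ , gfx≡x) = ⊥-elim (ℕ.<-asym fx<x (subst (λ k → rank k < rank (f x)) (trans (rec fx<x (f x) fx≢ refl) gfx≡x) (parent-pointwise rk (∈-others fx≢))))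
        where fx<x = parent-pointwise rk (∈-others x≢)

    ∈-neighbours : ∀ {x y} → y ∈ neighbours x → Adj E x y
    ∈-neighbours {x} y∈ = proj₂ (∈-filter⁻ (adj? E x) {xs = allFin n} y∈)

    acyclic⇒tree : ∀ {fs} → fs ∈ acyclic neighbours others id → ∃ λ T → T ∈ filter isTree? (subsets E) × Codes fs T
    acyclic⇒tree {fs} fs∈ with ch , rank , rk ← ∈⇒ranked neighbours others-unique id fs∈ =
      T , ∈-filter⁺ isTree? T∈E (T-connected , T-acyclic) , record { fs∈ = fs∈ ; T∈ = T∈E ; sound = T⇒F ; complete = F⇒T }
      where
      f = parent others fs
      open RankedTree Fin._≟_ root f rank (λ x≢ → parent-pointwise rk (∈-others x≢))
      P? = λ (e : Fin n × Fin n) → fromParent? f (proj₁ e) (proj₂ e)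
      T = filter P? E
      T∈E = filter∈subsets P? E
      T⇒F : ∀ {x y} → Adj T x y → FromParent f x y
      T⇒F (inj₁ e∈) = proj₂ (∈-filter⁻ P? {xs = E} e∈)
      T⇒F (inj₂ e∈) = edge-sym (proj₂ (∈-filter⁻ P? {xs = E} e∈))
      adj-sym : ∀ {x y} → Adj E x y → Adj E y x
      adj-sym (inj₁ e) = inj₂ e
      adj-sym (inj₂ e) = inj₁ e
      F⇒E : ∀ {x y} → FromParent f x y → Adj E x y
      F⇒E (inj₁ (x≢ , refl)) = ∈-neighbours (parent-pointwise ch (∈-others x≢))
      F⇒E (inj₂ (y≢ , refl)) = adj-sym (∈-neighbours (parent-pointwise ch (∈-others y≢)))
      F⇒T : ∀ {x y} → FromParent f x y → Adj T x y
      F⇒T F with F⇒E F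
      ... | inj₁ e∈ = inj₁ (∈-filter⁺ P? e∈ F)
      ... | inj₂ e∈ = inj₂ (∈-filter⁺ P? e∈ (edge-sym F))
      T-connected : Connected T
      T-connected u v with p , p! , path ← connected u v =
        p , (p! , Linked.map F⇒T (path-linked path)) , path-head path , path-last path
      T-acyclic : Acyclic T
      T-acyclic x (xs , u , 2≤ , lk) = no-cycle u 2≤ (Linked.map T⇒F lk)

    least : ∀ {P : ℕ → Set} → (∀ k → Dec (P k)) → ∀ k → P k → ∃ λ m → P m × ∀ {j} → j < m → ¬ P j
    least P? k pk with P? 0
    ... | yes p0 = 0 , p0 , λ ()
    least P? zero pk | no ¬p0 = ⊥-elim (¬p0 pk)
    least {P} P? (suc k) pk | no ¬p0 with m , pm , below ← least (P? ∘ suc) k pk = suc m , pm , below′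
      where
      below′ : ∀ {j} → j < suc m → ¬ P j
      below′ {zero}  _ = ¬p0
      below′ {suc j} (s≤s lt) = below lt

    module Tree (T : EdgeSet n) (T∈E : T ∈ subsets E) (tree : IsTree T) where

      Within : ℕ → Fin n → Set
      Within zero    x = x ≡ root
      Within (suc k) x = Within k x ⊎ ∃ λ y → Adj T x y × Within k y

      within? : ∀ k x → Dec (Within k x)
      within? zero    x = x Fin.≟ root
      within? (suc k) x = within? k x ⊎-dec Fin.any? (λ y → adj? T x y ×-dec within? k y)

      star⇒within : ∀ {x} → Star (Adj T) x root → ∃ λ k → Within k x
      star⇒within ε = 0 , refl
      star⇒within (e ◅ s) with k , w ← star⇒within s = suc k , inj₂ (_ , e , w)

      reach : ∀ x → ∃ λ k → Within k x × ∀ {j} → j < k → ¬ Within j x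
      reach x with p , (_ , lk) , hd , lt ← proj₁ tree x root with k , w ← star⇒within (linked⇒star lk hd lt) =
        least (λ k → within? k x) k w

      dist : Fin n → ℕ
      dist x = proj₁ (reach x)

      dist≤ : ∀ {k x} → Within k x → dist x ≤ k
      dist≤ {k} {x} w = ℕ.≮⇒≥ λ k<d → proj₂ (proj₂ (reach x)) k<d w

      -- The condition `x ≢ root` sits inside the existential so that `f` is a total function; its
      -- value at the root is a default.
      closer : ∀ x → ∃ λ y → x ≢ root → Adj T x y × dist y < dist x
      closer x with reach x
      ... | zero  , w , _ = root , λ x≢ → ⊥-elim (x≢ w)
      ... | suc k , inj₁ w , below = ⊥-elim (below ℕ.≤-refl w)
      ... | suc k , inj₂ (y , a , w) , below = y , λ _ → a , s≤s (dist≤ w)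

      f : Fin n → Fin n
      f x = proj₁ (closer x)

      open RankedTree Fin._≟_ root f dist (λ {x} x≢ → proj₂ (proj₂ (closer x) x≢))

      adj-symᵀ : ∀ {x y} → Adj T x y → Adj T y x
      adj-symᵀ (inj₁ e) = inj₂ e
      adj-symᵀ (inj₂ e) = inj₁ e

      F⇒T : ∀ {x y} → Edge x y → Adj T x y
      F⇒T {x} (inj₁ (x≢ , refl)) = proj₁ (proj₂ (closer x) x≢)
      F⇒T {_} {y} (inj₂ (y≢ , refl)) = adj-symᵀ (proj₁ (proj₂ (closer y) y≢))

      T⊆E : ∀ {x y} → Adj T x y → Adj E x y
      T⊆E (inj₁ e) = inj₁ (∈-subsets⇒⊆ E T∈E e)
      T⊆E (inj₂ e) = inj₂ (∈-subsets⇒⊆ E T∈E e)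

      irreflexive : ∀ {x} → ¬ Adj T x x
      irreflexive {x} a with T⊆E a
      ... | inj₁ e = ℕ.<-irrefl refl (oriented e)
      ... | inj₂ e = ℕ.<-irrefl refl (oriented e)

      -- An edge of T that is not an edge {x , f x} would close a cycle.
      T⇒F : ∀ {x y} → Adj T x y → Edge x y
      T⇒F {x} {y} a with p , p! , path ← connected x y with path
      ... | [ _ ] = ⊥-elim (irreflexive a)
      ... | e ∷ [ _ ] = e
      ... | e ∷ e′ ∷ rest = ⊥-elim (proj₂ tree x (_ , p! , long rest ,
              path-linked-∷ʳ (path-map F⇒T (e ∷ e′ ∷ rest)) (adj-symᵀ a)))
        where
        long : ∀ {z u q} → Path Edge z u q → 2 ≤ length (x ∷ q)
        long [ _ ] = s≤s (s≤s z≤n)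
        long (_ ∷ _) = s≤s (s≤s z≤n)

      fs : List (Fin n)
      fs = map f others

      f≗ : ∀ {x} → x ≢ root → parent others fs x ≡ f x
      f≗ x≢ = parent-map f others (∈-others x≢)

      pointwise-map : ∀ {P : Fin n → Fin n → Set} vs → (∀ {x} → x ∈ vs → P x (f x)) → Pointwise P vs (map f vs)
      pointwise-map []       h = []
      pointwise-map (v ∷ vs) h = h (here refl) ∷ pointwise-map vs (λ x∈ → h (there x∈))

      ∈others⇒≢ : ∀ {x} → x ∈ others → x ≢ root
      ∈others⇒≢ x∈ = proj₂ (∈-filter⁻ (λ v → ¬? (v Fin.≟ root)) {xs = allFin n} x∈)

      fs∈acyclic : fs ∈ acyclic neighbours others id
      fs∈acyclic = ranked⇒∈ neighbours dist id
        (pointwise-map others λ {x} x∈ → ∈-filter⁺ (adj? E x) (∈-allFin (f x)) (T⊆E (proj₁ (proj₂ (closer x) (∈others⇒≢ x∈)))))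
        (pointwise-map others λ {x} x∈ → proj₂ (proj₂ (closer x) (∈others⇒≢ x∈)))

      codes : Codes fs T
      codes = record { fs∈ = fs∈acyclic ; T∈ = T∈E
        ; sound = λ a → to (T⇒F a)
        ; complete = λ F → F⇒T (from F) }
        where
        to : ∀ {x y} → Edge x y → FromParent (parent others fs) x y
        to (inj₁ (x≢ , eq)) = inj₁ (x≢ , trans (f≗ x≢) eq)
        to (inj₂ (y≢ , eq)) = inj₂ (y≢ , trans (f≗ y≢) eq)
        from : ∀ {x y} → FromParent (parent others fs) x y → Edge x y
        from (inj₁ (x≢ , eq)) = inj₁ (x≢ , trans (sym (f≗ x≢)) eq)
        from (inj₂ (y≢ , eq)) = inj₂ (y≢ , trans (sym (f≗ y≢)) eq)

    neighbours-unique : ∀ x → Unique (neighbours x)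
    neighbours-unique x = Unique.filter⁺ (adj? E x) (Unique.allFin⁺ n)

    τ≡#acyclic : τ E ≡ #acyclic neighbours others id
    τ≡#acyclic = ℕ.≤-antisym
      (relation⇒length≤ (λ T fs → Codes fs T) codes-functionalˡ (Unique.filter⁺ isTree? (subsets-unique E!))
        λ {T} T∈ → let (T∈E , tree) = ∈-filter⁻ isTree? {xs = subsets E} T∈ in
          Tree.fs T T∈E tree , Tree.fs∈acyclic T T∈E tree , Tree.codes T T∈E tree)
      (relation⇒length≤ Codes codes-functionalʳ (acyclic-unique neighbours neighbours-unique others id) acyclic⇒tree)

-- Rotation systems: darts, faces and Euler's formula.

module RotationSystems where

  open FiniteLists
  open SpanningTree
  open import Data.List.Base using (List; []; _∷_; length; map; filter; concatMap; allFin; deduplicate)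
  open import Data.List.Properties using (length-++; length-map; length-tabulate)
  import Data.List.Relation.Unary.AllPairs.Properties as AllPairs
  open import Data.Nat.Base as ℕ using (ℕ; zero; suc; _+_; _*_; _≤_; _<_; z≤n; s≤s; >-nonZero)
  open import Data.Nat.DivMod using (m%n<n)
  open import Data.Nat.Solver using (module +-*-Solver)
  import Data.Product.Properties as Product
  import Relation.Unary as U
  open +-*-Solver

  filter-partition : ∀ {A : Set} {P : A → Set} (P? : U.Decidable P) xs →
    length (filter P? xs) + length (filter (¬? ∘ P?) xs) ≡ length xs
  filter-partition P? [] = refl
  filter-partition P? (x ∷ xs) with P? x
  ... | yes _ = cong suc (filter-partition P? xs)
  ... | no _  = trans (ℕ.+-suc (length (filter P? xs)) _) (cong suc (filter-partition P? xs))

  module _ {A : Set} {R : A → A → Set} (R? : ∀ x y → Dec (R x y)) where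

    deduplicate-pairs : ∀ xs → AllPairs (λ x y → ¬ R x y) (deduplicate R? xs)
    deduplicate-pairs [] = []
    deduplicate-pairs (x ∷ xs) = All.all-filter (¬? ∘ R? x) (deduplicate R? xs) ∷ AllPairs.filter⁺ (¬? ∘ R? x) (deduplicate-pairs xs)

    deduplicate-⊆ : ∀ xs {x} → x ∈ deduplicate R? xs → x ∈ xs
    deduplicate-⊆ (y ∷ xs) (here refl) = here refl
    deduplicate-⊆ (y ∷ xs) (there x∈) = there (deduplicate-⊆ xs (proj₁ (∈-filter⁻ (¬? ∘ R? y) {xs = deduplicate R? xs} x∈)))

  module Rotation {n : ℕ} (E : EdgeSet n) (oriented : ∀ {u v} → (u , v) ∈ E → u Fin.< v) (E! : Unique E)
    (ρ : RotationSystem n) (rotation : IsRotation E ρ) (regular : Regular E 6) where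

    Dart : Set
    Dart = Fin n × Fin n

    _≟ᴰ_ : DecidableEquality Dart
    _≟ᴰ_ = Product.≡-dec Fin._≟_ Fin._≟_

    neighbours : Fin n → List (Fin n)
    neighbours v = filter (adj? E v) (allFin n)

    neighbours-unique : ∀ v → Unique (neighbours v)
    neighbours-unique v = Unique.filter⁺ (adj? E v) (Unique.allFin⁺ n)

    ∈-neighbours⁺ : ∀ {v u} → Adj E v u → u ∈ neighbours v
    ∈-neighbours⁺ {v} {u} a = ∈-filter⁺ (adj? E v) (∈-allFin u) a

    ∈-neighbours⁻ : ∀ {v u} → u ∈ neighbours v → Adj E v u
    ∈-neighbours⁻ {v} u∈ = proj₂ (∈-filter⁻ (adj? E v) {xs = allFin n} u∈)

    adj-sym : ∀ {u v} → Adj E u v → Adj E v u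
    adj-sym (inj₁ e) = inj₂ e
    adj-sym (inj₂ e) = inj₁ e

    adj-irreflexive : ∀ {v} → ¬ Adj E v v
    adj-irreflexive (inj₁ e) = ℕ.<-irrefl refl (oriented e)
    adj-irreflexive (inj₂ e) = ℕ.<-irrefl refl (oriented e)

    Darts : List Dart
    Darts = darts E ρ

    ∈-darts⁺ : ∀ {u v} → Adj E u v → (u , v) ∈ Darts
    ∈-darts⁺ (inj₁ e) = ∈-++⁺ˡ e
    ∈-darts⁺ (inj₂ e) = ∈-++⁺ʳ E (∈-map⁺ swap e)

    ∈-darts⁻ : ∀ {u v} → (u , v) ∈ Darts → Adj E u v
    ∈-darts⁻ d∈ with ∈-++⁻ E d∈
    ... | inj₁ e = inj₁ e
    ... | inj₂ e with (v , u) , e∈ , refl ← ∈-map⁻ swap e = inj₂ e∈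

    darts-unique : Unique Darts
    darts-unique = Unique.++⁺ E! (Unique.map⁺ (λ { refl → refl }) E!)
      λ { (e∈ , e∈′) → opposite e∈ e∈′ }
      where
      opposite : ∀ {d} → d ∈ E → d ∈ map swap E → ⊥
      opposite d∈ d∈′ with (u , v) , e∈ , refl ← ∈-map⁻ swap d∈′ = ℕ.<-asym (oriented d∈) (oriented e∈)

    length-darts : length Darts ≡ n * 6
    length-darts = trans (unique-⊆⊇⇒length≡ darts-unique stars-unique to from)
      (trans (length-concatMap star 6 (allFin n) (λ {v} _ → trans (length-map (v ,_) (neighbours v)) (regular v))) (cong (_* 6) (length-tabulate {n = n} id)))
      where
      star : Fin n → List Dart
      star v = map (v ,_) (neighbours v)
      stars-unique : Unique (concatMap star (allFin n))
      stars-unique = concatMap-unique star (Unique.allFin⁺ n) (λ {v} _ → Unique.map⁺ (λ { refl → refl }) (neighbours-unique v))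
        λ {x} {y} _ _ x≢y b∈ b∈′ → clash x y x≢y b∈ b∈′
        where
        clash : ∀ x y → x ≢ y → ∀ {b} → b ∈ star x → b ∈ star y → ⊥
        clash x y x≢y b∈ b∈′ with _ , _ , refl ← ∈-map⁻ (x ,_) b∈ | _ , _ , refl ← ∈-map⁻ (y ,_) b∈′ = x≢y refl
      to : ∀ {d} → d ∈ Darts → d ∈ concatMap star (allFin n)
      to {u , v} d∈ = ∈-concatMap⁺ star (∈-allFin u) (∈-map⁺ (u ,_) (∈-neighbours⁺ (∈-darts⁻ d∈)))
      from : ∀ {d} → d ∈ concatMap star (allFin n) → d ∈ Darts
      from d∈ with v , _ , d∈v ← ∈-concatMap⁻ star (allFin n) d∈ with u , u∈ , refl ← ∈-map⁻ (v ,_) d∈v = ∈-darts⁺ (∈-neighbours⁻ u∈)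

    length-edges : length E ≡ n * 3
    length-edges = ℕ.*-cancelʳ-≡ (length E) (n * 3) 2 (begin
      length E * 2 ≡⟨ solve 1 (λ e → e :* con 2 := e :+ e) refl (length E) ⟩
      length E + length E ≡⟨ cong (length E +_) (length-map swap E) ⟨
      length E + length (map swap E) ≡⟨ length-++ E ⟨
      length Darts ≡⟨ length-darts ⟩
      n * 6 ≡⟨ ℕ.*-assoc n 3 2 ⟨
      n * 3 * 2 ∎)
      where open ≡-Reasoning

    module Around (v : Fin n) where

      private
        f = next ρ v
        N = neighbours v

      closed : ∀ {u} → u ∈ N → f u ∈ N
      closed {u} u∈ = ∈-neighbours⁺ (proj₁ (rotation v u (∈-neighbours⁻ u∈)))

      private
        iterate-suc′ : ∀ x k → iterate f (f x) k ≡ f (iterate f x k)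
        iterate-suc′ x zero    = refl
        iterate-suc′ x (suc k) = iterate-suc′ (f x) k

        iterate-closed : ∀ {x} k → x ∈ N → iterate f x k ∈ N
        iterate-closed zero    x∈ = x∈
        iterate-closed (suc k) x∈ = iterate-closed k (closed x∈)

        -- The rotation leads from `f w` back to `w`, and the last step of this journey exhibits `w`
        -- as a value of `f`.
        surjective : ∀ {w} → w ∈ N → w ∈ map f N
        surjective {w} w∈ with k , eq ← proj₂ (rotation v (f w) (∈-neighbours⁻ (closed w∈))) w (∈-neighbours⁻ w∈) =
          subst (_∈ map f N) (trans (sym (iterate-suc′ w (toℕ k))) eq) (∈-map⁺ f (iterate-closed (toℕ k) w∈))

      injective : ∀ {x y} → x ∈ N → y ∈ N → f x ≡ f y → x ≡ y
      injective = unique-map⁻ f (proj₁ (⊆-length≤⇒unique Fin._≟_ (neighbours-unique v) surjective (ℕ.≤-reflexive (length-map f N))))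

      open Orbits Fin._≟_ f N closed injective public

      private
        -- A return time is bounded by the number of neighbours, and it is no smaller because one
        -- period already meets all of them.
        period : ∀ {u} → u ∈ N → ∃ λ p → p ≡ 6 × iterate f u p ≡ u × (∀ {w} → w ∈ N → w ∈ trajectory u p)
        period {u} u∈ with p , 0<p , p≤ , eq ← return u∈ = p , ℕ.≤-antisym (subst (p ≤_) (regular v) p≤) 6≤p , eq , covers
          where
          covers : ∀ {w} → w ∈ N → w ∈ trajectory u p
          covers w∈ with k , eq′ ← proj₂ (rotation v u (∈-neighbours⁻ u∈)) _ (∈-neighbours⁻ w∈) =
            let instance nz = >-nonZero 0<p in
            subst (_∈ trajectory u p) (trans (sym (iterate-mod u p (toℕ k) eq)) eq′) (∈-trajectory⁺ u p (m%n<n (toℕ k) p))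
          6≤p : 6 ≤ p
          6≤p = subst₂ _≤_ (regular v) (length-trajectory u p) (unique-⊆⇒length≤ (neighbours-unique v) covers)

      period-6 : ∀ {u} → u ∈ N → iterate f u 6 ≡ u
      period-6 {u} u∈ = subst (λ p → iterate f u p ≡ u) (proj₁ (proj₂ (period u∈))) (proj₁ (proj₂ (proj₂ (period u∈))))

      trajectory-6-unique : ∀ {u} → u ∈ N → Unique (trajectory u 6)
      trajectory-6-unique {u} u∈ = proj₁ (⊆-length≤⇒unique Fin._≟_ (neighbours-unique v)
        (λ {w} w∈ → subst (λ p → w ∈ trajectory u p) (proj₁ (proj₂ (period u∈))) (proj₂ (proj₂ (proj₂ (period u∈))) w∈))
        (ℕ.≤-reflexive (trans (length-trajectory u 6) (sym (regular v)))))

      trajectory-⊆ : ∀ {u k w} → u ∈ N → w ∈ trajectory u k → w ∈ N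
      trajectory-⊆ {u} {k} u∈ w∈ with i , _ , eq ← ∈-trajectory⁻ k w∈ = subst (_∈ N) eq (iterate-∈ i u∈)

    rot : Dart → Dart
    rot (u , v) = u , next ρ u v

    rot-closed : ∀ {d} → d ∈ Darts → rot d ∈ Darts
    rot-closed {u , v} d∈ = ∈-darts⁺ (∈-neighbours⁻ (Around.closed u (∈-neighbours⁺ (∈-darts⁻ d∈))))

    rot-injective : ∀ {d e} → d ∈ Darts → e ∈ Darts → rot d ≡ rot e → d ≡ e
    rot-injective {u , v} {u′ , v′} d∈ e∈ eq = same (cong proj₁ eq) (cong proj₂ eq) d∈ e∈
      where
      same : u ≡ u′ → next ρ u v ≡ next ρ u′ v′ → (u , v) ∈ Darts → (u′ , v′) ∈ Darts → (u , v) ≡ (u′ , v′)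
      same refl eq d∈ e∈ = cong (u ,_) (Around.injective u (∈-neighbours⁺ (∈-darts⁻ d∈)) (∈-neighbours⁺ (∈-darts⁻ e∈)) eq)

    rot-6 : ∀ {d} → d ∈ Darts → rot (rot (rot (rot (rot (rot d))))) ≡ d
    rot-6 {u , v} d∈ = cong (u ,_) (Around.period-6 u (∈-neighbours⁺ (∈-darts⁻ d∈)))

    swap-closed : ∀ {d} → d ∈ Darts → swap d ∈ Darts
    swap-closed d∈ = ∈-darts⁺ (adj-sym (∈-darts⁻ d∈))

    φ : Dart → Dart
    φ = faceStep E ρ

    φ-closed : ∀ {d} → d ∈ Darts → φ d ∈ Darts
    φ-closed d∈ = rot-closed (swap-closed d∈)

    φ-injective : ∀ {d e} → d ∈ Darts → e ∈ Darts → φ d ≡ φ e → d ≡ e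
    φ-injective d∈ e∈ eq = cong swap (rot-injective (swap-closed d∈) (swap-closed e∈) eq)

    module Face = Orbits _≟ᴰ_ φ Darts φ-closed φ-injective

    Triangular : Dart → Set
    Triangular d = iterate φ d 3 ≡ d

    triangular? : U.Decidable Triangular
    triangular? d = iterate φ d 3 ≟ᴰ d

    private
      φ-1 : ∀ {d} → d ∈ Darts → iterate φ d 1 ≢ d
      φ-1 {u , v} d∈ eq = adj-irreflexive (subst (λ w → Adj E w v) (sym (cong proj₁ eq)) (∈-darts⁻ d∈))

      first≢second : ∀ {A : Set} {a b : A} {xs} → Unique (a ∷ b ∷ xs) → a ≢ b
      first≢second ((a≢b ∷ _) ∷ _) = a≢b

      -- Otherwise the neighbour that follows `u` around `v` would be `u` itself, whereas the
      -- rotation at `v` passes through six distinct neighbours.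
      φ-2 : ∀ {d} → d ∈ Darts → iterate φ d 2 ≢ d
      φ-2 {u , v} d∈ eq = first≢second (Around.trajectory-6-unique v (∈-neighbours⁺ (adj-sym (∈-darts⁻ d∈)))) (sym (cong proj₁ eq))

    trajectory-3-unique : ∀ {d} → d ∈ Darts → Unique (Face.trajectory d 3)
    trajectory-3-unique {d} d∈ = Face.unique-trajectory d∈ 3 λ
      { {suc zero} _ _ → φ-1 d∈ ; {suc (suc zero)} _ _ → φ-2 d∈ ; {suc (suc (suc _))} _ (s≤s (s≤s (s≤s ()))) }

    trajectory-4-unique : ∀ {d} → d ∈ Darts → ¬ Triangular d → Unique (Face.trajectory d 4)
    trajectory-4-unique {d} d∈ ¬t = Face.unique-trajectory d∈ 4 λ
      { {suc zero} _ _ → φ-1 d∈ ; {suc (suc zero)} _ _ → φ-2 d∈ ; {suc (suc (suc zero))} _ _ → ¬t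
      ; {suc (suc (suc (suc _)))} _ (s≤s (s≤s (s≤s (s≤s ())))) }

    private
      shift-3 : ∀ d i → iterate φ (iterate φ d i) 3 ≡ iterate φ (iterate φ d 3) i
      shift-3 d i = trans (sym (Face.iterate-+ d i 3)) (trans (cong (iterate φ d) (ℕ.+-comm i 3)) (Face.iterate-+ d 3 i))

    triangular-iterate : ∀ {d} i → Triangular d → Triangular (iterate φ d i)
    triangular-iterate {d} i t = trans (shift-3 d i) (cong (λ z → iterate φ z i) t)

    triangular-iterate⁻ : ∀ {d} i → d ∈ Darts → Triangular (iterate φ d i) → Triangular d
    triangular-iterate⁻ {d} i d∈ t = Face.iterate-injective i (Face.iterate-∈ 3 d∈) d∈ (trans (sym (shift-3 d i)) t)

    representatives : List Dart
    representatives = deduplicate (sameFace? E ρ) Darts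

    sameFace⁺ : ∀ {d e} i → i < length Darts → iterate φ d i ≡ e → SameFace E ρ d e
    sameFace⁺ {d} i i< eq = fromℕ< i< , trans (cong (iterate φ d) (Fin.toℕ-fromℕ< i<)) eq

    orbits-disjoint : ∀ k {d e} → d ∈ Darts → e ∈ Darts → ¬ SameFace E ρ d e → ∀ {b} → b ∈ Face.trajectory d k → b ∈ Face.trajectory e k → ⊥
    orbits-disjoint k d∈ e∈ ¬same b∈ b∈′ with i , _ , refl ← Face.∈-trajectory⁻ k b∈ | j , _ , eq ← Face.∈-trajectory⁻ k b∈′
      with l , l< , eq′ ← Face.backwards d∈ e∈ i j (sym eq) = ¬same (sameFace⁺ l l< eq′)

    module _ {P : Dart → Set} (P? : U.Decidable P) (P-iterate : ∀ {d} i → d ∈ Darts → P d → P (iterate φ d i))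
      (k : ℕ) (unique : ∀ {d} → d ∈ Darts → P d → Unique (Face.trajectory d k)) where

      -- The first `k` darts from each representative are distinct, they share the property `P`, and
      -- those of different faces are disjoint.
      representatives-*≤ : length (filter P? representatives) * k ≤ length (filter P? Darts)
      representatives-*≤ = subst (_≤ length (filter P? Darts))
        (length-concatMap traj k reps (λ {d} _ → Face.length-trajectory d k))
        (unique-⊆⇒length≤ (concatMap-unique traj (AllPairs.filter⁺ P? (deduplicate-pairs (sameFace? E ρ) Darts))
            (λ d∈ → unique (∈D d∈) (∈P d∈)) (λ d∈ e∈ → orbits-disjoint k (∈D d∈) (∈D e∈)))
          λ b∈ → let (d , d∈ , b∈d) = ∈-concatMap⁻ traj reps b∈ ; (i , _ , eq) = Face.∈-trajectory⁻ k b∈d in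
            subst (_∈ filter P? Darts) eq (∈-filter⁺ P? (Face.iterate-∈ i (∈D d∈)) (P-iterate i (∈D d∈) (∈P d∈))))
        where
        traj = λ d → Face.trajectory d k
        reps = filter P? representatives
        ∈P : ∀ {d} → d ∈ reps → P d
        ∈P d∈ = proj₂ (∈-filter⁻ P? {xs = representatives} d∈)
        ∈D : ∀ {d} → d ∈ reps → d ∈ Darts
        ∈D d∈ = deduplicate-⊆ (sameFace? E ρ) Darts (proj₁ (∈-filter⁻ P? {xs = representatives} d∈))

    nonTriangular : List Dart
    nonTriangular = filter (¬? ∘ triangular?) Darts

    -- A triangle has three darts and any other face at least four. Hence twelve times the number of
    -- faces is at most four times the darts on triangles plus three times the others, which falls
    -- short of four times all 6n darts by one for each non-triangular dart.
    faces-bound : faces E ρ * 12 + length nonTriangular ≤ n * 24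
    faces-bound = begin
      faces E ρ * 12 + b ≡⟨ cong (λ k → k * 12 + b) (filter-partition triangular? representatives) ⟨
      (rt + rb) * 12 + b ≡⟨ solve 3 (λ rt rb b → (rt :+ rb) :* con 12 :+ b := con 4 :* (rt :* con 3) :+ con 3 :* (rb :* con 4) :+ b) refl rt rb b ⟩
      4 * (rt * 3) + 3 * (rb * 4) + b ≤⟨ ℕ.+-monoˡ-≤ b (ℕ.+-mono-≤
          (ℕ.*-monoʳ-≤ 4 (representatives-*≤ triangular? (λ i _ → triangular-iterate i) 3 (λ d∈ _ → trajectory-3-unique d∈)))
          (ℕ.*-monoʳ-≤ 3 (representatives-*≤ (¬? ∘ triangular?) (λ i d∈ ¬t t → ¬t (triangular-iterate⁻ i d∈ t)) 4 trajectory-4-unique))) ⟩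
      4 * t + 3 * b + b ≡⟨ solve 2 (λ t b → con 4 :* t :+ con 3 :* b :+ b := con 4 :* (t :+ b)) refl t b ⟩
      4 * (t + b) ≡⟨ cong (4 *_) (trans (filter-partition triangular? Darts) length-darts) ⟩
      4 * (n * 6) ≡⟨ solve 1 (λ n → con 4 :* (n :* con 6) := n :* con 24) refl n ⟩
      n * 24 ∎
      where
      open ℕ.≤-Reasoning
      rt = length (filter triangular? representatives)
      rb = length (filter (¬? ∘ triangular?) representatives)
      t = length (filter triangular? Darts)
      b = length nonTriangular

    -- Euler's formula with 3n edges. In a 6-regular graph only the non-triangular faces can absorb
    -- the Euler characteristic, so their number is bounded by the genus, independently of n.
    nonTriangular-bound : ∀ {h} → HasGenus E ρ h → length nonTriangular + 24 ≤ 24 * h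
    nonTriangular-bound {h} genus = ℕ.+-cancelˡ-≤ (n * 36) _ _ (begin
      n * 36 + (b + 24) ≡⟨ solve 2 (λ n b → n :* con 36 :+ (b :+ con 24) := (n :* con 3 :+ con 2) :* con 12 :+ b) refl n b ⟩
      (n * 3 + 2) * 12 + b ≡⟨ cong (λ k → (k + 2) * 12 + b) length-edges ⟨
      (length E + 2) * 12 + b ≡⟨ cong (λ k → k * 12 + b) genus ⟨
      (n + faces E ρ + 2 * h) * 12 + b ≡⟨ solve 4 (λ n f h b → (n :+ f :+ con 2 :* h) :* con 12 :+ b := f :* con 12 :+ b :+ (n :* con 12 :+ con 24 :* h)) refl n (faces E ρ) h b ⟩
      faces E ρ * 12 + b + (n * 12 + 24 * h) ≤⟨ ℕ.+-monoˡ-≤ (n * 12 + 24 * h) faces-bound ⟩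
      n * 24 + (n * 12 + 24 * h) ≡⟨ solve 2 (λ n h → n :* con 24 :+ (n :* con 12 :+ con 24 :* h) := n :* con 36 :+ con 24 :* h) refl n h ⟩
      n * 36 + 24 * h ∎)
      where
      open ℕ.≤-Reasoning
      b = length nonTriangular

    all-triangular⇒faces : (∀ {d} → d ∈ Darts → Triangular d) → faces E ρ ≡ n * 2
    all-triangular⇒faces tri = ℕ.≤-antisym upper lower
      where
      upper : faces E ρ ≤ n * 2
      upper = ℕ.*-cancelʳ-≤ (faces E ρ) (n * 2) 12 (ℕ.≤-trans (ℕ.m≤m+n _ (length nonTriangular))
        (ℕ.≤-trans faces-bound (ℕ.≤-reflexive (solve 1 (λ n → n :* con 24 := n :* con 2 :* con 12) refl n))))
      deduplicate-covers-on : ∀ {d} → d ∈ Darts → ∃ λ e → e ∈ representatives × SameFace E ρ e d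
      deduplicate-covers-on = go Darts id
        where
        go : ∀ ds → (∀ {d} → d ∈ ds → d ∈ Darts) → ∀ {d} → d ∈ ds → ∃ λ e → e ∈ deduplicate (sameFace? E ρ) ds × SameFace E ρ e d
        go (x ∷ ds) sub (here refl) = x , here refl , sameFace⁺ 0 (nonempty (sub (here refl))) refl
          where
          nonempty : ∀ {x : Dart} {xs} → x ∈ xs → 0 < length xs
          nonempty (here _)  = s≤s z≤n
          nonempty (there _) = s≤s z≤n
        go (x ∷ ds) sub (there y∈) with z , z∈ , (j , zy) ← go ds (λ d∈ → sub (there d∈)) y∈ with sameFace? E ρ x z
        ... | no ¬xz = z , there (∈-filter⁺ (¬? ∘ sameFace? E ρ x) z∈ ¬xz) , (j , zy)
        -- The concatenation of two orbits can exceed the exponent bound of `SameFace`, so it is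
        -- reduced by a period.
        ... | yes (i , xz) with l , l< , eq ← Face.shorten (sub (here refl)) (toℕ i + toℕ j) =
          x , here refl , sameFace⁺ l l< (trans eq (trans (Face.iterate-+ x (toℕ i) (toℕ j)) (trans (cong (λ w → iterate φ w (toℕ j)) xz) zy)))
      covered : ∀ {d} → d ∈ Darts → d ∈ concatMap (λ e → Face.trajectory e 3) representatives
      covered {d} d∈ with e , e∈ , (i , eq) ← deduplicate-covers-on d∈ =
        ∈-concatMap⁺ (λ e → Face.trajectory e 3) e∈ (subst (_∈ Face.trajectory e 3)
          (trans (sym (Face.iterate-mod e 3 (toℕ i) (tri (deduplicate-⊆ (sameFace? E ρ) Darts e∈)))) eq) (Face.∈-trajectory⁺ e 3 (m%n<n (toℕ i) 3)))
      lower : n * 2 ≤ faces E ρ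
      lower = ℕ.*-cancelʳ-≤ (n * 2) (faces E ρ) 3 (begin
        n * 2 * 3 ≡⟨ ℕ.*-assoc n 2 3 ⟩
        n * 6 ≡⟨ length-darts ⟨
        length Darts ≤⟨ unique-⊆⇒length≤ darts-unique covered ⟩
        length (concatMap (λ e → Face.trajectory e 3) representatives) ≡⟨ length-concatMap _ 3 representatives (λ {d} _ → Face.length-trajectory d 3) ⟩
        faces E ρ * 3 ∎)
        where open ℕ.≤-Reasoning

-- Boxes of the triangular lattice developed along good frames.

module LatticeFrames where

  open Determinant
  open Elimination
  open MatrixTree
  open FiniteLists
  open SpanningTree
  open RotationSystems
  open import Data.List.Base using (List; []; _∷_; _++_; length; map; filter; concatMap; cartesianProduct; upTo)
  open import Data.List.Properties using (length-++; length-map; length-upTo)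
  open import Data.List.Relation.Binary.Permutation.Propositional as Perm using (_↭_; ↭-sym)
  open import Data.Nat.Base as ℕ using (ℕ; zero; suc; s≤s; NonZero)
  import Data.Product.Properties as Product
  open import Data.Rational.Base using (ℚ; 0ℚ; _+_; _*_; _≤_)
  open import Algebra.Definitions.RawSemiring ℚ.+-*-rawSemiring using (_^_)
  import Relation.Unary as U

  Position : Set
  Position = ℕ × ℕ

  _≟ᴾ_ : DecidableEquality Position
  _≟ᴾ_ = Product.≡-dec ℕ._≟_ ℕ._≟_

  -- The neighbours in the triangular lattice, in cyclic order, for positions
  -- with positive coordinates.
  hex : Position → List Position
  hex (i , j) = (suc i , j) ∷ (i , suc j) ∷ (ℕ.pred i , suc j) ∷ (ℕ.pred i , j) ∷ (i , ℕ.pred j) ∷ (suc i , ℕ.pred j) ∷ []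

  -- Coordinates start at 1 so that `pred` in `hex` is a true predecessor on the box and the
  -- neighbours of the box have natural coordinates.
  range : ℕ → List ℕ
  range m = map suc (upTo m)

  Box : ℕ → List Position
  Box m = cartesianProduct (range m) (range m)

  range-unique : ∀ m → Unique (range m)
  range-unique m = Unique.map⁺ ℕ.suc-injective (Unique.upTo⁺ m)

  Box-unique : ∀ m → Unique (Box m)
  Box-unique m = Unique.cartesianProduct⁺ (range-unique m) (range-unique m)

  length-Box : ∀ m → length (Box m) ≡ m ℕ.* m
  length-Box m = trans (length-cartesianProduct (range m) (range m)) (cong₂ ℕ._*_ eq eq)
    where
    eq : length (range m) ≡ m
    eq = trans (length-map suc (upTo m)) (length-upTo m)

  ∈-range⁻ : ∀ {m i} → i ∈ range m → ∃ λ i′ → i ≡ suc i′ × i′ ℕ.< m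
  ∈-range⁻ i∈ = let (i′ , i′∈ , eq) = ∈-map⁻ suc i∈ in i′ , eq , ∈-upTo⁻ i′∈

  ∈-range⁺ : ∀ {m i} → i ℕ.< m → suc i ∈ range m
  ∈-range⁺ i<m = ∈-map⁺ suc (∈-upTo⁺ i<m)

  module Lattice = AcyclicChoices _≟ᴾ_

  module _ {A : Set} where

    Σ-⊆ : ∀ {xs ys : List A} {f} → (∀ x → 0ℚ ≤ f x) → Unique xs → (∀ {x} → x ∈ xs → x ∈ ys) → Σ xs f ≤ Σ ys f
    Σ-⊆ {[]} {ys} 0≤f [] sub = 0≤Σ ys 0≤f
    Σ-⊆ {x ∷ xs} {ys} {f} 0≤f (x∉ ∷ u) sub with as , bs , refl ← ∈-∃++ (sub (here refl)) = begin
      f x + Σ xs f ≤⟨ ℚ.+-monoʳ-≤ (f x) (Σ-⊆ 0≤f u (λ z∈ → remove-middle as (sub (there z∈)) (All.lookup x∉ z∈))) ⟩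
      f x + Σ (as ++ bs) f ≡⟨ cong (f x +_) (Σ-++ as bs f) ⟩
      f x + (Σ as f + Σ bs f) ≡⟨ trans (sym (ℚ.+-assoc (f x) _ _)) (trans (cong (_+ Σ bs f) (ℚ.+-comm (f x) (Σ as f))) (ℚ.+-assoc (Σ as f) _ _)) ⟩
      Σ as f + (f x + Σ bs f) ≡⟨ Σ-++ as (x ∷ bs) f ⟨
      Σ (as ++ x ∷ bs) f ∎
      where open ℚ.≤-Reasoning

  module Frames {n : ℕ} (E : EdgeSet n) (oriented : ∀ {u v} → (u , v) ∈ E → u Fin.< v) (E! : Unique E)
    (ρ : RotationSystem n) (rotation : IsRotation E ρ) (regular : Regular E 6) (root : Fin n) where

    open Rotation E oriented E! ρ rotation regular

    -- Frames are moved by words in two injective maps of the darts. A fixed word therefore takes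
    -- only one starting dart to any given bad dart, which is what bounds the frames that must be
    -- discarded.
    data Move : Set where
      turn flip : Move

    move : Move → Dart → Dart
    move turn = rot
    move flip = swap

    act : List Move → Dart → Dart
    act []      d = d
    act (s ∷ w) d = move s (act w d)

    act-closed : ∀ w {d} → d ∈ Darts → act w d ∈ Darts
    act-closed []         d∈ = d∈
    act-closed (turn ∷ w) d∈ = rot-closed (act-closed w d∈)
    act-closed (flip ∷ w) d∈ = swap-closed (act-closed w d∈)

    act-injective : ∀ w {d e} → d ∈ Darts → e ∈ Darts → act w d ≡ act w e → d ≡ e
    act-injective []         d∈ e∈ eq = eq
    act-injective (turn ∷ w) d∈ e∈ eq = act-injective w d∈ e∈ (rot-injective (act-closed w d∈) (act-closed w e∈) eq)
    act-injective (flip ∷ w) d∈ e∈ eq = act-injective w d∈ e∈ (cong swap eq)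

    rot² rot³ rot⁴ rot⁵ t₀ t₁ t₂ : Dart → Dart
    rot² d = rot (rot d)
    rot³ d = rot (rot² d)
    rot⁴ d = rot (rot³ d)
    rot⁵ d = rot (rot⁴ d)
    -- Parallel translation along the dart, and along the darts one and two
    -- positions after it.
    t₀ d = rot³ (swap d)
    t₁ d = rot⁵ (t₀ (rot d))
    t₂ d = rot⁴ (t₀ (rot² d))

    -- The face step takes `swap d` to `rot d`, so this is the face in the corner between `d` and
    -- `rot d`.
    Flat : Dart → Set
    Flat d = Triangular (swap d)

    -- In the triangle between `d` and `rot d`, the side `rot d` is reached by following `d` and
    -- then the third side, which at the head of `d` is two positions after the translated dart.
    t₁≡t₂t₀ : ∀ {d} → d ∈ Darts → Flat d → t₁ d ≡ t₂ (t₀ d)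
    t₁≡t₂t₀ {d} d∈ flat = begin
      t₁ d ≡⟨ rot-6 (rot-closed (rot-closed (swap-closed (rot-closed d∈)))) ⟩
      rot² (swap (rot d)) ≡⟨ cong (λ z → rot (swap z)) (trans (sym (rot-6 (swap-closed (rot-closed (swap-closed (rot-closed d∈)))))) (cong rot⁵ flat)) ⟩
      rot (swap (rot⁵ (swap d))) ≡⟨ rot-6 (rot-closed (swap-closed (rot-closed (rot-closed (act-closed (turn ∷ turn ∷ turn ∷ flip ∷ []) d∈))))) ⟨
      t₂ (t₀ d) ∎
      where open ≡-Reasoning

    t₀t₂≡t₁ : ∀ {d} → d ∈ Darts → Flat (rot d) → t₀ (t₂ d) ≡ t₁ d
    t₀t₂≡t₁ {d} d∈ flat = begin
      t₀ (t₂ d) ≡⟨ cong (λ z → rot³ (swap z)) (rot-6 (rot-closed (swap-closed (rot-closed (rot-closed d∈))))) ⟩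
      rot³ (swap (rot (swap (rot² d)))) ≡⟨ cong rot² flat ⟩
      rot² (swap (rot d)) ≡⟨ rot-6 (rot-closed (rot-closed (swap-closed (rot-closed d∈)))) ⟨
      t₁ d ∎
      where open ≡-Reasoning

    -- Two triangles with a common side form the parallelogram spanned by both translations, and
    -- there is no holonomy around it. The common side is the one crossed by `t₂`.
    commute : ∀ {d} → d ∈ Darts → Flat d → Flat (rot (t₀ d)) → t₀ (t₁ d) ≡ t₁ (t₀ d)
    commute d∈ flat flat′ = trans (cong t₀ (t₁≡t₂t₀ d∈ flat)) (t₀t₂≡t₁ (act-closed (turn ∷ turn ∷ turn ∷ flip ∷ []) d∈) flat′)

    -- All translations `t₀` are made before the `t₁`. One lattice direction is then correct by
    -- computation (`frame-t₁`), and flatness is needed only for the other (`frame-t₀`).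
    word : ℕ → ℕ → List Move
    word zero    zero    = []
    word (suc i) zero    = turn ∷ turn ∷ turn ∷ flip ∷ word i zero
    word i       (suc j) = turn ∷ turn ∷ turn ∷ turn ∷ turn ∷ turn ∷ turn ∷ turn ∷ flip ∷ turn ∷ word i j

    frame : Dart → ℕ → ℕ → Dart
    frame d i j = act (word i j) d

    heads : Dart → List (Fin n)
    heads (u , v) = Around.trajectory u v 6

    module Developed (m : ℕ) {d : Dart} (d∈ : d ∈ Darts)
      (flat : ∀ {i j} → i ℕ.≤ m → j ℕ.≤ m → Flat (frame d i j))
      (flat′ : ∀ {i j} → i ℕ.≤ m → j ℕ.≤ m → Flat (rot (t₀ (frame d i j)))) where

      frame-∈ : ∀ i j → frame d i j ∈ Darts
      frame-∈ i j = act-closed (word i j) d∈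

      frame-t₁ : ∀ i j → frame d i (suc j) ≡ t₁ (frame d i j)
      frame-t₁ zero    j = refl
      frame-t₁ (suc i) j = refl

      frame-t₀ : ∀ i j → i ℕ.≤ m → j ℕ.≤ m → frame d (suc i) j ≡ t₀ (frame d i j)
      frame-t₀ i zero    i≤ j≤ = refl
      frame-t₀ i (suc j) i≤ j≤ = begin
        t₁ (frame d (suc i) j) ≡⟨ cong t₁ (frame-t₀ i j i≤ j≤m) ⟩
        t₁ (t₀ (frame d i j)) ≡⟨ commute (frame-∈ i j) (flat i≤ j≤m) (flat′ i≤ j≤m) ⟨
        t₀ (t₁ (frame d i j)) ≡⟨ cong t₀ (frame-t₁ i j) ⟨
        t₀ (frame d i (suc j)) ∎
        where
        open ≡-Reasoning
        j≤m = ℕ.≤-trans (ℕ.n≤1+n j) j≤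

      place : Position → Fin n
      place (i , j) = proj₁ (frame d i j)

      -- A translation ends at the head of the dart along which it is made.
      place-hex : ∀ {i j} → i ℕ.< m → j ℕ.< m → map place (hex (suc i , suc j)) ≡ heads (frame d (suc i) (suc j))
      place-hex {i} {j} i< j< =
        cong₂ _∷_ e₀ (cong₂ _∷_ refl (cong₂ _∷_ e₂ (cong₂ _∷_ e₃ (cong₂ _∷_ e₄ (cong₂ _∷_ e₅ refl)))))
        where
        f = frame d (suc i) (suc j)
        head : Dart → Fin n
        head = proj₂
        f≡t₀ : f ≡ t₀ (frame d i (suc j))
        f≡t₀ = frame-t₀ i (suc j) (ℕ.<⇒≤ i<) j<
        f≡t₁ : f ≡ t₁ (frame d (suc i) j)
        f≡t₁ = frame-t₁ (suc i) j
        e₀ : place (suc (suc i) , suc j) ≡ head f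
        e₀ = cong proj₁ (frame-t₀ (suc i) (suc j) i< j<)
        e₂ : place (i , suc (suc j)) ≡ head (rot² f)
        e₂ = cong proj₁ (trans (frame-t₁ i (suc j)) (trans (t₁≡t₂t₀ (frame-∈ i (suc j)) (flat (ℕ.<⇒≤ i<) j<)) (cong t₂ (sym f≡t₀))))
        e₃ : place (i , suc j) ≡ head (rot³ f)
        e₃ = trans (sym (cong head (rot-6 (swap-closed (frame-∈ i (suc j)))))) (cong (λ z → head (rot³ z)) (sym f≡t₀))
        back₁ : ∀ {e} → e ∈ Darts → rot e ≡ swap (rot⁴ (t₁ e))
        back₁ {e} e∈ = sym (cong swap (trans (rot-6 (rot-closed (rot-closed (rot-closed (rot-closed (rot-closed (rot-closed (swap-closed (rot-closed e∈))))))))) (rot-6 (swap-closed (rot-closed e∈)))))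
        e₄ : place (suc i , j) ≡ head (rot⁴ f)
        e₄ = cong proj₁ (trans (back₁ (frame-∈ (suc i) j)) (cong (λ z → swap (rot⁴ z)) (sym f≡t₁)))
        back₂ : ∀ {x} → x ∈ Darts → rot² x ≡ swap (rot⁵ (t₂ x))
        back₂ {x} x∈ = sym (cong swap (trans (rot-6 (rot-closed (rot-closed (rot-closed (rot-closed (rot-closed (rot-closed (swap-closed (rot-closed (rot-closed x∈)))))))))) (rot-6 (swap-closed (rot-closed (rot-closed x∈))))))
        e₅ : place (suc (suc i) , j) ≡ head (rot⁵ f)
        e₅ = trans (cong proj₁ (frame-t₀ (suc i) j i< (ℕ.<⇒≤ j<)))
          (cong proj₁ (trans (back₂ (act-closed (turn ∷ turn ∷ turn ∷ flip ∷ []) (frame-∈ (suc i) j)))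
            (cong (λ z → swap (rot⁵ z)) (trans (sym (t₁≡t₂t₀ (frame-∈ (suc i) j) (flat i< (ℕ.<⇒≤ j<)))) (sym f≡t₁)))))

    open DecMembership _≟ᴰ_ using (_∈?_)

    rooted : List Dart
    rooted = filter (λ d → proj₁ d Fin.≟ root) Darts

    -- The walk in the graph is killed at the root, so darts at the root are excluded like those on
    -- large faces: a developed box must consist of vertices that carry arrows.
    bad : List Dart
    bad = nonTriangular ++ rooted

    length-bad : length bad ℕ.≤ length nonTriangular ℕ.+ 6
    length-bad = subst (ℕ._≤ length nonTriangular ℕ.+ 6) (sym (length-++ nonTriangular)) (ℕ.+-monoʳ-≤ (length nonTriangular)
      (subst (length rooted ℕ.≤_) (trans (length-map (root ,_) (neighbours root)) (regular root))
        (unique-⊆⇒length≤ (Unique.filter⁺ (λ d → proj₁ d Fin.≟ root) darts-unique) into)))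
      where
      into : ∀ {d} → d ∈ rooted → d ∈ map (root ,_) (neighbours root)
      into {u , v} d∈ with d∈D , refl ← ∈-filter⁻ (λ d → proj₁ d Fin.≟ root) {xs = Darts} d∈ = ∈-map⁺ (root ,_) (∈-neighbours⁺ (∈-darts⁻ d∈D))

    ∉-bad⇒triangular : ∀ {d} → d ∈ Darts → d ∉ bad → Triangular d
    ∉-bad⇒triangular {d} d∈ d∉ with triangular? d
    ... | yes t = t
    ... | no ¬t = ⊥-elim (d∉ (∈-++⁺ˡ (∈-filter⁺ (¬? ∘ triangular?) d∈ ¬t)))

    ∉-bad⇒≢root : ∀ {d} → d ∈ Darts → d ∉ bad → proj₁ d ≢ root
    ∉-bad⇒≢root d∈ d∉ eq = d∉ (∈-++⁺ʳ nonTriangular (∈-filter⁺ (λ d → proj₁ d Fin.≟ root) d∈ eq))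

    module Boxes (m : ℕ) where

      -- At each corner: the vertex is not the root, and the two triangles in the hypotheses of
      -- `commute` are present. The last word leads to `swap (rot (t₀ f))` for the frame `f` there.
      tests : ℕ × ℕ → List (List Move)
      tests (i , j) = word i j ∷ (flip ∷ word i j) ∷ (flip ∷ turn ∷ turn ∷ turn ∷ turn ∷ flip ∷ word i j) ∷ []

      corners : List (ℕ × ℕ)
      corners = cartesianProduct (upTo (suc m)) (upTo (suc m))

      words : List (List Move)
      words = concatMap tests corners

      Good : Dart → Set
      Good d = All (λ w → act w d ∉ bad) words

      good? : U.Decidable Good
      good? d = All.all? (λ w → ¬? (act w d ∈? bad)) words

      goodFrames : List Dart
      goodFrames = filter good? Darts

      ∈-goodFrames⁻ : ∀ {d} → d ∈ goodFrames → d ∈ Darts × Good d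
      ∈-goodFrames⁻ = ∈-filter⁻ good? {xs = Darts}

      -- A discarded frame has a word that takes it to a bad dart, and this word and bad dart
      -- determine the frame. The loss is thus independent of n.
      many-goodFrames : n ℕ.* 6 ℕ.≤ length goodFrames ℕ.+ length words ℕ.* (length nonTriangular ℕ.+ 6)
      many-goodFrames = begin
        n ℕ.* 6 ≡⟨ trans (filter-partition good? Darts) length-darts ⟨
        length goodFrames ℕ.+ length (filter (¬? ∘ good?) Darts) ≤⟨ ℕ.+-monoʳ-≤ (length goodFrames) few ⟩
        length goodFrames ℕ.+ length words ℕ.* length bad ≤⟨ ℕ.+-monoʳ-≤ (length goodFrames) (ℕ.*-monoʳ-≤ (length words) length-bad) ⟩
        length goodFrames ℕ.+ length words ℕ.* (length nonTriangular ℕ.+ 6) ∎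
        where
        open ℕ.≤-Reasoning
        R : Dart → List Move × Dart → Set
        R d (w , b) = d ∈ Darts × act w d ≡ b
        witness : ∀ {d} → d ∈ filter (¬? ∘ good?) Darts → ∃ λ wb → wb ∈ cartesianProduct words bad × R d wb
        witness {d} d∈ = let (d∈D , ¬good) = ∈-filter⁻ (¬? ∘ good?) {xs = Darts} d∈
                             (w , w∈ , ¬¬b) = find (All.¬All⇒Any¬ (λ w → ¬? (act w d ∈? bad)) words ¬good) in
          (w , act w d) , ∈-cartesianProduct⁺ w∈ (decidable-stable (act w d ∈? bad) ¬¬b) , d∈D , refl
        few : length (filter (¬? ∘ good?) Darts) ℕ.≤ length words ℕ.* length bad
        few = subst (length (filter (¬? ∘ good?) Darts) ℕ.≤_) (length-cartesianProduct words bad)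
          (relation⇒length≤ R (λ { {y = w , _} (d∈ , refl) (e∈ , eq) → act-injective w d∈ e∈ (sym eq) })
            (Unique.filter⁺ (¬? ∘ good?) darts-unique) witness)

      private
        good-word : ∀ {d i j w} → d ∈ goodFrames → i ℕ.≤ m → j ℕ.≤ m → w ∈ tests (i , j) → act w d ∈ Darts × act w d ∉ bad
        good-word {w = w} d∈ i≤ j≤ w∈ = let (d∈D , good) = ∈-goodFrames⁻ d∈ in act-closed w d∈D ,
          All.lookup good (∈-concatMap⁺ tests (∈-cartesianProduct⁺ (∈-upTo⁺ (s≤s i≤)) (∈-upTo⁺ (s≤s j≤))) w∈)

      module Frame {d} (d∈ : d ∈ goodFrames) where

        flat : ∀ {i j} → i ℕ.≤ m → j ℕ.≤ m → Flat (frame d i j)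
        flat i≤ j≤ = let (a∈ , a∉) = good-word d∈ i≤ j≤ (there (here refl)) in ∉-bad⇒triangular a∈ a∉

        flat′ : ∀ {i j} → i ℕ.≤ m → j ℕ.≤ m → Flat (rot (t₀ (frame d i j)))
        flat′ i≤ j≤ = let (a∈ , a∉) = good-word d∈ i≤ j≤ (there (there (here refl))) in ∉-bad⇒triangular a∈ a∉

        avoids : ∀ {i j} → i ℕ.≤ m → j ℕ.≤ m → proj₁ (frame d i j) ≢ root
        avoids i≤ j≤ = let (a∈ , a∉) = good-word d∈ i≤ j≤ (here refl) in ∉-bad⇒≢root a∈ a∉

        open Developed m (proj₁ (∈-goodFrames⁻ d∈)) flat flat′ public

      Point : Set
      Point = Dart × Position

      _≟ᵂ_ : DecidableEquality Point
      _≟ᵂ_ = Product.≡-dec _≟ᴰ_ _≟ᴾ_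

      module G = AcyclicChoices {Fin n} Fin._≟_
      module W = AcyclicChoices _≟ᵂ_

      hexᵂ : Point → List Point
      hexᵂ (d , b) = map (d ,_) (hex b)

      π : Point → Fin n
      π (d , i , j) = proj₁ (frame d i j)

      points : List Point
      points = cartesianProduct goodFrames (Box m)

      points-unique : Unique points
      points-unique = Unique.cartesianProduct⁺ (Unique.filter⁺ good? darts-unique) (Box-unique m)

      fibre : Fin n → List Point
      fibre v = filter (λ w → π w Fin.≟ v) points

      fibre-unique : ∀ v → Unique (fibre v)
      fibre-unique v = Unique.filter⁺ (λ w → π w Fin.≟ v) points-unique

      ∈-fibre⁻ : ∀ {v w} → w ∈ fibre v → w ∈ points × π w ≡ v
      ∈-fibre⁻ {v} = ∈-filter⁻ (λ w → π w Fin.≟ v) {xs = points}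

      ∈-points⁻ : ∀ {d i j} → (d , i , j) ∈ points → d ∈ goodFrames × (∃ λ i′ → i ≡ suc i′ × i′ ℕ.< m) × (∃ λ j′ → j ≡ suc j′ × j′ ℕ.< m)
      ∈-points⁻ w∈ = let (d∈ , b∈) = ∈-cartesianProduct⁻ goodFrames (Box m) w∈ ; (i∈ , j∈) = ∈-cartesianProduct⁻ (range m) (range m) b∈ in
        d∈ , ∈-range⁻ i∈ , ∈-range⁻ j∈

      open SpanningTrees E oriented E! root using (others; others-unique; ∈-others)

      -- A point above `v` is recovered from its position and the dart at `v` to which its frame has
      -- been moved: words act injectively, so these two data give back the initial frame.
      fibre-length : ∀ v → length (fibre v) ℕ.≤ m ℕ.* m ℕ.* 6
      fibre-length v = subst (length (fibre v) ℕ.≤_)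
        (trans (length-cartesianProduct (Box m) (neighbours v)) (cong₂ ℕ._*_ (length-Box m) (regular v)))
        (relation⇒length≤ R functional (fibre-unique v) witness)
        where
        R : Point → Position × Fin n → Set
        R w@(d , i , j) (b , u) = d ∈ Darts × (i , j) ≡ b × frame d i j ≡ (v , u)
        functional : ∀ {w w′ y} → R w y → R w′ y → w ≡ w′
        functional {d , i , j} {d′ , _} (d∈ , refl , eq) (d′∈ , refl , eq′) =
          cong (_, (i , j)) (act-injective (word i j) d∈ d′∈ (trans eq (sym eq′)))
        witness : ∀ {w} → w ∈ fibre v → ∃ λ y → y ∈ cartesianProduct (Box m) (neighbours v) × R w y
        witness {d , i , j} w∈ = let (w∈P , π≡v) = ∈-fibre⁻ w∈
                                     (d∈ , b∈) = ∈-cartesianProduct⁻ goodFrames (Box m) w∈P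
                                     d∈D = proj₁ (∈-goodFrames⁻ d∈) in
          ((i , j) , proj₂ (frame d i j)) ,
          ∈-cartesianProduct⁺ b∈ (subst (λ v → proj₂ (frame d i j) ∈ neighbours v) π≡v (∈-neighbours⁺ (∈-darts⁻ (act-closed (word i j) d∈D)))) ,
          d∈D , refl , cong (_, proj₂ (frame d i j)) π≡v

      fibres↭points : concatMap fibre others ↭ points
      fibres↭points = unique-⊆⊇⇒↭
        (concatMap-unique fibre others-unique (λ {v} _ → fibre-unique v)
          λ _ _ x≢y w∈ w∈′ → x≢y (trans (sym (proj₂ (∈-fibre⁻ w∈))) (proj₂ (∈-fibre⁻ w∈′))))
        points-unique
        (λ w∈ → let (v , _ , w∈v) = ∈-concatMap⁻ fibre others w∈ in proj₁ (∈-fibre⁻ w∈v))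
        into
        where
        into : ∀ {w} → w ∈ points → w ∈ concatMap fibre others
        into {w@(d , i , j)} w∈ = let (d∈ , (_ , i≡ , i<) , (_ , j≡ , j<)) = ∈-points⁻ w∈ in
          ∈-concatMap⁺ fibre (∈-others (Frame.avoids d∈ (subst (ℕ._≤ m) (sym i≡) i<) (subst (ℕ._≤ m) (sym j≡) j<))) (∈-filter⁺ (λ z → π z Fin.≟ π w) w∈ refl)

      heads-⊆ : ∀ {e} → e ∈ Darts → ∀ {u} → u ∈ heads e → u ∈ neighbours (proj₁ e)
      heads-⊆ {x , v} e∈ = Around.trajectory-⊆ x {k = 6} (∈-neighbours⁺ (∈-darts⁻ e∈))

      heads-unique : ∀ {e} → e ∈ Darts → Unique (heads e)
      heads-unique {x , v} e∈ = Around.trajectory-6-unique x (∈-neighbours⁺ (∈-darts⁻ e∈))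

      fibre-sixth : ∀ z y → Σ (fibre y) (W.sixth z) ≤ G.sixth (π z) y
      fibre-sixth z y with π z Fin.≟ y
      ... | yes _ = W.Σ-sixth≤ z (fibre-unique y)
      ... | no πz≢y = ℚ.≤-reflexive (trans (Σ-cong (fibre y) λ {w} w∈ → W.sixth-≢ {z} {w} λ { refl → πz≢y (proj₂ (∈-fibre⁻ w∈)) })
          (trans (Σ-const (fibre y) 0ℚ) (ℚ.*-zeroʳ (ι (length (fibre y))))))

      -- The six lattice neighbours develop onto the six neighbours in the graph. Those beyond the
      -- rim of the box belong to no fibre, and there the lifted walk is killed.
      dominates-at : ∀ {d i′ j′} y → d ∈ goodFrames → i′ ℕ.< m → j′ ℕ.< m →
        Σ (fibre y) (W.step hexᵂ (d , suc i′ , suc j′)) ≤ G.step neighbours (π (d , suc i′ , suc j′)) y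
      dominates-at {d} {i′} {j′} y d∈ i< j< = begin
        Σ (fibre y) (λ w′ → Σ (hexᵂ w) (λ z → W.sixth z w′)) ≡⟨ Σ-swap (fibre y) (hexᵂ w) (λ w′ z → W.sixth z w′) ⟩
        Σ (hexᵂ w) (λ z → Σ (fibre y) (W.sixth z)) ≤⟨ Σ-mono (hexᵂ w) (λ {z} _ → fibre-sixth z y) ⟩
        Σ (hexᵂ w) (λ z → G.sixth (π z) y) ≡⟨ Σ-map (d ,_) (hex (i , j)) (λ z → G.sixth (π z) y) ⟩
        Σ (hex (i , j)) (λ b → G.sixth (π (d , b)) y) ≡⟨ Σ-map (λ b → π (d , b)) (hex (i , j)) (λ z → G.sixth z y) ⟨
        Σ (map (λ b → π (d , b)) (hex (i , j))) (λ z → G.sixth z y) ≡⟨ cong (λ l → Σ l (λ z → G.sixth z y)) (Frame.place-hex d∈ i< j<) ⟩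
        Σ (heads e) (λ z → G.sixth z y) ≤⟨ Σ-⊆ (λ z → G.0≤sixth z y) (heads-unique e∈) (heads-⊆ e∈) ⟩
        Σ (neighbours (proj₁ e)) (λ z → G.sixth z y) ∎
        where
        open ℚ.≤-Reasoning
        i = suc i′
        j = suc j′
        w = d , i , j
        e = frame d i j
        e∈ = act-closed (word i j) (proj₁ (∈-goodFrames⁻ d∈))

      dominates : ∀ {x w y} → w ∈ fibre x → Σ (fibre y) (W.step hexᵂ w) ≤ G.step neighbours x y
      dominates {x} {d , i , j} {y} w∈ = let (w∈P , π≡x) = ∈-fibre⁻ w∈
                                             (d∈ , (_ , i≡ , i<) , (_ , j≡ , j<)) = ∈-points⁻ w∈P in
        subst (λ x → Σ (fibre y) (W.step hexᵂ (d , i , j)) ≤ G.step neighbours x y) π≡x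
          (subst₂ (λ i j → Σ (fibre y) (W.step hexᵂ (d , i , j)) ≤ G.step neighbours (π (d , i , j)) y) (sym i≡) (sym j≡) (dominates-at y d∈ i< j<))

      hexᵂ-6 : ∀ w → length (hexᵂ w) ≡ 6
      hexᵂ-6 (d , i , j) = refl

      -- Points of different frames are not adjacent in the cover, even where their boxes overlap in
      -- the graph, so the determinant splits into equal blocks.
      D-blocks : ∀ ds → Unique ds → D (cartesianProduct ds (Box m)) (W.step hexᵂ) ≡ D (Box m) (Lattice.step hex) ^ length ds
      D-blocks []       _ = refl
      D-blocks (d ∷ ds) (d∉ ∷ u) = begin
        D (map (d ,_) (Box m) ++ rest) (W.step hexᵂ) ≡⟨ D-++ (map (d ,_) (Box m)) rest (W.step hexᵂ) (λ x∈ y∈ → zero₁ x∈ y∈) (λ x∈ y∈ → zero₂ x∈ y∈) ⟩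
        D (map (d ,_) (Box m)) (W.step hexᵂ) * D rest (W.step hexᵂ) ≡⟨ cong₂ _*_ (trans (D-map (d ,_) (Box m) (W.step hexᵂ)) (D-≗ (Box m) same)) (D-blocks ds u) ⟩
        D (Box m) (Lattice.step hex) * D (Box m) (Lattice.step hex) ^ length ds ∎
        where
        open ≡-Reasoning
        rest = cartesianProduct ds (Box m)
        same : ∀ b b′ → W.step hexᵂ (d , b) (d , b′) ≡ Lattice.step hex b b′
        same b b′ = trans (Σ-map (d ,_) (hex b) (λ z → W.sixth z (d , b′))) (Σ-cong (hex b) λ {z} _ → sixth-same z)
          where
          sixth-same : ∀ z → W.sixth (d , z) (d , b′) ≡ Lattice.sixth z b′
          sixth-same z with z ≟ᴾ b′
          ... | yes refl = W.sixth-≡ (d , z)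
          ... | no z≢ = W.sixth-≢ {d , z} {d , b′} (λ eq → z≢ (cong proj₂ eq))
        apart : ∀ {d d′ b b′} → d ≢ d′ → W.step hexᵂ (d , b) (d′ , b′) ≡ 0ℚ
        apart {d} {d′} {b} {b′} d≢ = trans (Σ-map (d ,_) (hex b) (λ z → W.sixth z (d′ , b′))) (trans (Σ-cong (hex b) λ {z} _ → W.sixth-≢ {d , z} {d′ , b′} (λ eq → d≢ (cong proj₁ eq))) (trans (Σ-const (hex b) 0ℚ) (ℚ.*-zeroʳ (ι (length (hex b))))))
        split : ∀ {x y} → x ∈ map (d ,_) (Box m) → y ∈ rest → proj₁ x ≡ d × proj₁ y ∈ ds
        split x∈ y∈ with _ , _ , refl ← ∈-map⁻ (d ,_) x∈ = refl , proj₁ (∈-cartesianProduct⁻ ds (Box m) y∈)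
        zero₁ : ∀ {x y} → x ∈ map (d ,_) (Box m) → y ∈ rest → W.step hexᵂ x y ≡ 0ℚ
        zero₁ {x} {y} x∈ y∈ = let (eq , y∈ds) = split x∈ y∈ in apart λ e → All.lookup d∉ y∈ds (trans (sym eq) e)
        zero₂ : ∀ {x y} → x ∈ rest → y ∈ map (d ,_) (Box m) → W.step hexᵂ x y ≡ 0ℚ
        zero₂ {x} {y} x∈ y∈ = let (eq , x∈ds) = split y∈ x∈ in apart λ e → All.lookup d∉ x∈ds (trans (sym eq) (sym e))

      cover-bound : {{_ : NonZero (m ℕ.* m ℕ.* 6)}} →
        D others (G.step neighbours) ^ (m ℕ.* m ℕ.* 6) ≤ D (Box m) (Lattice.step hex) ^ length goodFrames
      cover-bound = begin
        D others (G.step neighbours) ^ (m ℕ.* m ℕ.* 6) ≤⟨ Cover.D-cover fibre (m ℕ.* m ℕ.* 6) others (G.step neighbours) (W.step hexᵂ)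
            (G.step-substochastic {neighbours} regular others-unique)
            (substochastic-↭ (↭-sym fibres↭points) (W.step-substochastic {hexᵂ} hexᵂ-6 points-unique))
            (λ {x} {w} {y} _ w∈ _ → dominates {x} {w} {y} w∈) (λ {v} _ → fibre-length v) ⟩
        D (concatMap fibre others) (W.step hexᵂ) ≡⟨ D-↭ fibres↭points (W.step hexᵂ) ⟩
        D points (W.step hexᵂ) ≡⟨ D-blocks goodFrames (Unique.filter⁺ good? darts-unique) ⟩
        D (Box m) (Lattice.step hex) ^ length goodFrames ∎
        where open ℚ.≤-Reasoning

-- Comparison of the box with 16 / 3 through escape probabilities.

module BoxEstimate where

  open Determinant
  open Elimination
  open MatrixTree
  open FiniteLists
  open LatticeFrames
  open import Data.List.Base using (List; []; _∷_; _++_; length; map; filter; cartesianProduct)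
  open import Data.List.Properties using (++-identityʳ; ++-assoc; filter-accept; filter-reject)
  open import Data.List.Relation.Binary.Permutation.Propositional using (_↭_; prep)
  import Data.List.Relation.Unary.AllPairs.Properties as AllPairs
  open import Data.Nat.Base as ℕ using (ℕ; suc; z≤n; s≤s; NonZero)
  import Data.Integer.Base as ℤ
  open import Data.Rational.Base using (ℚ; 0ℚ; 1ℚ; _+_; _*_; _-_; _≤_; _<_; _/_)
  open import Data.Rational.Solver using (module +-*-Solver)
  open import Algebra.Definitions.RawSemiring ℚ.+-*-rawSemiring using (_^_)
  open import Data.Unit.Base using (tt)
  open +-*-Solver

  hex-6 : ∀ b → length (hex b) ≡ 6
  hex-6 b = refl

  private
    p : Matrix Position
    p = Lattice.step hex

  box-substochastic : ∀ {vs} → Unique vs → Substochastic vs p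
  box-substochastic = Lattice.step-substochastic {hex} hex-6

  abstract
    A : ℕ → ℕ
    A m = Lattice.#acyclic hex (Box m) id

    ι-A : ∀ m → ι (A m) ≡ ι 6 ^ (m ℕ.* m) * D (Box m) p
    ι-A m = trans (Lattice.#acyclic≡D hex hex-6 (Box-unique m) id) (cong (λ k → ι 6 ^ k * D (Box m) p) (length-Box m))

    -- If all arrows point in the direction of the first coordinate, they close no cycle.
    1≤A : ∀ m → 1 ℕ.≤ A m
    1≤A m = subst (λ vs → 1 ℕ.≤ Lattice.#acyclic hex vs id) (++-identityʳ (Box m))
      (proj₂ (proj₂ (proj₂ (Lattice.collapse hex (Box m) [] id (λ (i , j) → suc i , j) (λ (i , j) → suc m ℕ.∸ i) step))))
      where
      step : ∀ {c : Position} → c ∈ Box m → (suc (proj₁ c) , proj₂ c) ∈ hex c × (suc m ℕ.∸ suc (proj₁ c)) ℕ.< (suc m ℕ.∸ proj₁ c) × _∉_ {A = Position} (suc (proj₁ c) , proj₂ c) []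
      step c∈ with i∈ , _ ← ∈-cartesianProduct⁻ (range m) (range m) c∈ with i′ , refl , i′<m ← ∈-range⁻ i∈ =
        here refl , ℕ.∸-monoʳ-< (ℕ.n<1+n (suc i′)) (s≤s i′<m) , λ ()

  D≤1 : ∀ {V : Set} {vs : List V} {p} → Substochastic vs p → D vs p ≤ 1ℚ
  D≤1 {vs = []}     s = ℚ.≤-refl
  D≤1 {vs = v ∷ vs} s = ℚ.≤-trans (D-∷≤ s) (D≤1 (tailˢ s))

  -- The three neighbours of (1 , 2) that follow it in lexicographic order, and two further
  -- positions, (2 , 3) and (3 , 1), each adjacent to two of these. Enlarging a window lowers the
  -- escape probability; these five bring it below 8 / 9.
  Window : List Position
  Window = (1 , 3) ∷ (2 , 2) ∷ (2 , 1) ∷ (2 , 3) ∷ (3 , 1) ∷ []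

  shift-by : ℕ → ℕ → Position → Position
  shift-by i j (k , l) = k ℕ.+ i , l ℕ.+ j

  step-shift : ∀ i j {b} b′ → 1 ℕ.≤ proj₁ b → 1 ℕ.≤ proj₂ b → p (shift-by i j b) (shift-by i j b′) ≡ p b b′
  step-shift i j {suc k , suc l} b′ _ _ = trans (Σ-map (shift-by i j) (hex (suc k , suc l)) (λ z → Lattice.sixth z (shift-by i j b′)))
    (Σ-cong (hex (suc k , suc l)) λ {z} _ → same z)
    where
    same : ∀ z → Lattice.sixth (shift-by i j z) (shift-by i j b′) ≡ Lattice.sixth z b′
    same z with z ≟ᴾ b′
    ... | yes refl = Lattice.sixth-≡ (shift-by i j z)
    ... | no z≢ = Lattice.sixth-≢ {shift-by i j z} {shift-by i j b′} (λ eq → z≢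
          (cong₂ _,_ (ℕ.+-cancelʳ-≡ i _ _ (cong proj₁ eq)) (ℕ.+-cancelʳ-≡ j _ _ (cong proj₂ eq))))

  D-shift : ∀ i j vs → All (λ b → 1 ℕ.≤ proj₁ b × 1 ℕ.≤ proj₂ b) vs → D (map (shift-by i j) vs) p ≡ D vs p
  D-shift i j vs pos = trans (D-map (shift-by i j) vs p)
    (D-cong vs λ {x} {y} x∈ _ → let (1≤k , 1≤l) = All.lookup pos x∈ in step-shift i j {x} y 1≤k 1≤l)

  -- The value of D ((1 , 2) ∷ Window) p / D Window p.
  escape : ℚ
  escape = ℤ.+ 961 / 1092

  abstract
    window-ratio : D ((1 , 2) ∷ Window) p ≤ escape * D Window p
    window-ratio = from-yes (D ((1 , 2) ∷ Window) p ℚ.≤? escape * D Window p)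

  window-ratio-shifted : ∀ i j → D (map (shift-by i j) ((1 , 2) ∷ Window)) p ≤ escape * D (map (shift-by i j) Window) p
  window-ratio-shifted i j = subst₂ (λ a b → a ≤ escape * b)
    (sym (D-shift i j ((1 , 2) ∷ Window) ((s≤s z≤n , s≤s z≤n) ∷ positive-window))) (sym (D-shift i j Window positive-window)) window-ratio
    where
    positive-window : All (λ b → 1 ℕ.≤ proj₁ b × 1 ℕ.≤ proj₂ b) Window
    positive-window = (s≤s z≤n , s≤s z≤n) ∷ (s≤s z≤n , s≤s z≤n) ∷ (s≤s z≤n , s≤s z≤n) ∷ (s≤s z≤n , s≤s z≤n) ∷ (s≤s z≤n , s≤s z≤n) ∷ []

  _<ˡ_ : Position → Position → Set
  (i , j) <ˡ (k , l) = i ℕ.< k ⊎ i ≡ k × j ℕ.< l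

  <ˡ-asym : ∀ {a b} → a <ˡ b → b <ˡ a → ⊥
  <ˡ-asym (inj₁ lt) (inj₁ lt′) = ℕ.<-asym lt lt′
  <ˡ-asym (inj₁ lt) (inj₂ (refl , _)) = ℕ.<-irrefl refl lt
  <ˡ-asym (inj₂ (refl , _)) (inj₁ lt′) = ℕ.<-irrefl refl lt′
  <ˡ-asym (inj₂ (refl , lt)) (inj₂ (_ , lt′)) = ℕ.<-asym lt lt′

  range-sorted : ∀ m → AllPairs ℕ._<_ (range m)
  range-sorted m = AllPairs.map⁺ (AllPairs.applyUpTo⁺₁ id m (λ i<j _ → s≤s i<j))

  Box-sorted : ∀ m → AllPairs _<ˡ_ (Box m)
  Box-sorted m = go (range m) (range-sorted m)
    where
    go : ∀ is → AllPairs ℕ._<_ is → AllPairs _<ˡ_ (cartesianProduct is (range m))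
    go [] [] = []
    go (i ∷ is) (i< ∷ s) = AllPairs.++⁺ (AllPairs.map⁺ (AllPairs.map (λ lt → inj₂ (refl , lt)) (range-sorted m))) (go is s)
      (All.map⁺ (All.tabulate λ _ → All.tabulate λ y∈ → inj₁ (All.lookup i< (proj₁ (∈-cartesianProduct⁻ is (range m) y∈)))))

  -- The window of a position lies in the part of the box that comes later in
  -- lexicographic order.
  Fits : ℕ → Position → Set
  Fits m (i , j) = suc (suc i) ℕ.≤ m × 2 ℕ.≤ j × suc j ℕ.≤ m

  fits? : ∀ m b → Dec (Fits m b)
  fits? m (i , j) = (suc (suc i) ℕ.≤? m) ×-dec (2 ℕ.≤? j) ×-dec (suc j ℕ.≤? m)

  0≤escape : 0ℚ ≤ escape
  0≤escape = ℚ.nonNegative⁻¹ escape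

  -- All positions of the window lie in `L`, so by `D-window` escaping from `L` is no more likely
  -- than escaping from the window, whose ratio is invariant under translation.
  escape-bound : ∀ m P {x L} → Box m ≡ P ++ x ∷ L → Fits m x → D (x ∷ L) p ≤ escape * D L p
  escape-bound m P {x@(i , j)} {L} eq (i+2≤m , 2≤j , j<m) = begin
    D (x ∷ L) p ≡⟨ D-↭ (prep x L↭R++S) p ⟩
    D (x ∷ R ++ S) p ≤⟨ D-window x R S 0≤escape (substochastic-↭ (prep x L↭R++S) (box-substochastic L!)) ratio ⟩
    escape * D (R ++ S) p ≡⟨ cong (escape *_) (D-↭ L↭R++S p) ⟨
    escape * D L p ∎
    where
    open ℚ.≤-Reasoning
    open DecMembership _≟ᴾ_ using (_∈?_)
    L! : Unique (x ∷ L)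
    L! = unique-suffix P (subst Unique eq (Box-unique m))
    sorted-prefix : ∀ as {bs} → AllPairs _<ˡ_ (as ++ bs) → ∀ {a b} → a ∈ as → b ∈ bs → a <ˡ b
    sorted-prefix (a ∷ as) (a< ∷ s) (here refl) b∈ = All.lookup a< (∈-++⁺ʳ as b∈)
    sorted-prefix (a ∷ as) (_ ∷ s) (there a∈) b∈ = sorted-prefix as s a∈ b∈
    later : ∀ {y} → y ∈ Box m → x <ˡ y → y ∈ L
    later {y} y∈ x<y with ∈-++⁻ P (subst (y ∈_) eq y∈)
    ... | inj₁ y∈P = ⊥-elim (<ˡ-asym x<y (sorted-prefix P (subst (AllPairs _<ˡ_) eq (Box-sorted m)) y∈P (here refl)))
    ... | inj₂ (here refl) = ⊥-elim (<ˡ-asym x<y x<y)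
    ... | inj₂ (there y∈L) = y∈L
    x∈ : x ∈ Box m
    x∈ = subst (x ∈_) (sym eq) (∈-++⁺ʳ P (here refl))
    positive-i : ∃ λ i′ → i ≡ suc i′ × i′ ℕ.< m
    positive-i = ∈-range⁻ (proj₁ (∈-cartesianProduct⁻ (range m) (range m) x∈))
    i′ = proj₁ positive-i
    -- The model vertex is (1 , 2), since its window extends to the column to its left and
    -- coordinates must stay positive.
    j″ = j ℕ.∸ 2
    S : List Position
    S = map (shift-by i′ j″) Window
    i≡ : i ≡ suc i′
    i≡ = proj₁ (proj₂ positive-i)
    j≡ : j ≡ 2 ℕ.+ j″
    j≡ = sym (ℕ.m+[n∸m]≡n 2≤j)
    ratio : D (x ∷ S) p ≤ escape * D S p
    ratio = subst (λ z → D (z ∷ S) p ≤ escape * D S p) (sym (cong₂ _,_ i≡ j≡)) (window-ratio-shifted i′ j″)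
    i+2≤m′ : suc (suc (suc i′)) ℕ.≤ m
    i+2≤m′ = subst (λ k → suc (suc k) ℕ.≤ m) i≡ i+2≤m
    j<m′ : suc (suc (suc j″)) ℕ.≤ m
    j<m′ = subst (λ k → suc k ℕ.≤ m) j≡ j<m
    in-box : ∀ {k l} → k ℕ.< m → l ℕ.< m → (suc k , suc l) ∈ Box m
    in-box k< l< = ∈-cartesianProduct⁺ (∈-range⁺ k<) (∈-range⁺ l<)
    le : ∀ {k n} → suc k ℕ.≤ n → k ℕ.≤ n
    le = ℕ.<⇒≤
    S⊆ : ∀ {y} → y ∈ S → y ∈ Box m × (suc i′ , 2 ℕ.+ j″) <ˡ y
    S⊆ (here refl) = in-box (le (le i+2≤m′)) j<m′ , inj₂ (refl , ℕ.≤-refl)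
    S⊆ (there (here refl)) = in-box (le i+2≤m′) (le j<m′) , inj₁ ℕ.≤-refl
    S⊆ (there (there (here refl))) = in-box (le i+2≤m′) (le (le j<m′)) , inj₁ ℕ.≤-refl
    S⊆ (there (there (there (here refl)))) = in-box (le i+2≤m′) j<m′ , inj₁ ℕ.≤-refl
    S⊆ (there (there (there (there (here refl))))) = in-box i+2≤m′ (le (le j<m′)) , inj₁ (ℕ.n≤1+n _)
    S⊆L : ∀ {y} → y ∈ S → y ∈ L
    S⊆L {y} y∈ = later (proj₁ (S⊆ y∈)) (subst (_<ˡ y) (sym (cong₂ _,_ i≡ j≡)) (proj₂ (S⊆ y∈)))
    R : List Position
    R = filter (λ y → ¬? (y ∈? S)) L
    S! : Unique S
    S! = Unique.map⁺ (λ eq → cong₂ _,_ (ℕ.+-cancelʳ-≡ i′ _ _ (cong proj₁ eq)) (ℕ.+-cancelʳ-≡ j″ _ _ (cong proj₂ eq)))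
      (((λ ()) ∷ (λ ()) ∷ (λ ()) ∷ (λ ()) ∷ []) ∷ ((λ ()) ∷ (λ ()) ∷ (λ ()) ∷ []) ∷ ((λ ()) ∷ (λ ()) ∷ []) ∷ ((λ ()) ∷ []) ∷ [] ∷ [])
    tail! : Unique L
    tail! with _ ∷ u ← L! = u
    L↭R++S : L ↭ R ++ S
    L↭R++S = unique-⊆⊇⇒↭ tail! (Unique.++⁺ (Unique.filter⁺ (λ y → ¬? (y ∈? S)) tail!) S!
        λ { (y∈R , y∈S) → proj₂ (∈-filter⁻ (λ y → ¬? (y ∈? S)) {xs = L} y∈R) y∈S }) to from
      where
      to : ∀ {y} → y ∈ L → y ∈ R ++ S
      to {y} y∈ with y ∈? S
      ... | yes y∈S = ∈-++⁺ʳ R y∈S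
      ... | no y∉S = ∈-++⁺ˡ (∈-filter⁺ (λ y → ¬? (y ∈? S)) y∈ y∉S)
      from : ∀ {y} → y ∈ R ++ S → y ∈ L
      from y∈ with ∈-++⁻ R y∈
      ... | inj₁ y∈R = proj₁ (∈-filter⁻ (λ y → ¬? (y ∈? S)) {xs = L} y∈R)
      ... | inj₂ y∈S = S⊆L y∈S

  -- The determinant telescopes when vertices are added from the last to the first: each contributes
  -- its escape probability, at most `escape` if its window fits and at most 1 at the rim.
  Box-suffix-bound : ∀ m P L → Box m ≡ P ++ L → D L p ≤ escape ^ length (filter (fits? m) L)
  Box-suffix-bound m P []      eq = ℚ.≤-refl
  Box-suffix-bound m P (x ∷ L) eq = split (fits? m x)
    where
    rest : D L p ≤ escape ^ length (filter (fits? m) L)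
    rest = Box-suffix-bound m (P ++ x ∷ []) L (trans eq (sym (++-assoc P (x ∷ []) L)))
    split : Dec (Fits m x) → D (x ∷ L) p ≤ escape ^ length (filter (fits? m) (x ∷ L))
    split (no ¬fit) = subst (λ l → D (x ∷ L) p ≤ escape ^ length l) (sym (filter-reject (fits? m) ¬fit))
      (ℚ.≤-trans (D-∷≤ (box-substochastic (unique-suffix P (subst Unique eq (Box-unique m))))) rest)
    split (yes fit) = subst (λ l → D (x ∷ L) p ≤ escape ^ length l) (sym (filter-accept (fits? m) fit))
      (ℚ.≤-trans (escape-bound m P eq fit) (*-monoˡ escape 0≤escape rest))

  0<ι^ : ∀ a n {{_ : NonZero a}} → 0ℚ < ι a ^ n
  0<ι^ a n = subst (0ℚ <_) (ι-^ a n) (ℚ.<-≤-trans (ℚ.positive⁻¹ 1ℚ) (ι-mono (ℕ.m^n>0 a n)))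

  -- Since `A m` is 6^(m²) times a determinant and 16 / 3 = 6 · 8 / 9, it suffices that (961 /
  -- 1092)^k is at most (8 / 9)^(m²). This is `numeric` with denominators cleared.
  A-bound : ∀ m k → length (filter (fits? m) (Box m)) ≡ k →
    6 ℕ.^ (m ℕ.* m) ℕ.* 961 ℕ.^ k ℕ.* 3 ℕ.^ (m ℕ.* m) ℕ.≤ 16 ℕ.^ (m ℕ.* m) ℕ.* 1092 ℕ.^ k →
    A m ℕ.* 3 ℕ.^ (m ℕ.* m) ℕ.≤ 16 ℕ.^ (m ℕ.* m)
  A-bound m k fits numeric = ℕ.*-cancelʳ-≤ _ _ (1092 ℕ.^ k) {{ℕ.m^n≢0 1092 k}} (ι-cancel-≤ (begin
    ι (A m ℕ.* 3^ ℕ.* 1092 ℕ.^ k) ≡⟨ trans (ι-* (A m ℕ.* 3^) (1092 ℕ.^ k)) (cong (_* ι (1092 ℕ.^ k)) (ι-* (A m) 3^)) ⟩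
    ι (A m) * ι 3^ * ι (1092 ℕ.^ k) ≤⟨ *-monoʳ _ (0≤ι (1092 ℕ.^ k)) (*-monoʳ _ (0≤ι 3^) ιA≤) ⟩
    ι 6 ^ N * escape ^ k * ι 3^ * ι (1092 ℕ.^ k) ≡⟨ solve 4 (λ a b d e → a :* b :* d :* e := a :* (b :* e) :* d) refl (ι 6 ^ N) (escape ^ k) (ι 3^) (ι (1092 ℕ.^ k)) ⟩
    ι 6 ^ N * (escape ^ k * ι (1092 ℕ.^ k)) * ι 3^ ≡⟨ cong₂ (λ a b → a * b * ι 3^) (sym (ι-^ 6 N)) escape^k ⟩
    ι (6 ℕ.^ N) * ι (961 ℕ.^ k) * ι 3^ ≡⟨ trans (ι-* (6 ℕ.^ N ℕ.* 961 ℕ.^ k) 3^) (cong (_* ι 3^) (ι-* (6 ℕ.^ N) (961 ℕ.^ k))) ⟨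
    ι (6 ℕ.^ N ℕ.* 961 ℕ.^ k ℕ.* 3^) ≤⟨ ι-mono numeric ⟩
    ι (16 ℕ.^ N ℕ.* 1092 ℕ.^ k) ∎))
    where
    open ℚ.≤-Reasoning
    N = m ℕ.* m
    3^ = 3 ℕ.^ N
    ιA≤ : ι (A m) ≤ ι 6 ^ N * escape ^ k
    ιA≤ = subst (_≤ ι 6 ^ N * escape ^ k) (sym (ι-A m)) (*-monoˡ (ι 6 ^ N) (ℚ.<⇒≤ (0<ι^ 6 N)) (subst (λ k → D (Box m) p ≤ escape ^ k) fits (Box-suffix-bound m [] (Box m) refl)))
    escape^k : escape ^ k * ι (1092 ℕ.^ k) ≡ ι (961 ℕ.^ k)
    escape^k = trans (cong (escape ^ k *_) (ι-^ 1092 k)) (trans (sym (*-^ escape (ι 1092) k)) (sym (ι-^ 961 k)))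

  abstract
    -- 51 is the least m with (961 / 1092) ^ ((m - 2)²) ≤ (8 / 9) ^ (m²), and
    -- the windows of (m - 2)² positions fit into the box.
    A-small : ∃ λ m → 1 ℕ.≤ m × A m ℕ.* 3 ℕ.^ (m ℕ.* m) ℕ.≤ 16 ℕ.^ (m ℕ.* m)
    A-small = 51 , s≤s z≤n , A-bound 51 2401 refl (ℕ.≤ᵇ⇒≤ _ _ tt)

-- Circulant triangulations of the torus.

module Circulants where

  open FiniteLists
  open SpanningTree
  open RotationSystems
  open import Data.List.Base using (List; []; _∷_; length; map; filter; allFin; cartesianProduct)
  open import Data.Nat.Base as ℕ using (ℕ; zero; suc; _+_; _*_; _∸_; _≤_; _<_; z≤n; s≤s; _%_)
  open import Data.Nat.DivMod using (m%n<n; m<n⇒m%n≡m; [m+n]%n≡m%n; %-distribˡ-+; m%n%n≡m%n)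
  open import Data.Nat.Solver using (module +-*-Solver)
  open import Data.Vec.Base as Vec using (Vec)
  import Data.Vec.Properties as Vec
  open import Relation.Binary.Construct.Closure.ReflexiveTransitive as Star using (Star; ε; _◅_; _◅◅_)
  open +-*-Solver

  completeGraph-unique : ∀ n → Unique (completeGraph n)
  completeGraph-unique n = Unique.filter⁺ (λ (u , v) → u Fin.<? v) (Unique.cartesianProduct⁺ (Unique.allFin⁺ n) (Unique.allFin⁺ n))

  simple-oriented : ∀ {n} {E : EdgeSet n} → E ∈ simpleGraphs n → ∀ {u v} → (u , v) ∈ E → u Fin.< v
  simple-oriented {n} E∈ e∈ = proj₂ (∈-filter⁻ (λ (u , v) → u Fin.<? v) {xs = cartesianProduct (allFin n) (allFin n)} (∈-subsets⇒⊆ (completeGraph n) E∈ e∈))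

  simple-unique : ∀ {n} {E : EdgeSet n} → E ∈ simpleGraphs n → Unique E
  simple-unique {n} = ∈-subsets⇒unique (completeGraph-unique n)

  data At {A B : Set} : List A → List B → A → B → Set where
    here  : ∀ {x y xs ys} → At (x ∷ xs) (y ∷ ys) x y
    there : ∀ {x y x′ y′ xs ys} → At xs ys x y → At (x′ ∷ xs) (y′ ∷ ys) x y

  at⇒∈ : ∀ {A B : Set} {xs : List A} {ys : List B} {x y} → At xs ys x y → x ∈ xs
  at⇒∈ here = here refl
  at⇒∈ (there at) = there (at⇒∈ at)

  choose : ∀ {P : Set} → Dec P → ℕ → ℕ → ℕ
  choose (yes _) a b = a
  choose (no _)  a b = b

  choose-yes : ∀ {P : Set} (d : Dec P) {a b} → P → choose d a b ≡ a
  choose-yes (yes _) p = refl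
  choose-yes (no ¬p) p = ⊥-elim (¬p p)

  choose-no : ∀ {P : Set} (d : Dec P) {a b} → ¬ P → choose d a b ≡ b
  choose-no (yes p) ¬p = ⊥-elim (¬p p)
  choose-no (no _)  ¬p = refl

  assoc : List ℕ → List ℕ → ℕ → ℕ
  assoc (k ∷ ks) (v ∷ vs) x = choose (x ℕ.≟ k) v (assoc ks vs x)
  assoc _        _        x = x

  assoc-at : ∀ {ks vs x y} → Unique ks → At ks vs x y → assoc ks vs x ≡ y
  assoc-at {k ∷ ks} {x = x} _        here       = choose-yes (x ℕ.≟ k) refl
  assoc-at {k ∷ ks} {x = x} (k∉ ∷ u) (there at) =
    trans (choose-no (x ℕ.≟ k) (λ x≡k → All.lookup k∉ (at⇒∈ at) (sym x≡k))) (assoc-at u at)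

  -- With n = m + t + 1 vertices, the negatives of the steps 1, m + 1, m modulo n are m + t, t, t +
  -- 1, so no subtraction occurs. The condition on `t` separates the positive steps from the
  -- negative ones.
  module Circulant (m t : ℕ) (2≤m : 2 ≤ m) (m+2≤t : suc (suc m) ≤ t) (12≤n : 12 ≤ suc (m + t)) where

    n : ℕ
    n = suc (m + t)

    V : Set
    V = Fin n

    vertex : ℕ → V
    vertex x = fromℕ< (m%n<n x n)

    toℕ-vertex : ∀ x → toℕ (vertex x) ≡ x % n
    toℕ-vertex x = Fin.toℕ-fromℕ< (m%n<n x n)

    toℕ-vertex-< : ∀ {x} → x < n → toℕ (vertex x) ≡ x
    toℕ-vertex-< {x} x<n = trans (toℕ-vertex x) (m<n⇒m%n≡m x<n)

    vertex-cong : ∀ x y → x % n ≡ y % n → vertex x ≡ vertex y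
    vertex-cong x y eq = Fin.toℕ-injective (trans (toℕ-vertex x) (trans eq (sym (toℕ-vertex y))))

    vertex-toℕ : ∀ v → vertex (toℕ v) ≡ v
    vertex-toℕ v = Fin.toℕ-injective (toℕ-vertex-< (Fin.toℕ<n v))

    vertex-+ : ∀ x y → vertex (toℕ (vertex x) + y) ≡ vertex (x + y)
    vertex-+ x y = vertex-cong (toℕ (vertex x) + y) (x + y) (begin
      (toℕ (vertex x) + y) % n ≡⟨ cong (λ k → (k + y) % n) (toℕ-vertex x) ⟩
      (x % n + y) % n ≡⟨ %-distribˡ-+ (x % n) y n ⟩
      (x % n % n + y % n) % n ≡⟨ cong (λ k → (k + y % n) % n) (m%n%n≡m%n x n) ⟩
      (x % n + y % n) % n ≡⟨ %-distribˡ-+ x y n ⟨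
      (x + y) % n ∎)
      where open ≡-Reasoning

    vertex-+n : ∀ x → vertex (x + n) ≡ vertex x
    vertex-+n x = vertex-cong (x + n) x ([m+n]%n≡m%n x n)

    infixl 6 _⊞_
    _⊞_ : V → ℕ → V
    v ⊞ o = vertex (toℕ v + o)

    ⊞-⊞ : ∀ v x y → v ⊞ x ⊞ y ≡ v ⊞ (x + y)
    ⊞-⊞ v x y = trans (vertex-+ (toℕ v + x) y) (cong vertex (ℕ.+-assoc (toℕ v) x y))

    ⊞-n : ∀ v → v ⊞ n ≡ v
    ⊞-n v = trans (vertex-+n (toℕ v)) (vertex-toℕ v)

    difference : V → V → ℕ
    difference v u = (toℕ u + (n ∸ toℕ v)) % n

    difference-⊞ : ∀ v {o} → o < n → difference v (v ⊞ o) ≡ o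
    difference-⊞ v {o} o<n = begin
      (toℕ (v ⊞ o) + (n ∸ toℕ v)) % n ≡⟨ toℕ-vertex (toℕ (v ⊞ o) + (n ∸ toℕ v)) ⟨
      toℕ (v ⊞ o ⊞ (n ∸ toℕ v)) ≡⟨ cong toℕ (⊞-⊞ v o (n ∸ toℕ v)) ⟩
      toℕ (v ⊞ (o + (n ∸ toℕ v))) ≡⟨ cong (toℕ ∘ vertex) (trans (solve 3 (λ v o k → v :+ (o :+ k) := o :+ (v :+ k)) refl (toℕ v) o (n ∸ toℕ v)) (cong (o +_) (ℕ.m+[n∸m]≡n (ℕ.<⇒≤ (Fin.toℕ<n v))))) ⟩
      toℕ (vertex (o + n)) ≡⟨ cong toℕ (vertex-+n o) ⟩
      toℕ (vertex o) ≡⟨ toℕ-vertex-< o<n ⟩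
      o ∎
      where open ≡-Reasoning

    ⊞-injective : ∀ v {o o′} → o < n → o′ < n → v ⊞ o ≡ v ⊞ o′ → o ≡ o′
    ⊞-injective v o<n o′<n eq = trans (sym (difference-⊞ v o<n)) (trans (cong (difference v) eq) (difference-⊞ v o′<n))

    -- The steps 1, m + 1, m and their negatives modulo n, in cyclic order.
    o₀ o₁ o₂ o₃ o₄ o₅ : ℕ
    o₀ = 1
    o₁ = suc m
    o₂ = m
    o₃ = m + t
    o₄ = t
    o₅ = suc t

    offsets rotated : List ℕ
    offsets = o₀ ∷ o₁ ∷ o₂ ∷ o₃ ∷ o₄ ∷ o₅ ∷ []
    rotated = o₁ ∷ o₂ ∷ o₃ ∷ o₄ ∷ o₅ ∷ o₀ ∷ []

    private
      1<t : 1 < t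
      1<t = ℕ.≤-trans 2≤m (ℕ.≤-trans (ℕ.≤-trans (ℕ.n≤1+n m) (ℕ.n≤1+n (suc m))) m+2≤t)
      m<t : m < t
      m<t = ℕ.≤-trans (ℕ.n≤1+n (suc m)) m+2≤t
      1+t<m+t : suc t < m + t
      1+t<m+t = ℕ.+-monoˡ-≤ t 2≤m
      t<m+t : t < m + t
      t<m+t = ℕ.<-trans (ℕ.n<1+n t) 1+t<m+t

    offsets-unique : Unique offsets
    offsets-unique =
      ( ℕ.<⇒≢ (s≤s (ℕ.≤-trans (s≤s z≤n) 2≤m)) ∷ ℕ.<⇒≢ 2≤m ∷ ℕ.<⇒≢ (ℕ.<-trans 1<t t<m+t) ∷ ℕ.<⇒≢ 1<t ∷ ℕ.<⇒≢ (s≤s (ℕ.<⇒≤ 1<t)) ∷ []) ∷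
      ((λ eq → ℕ.<⇒≢ (ℕ.n<1+n m) (sym eq)) ∷ ℕ.<⇒≢ (ℕ.<-trans m+2≤t t<m+t) ∷ ℕ.<⇒≢ m+2≤t ∷ ℕ.<⇒≢ (s≤s m<t) ∷ []) ∷
      (ℕ.<⇒≢ (ℕ.<-trans m<t t<m+t) ∷ ℕ.<⇒≢ m<t ∷ ℕ.<⇒≢ (ℕ.<-trans m<t (ℕ.n<1+n t)) ∷ []) ∷
      ((λ eq → ℕ.<⇒≢ t<m+t (sym eq)) ∷ (λ eq → ℕ.<⇒≢ 1+t<m+t (sym eq)) ∷ []) ∷
      (ℕ.<⇒≢ (ℕ.n<1+n t) ∷ []) ∷
      [] ∷ []

    offsets-< : ∀ {o} → o ∈ offsets → o < n
    offsets-< (here refl) = s≤s (ℕ.≤-trans (ℕ.≤-trans (s≤s z≤n) 2≤m) (ℕ.m≤m+n m t))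
    offsets-< (there (here refl)) = s≤s (subst (_≤ m + t) (ℕ.+-comm m 1) (ℕ.+-monoʳ-≤ m (ℕ.<⇒≤ 1<t)))
    offsets-< (there (there (here refl))) = s≤s (ℕ.m≤m+n m t)
    offsets-< (there (there (there (here refl)))) = ℕ.≤-refl
    offsets-< (there (there (there (there (here refl))))) = s≤s (ℕ.m≤n+m t m)
    offsets-< (there (there (there (there (there (here refl)))))) = s≤s t<m+t

    offsets-> : ∀ {o} → o ∈ offsets → 0 < o
    offsets-> (here refl) = s≤s z≤n
    offsets-> (there (here refl)) = s≤s z≤n
    offsets-> (there (there (here refl))) = ℕ.≤-trans (s≤s z≤n) 2≤m
    offsets-> (there (there (there (here refl)))) = ℕ.≤-trans (s≤s z≤n) t<m+t
    offsets-> (there (there (there (there (here refl))))) = ℕ.<⇒≤ 1<t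
    offsets-> (there (there (there (there (there (here refl)))))) = s≤s z≤n

    around : V → List V
    around v = map (v ⊞_) offsets

    around-unique : ∀ v → Unique (around v)
    around-unique v = unique-map⁺ (v ⊞_) (λ o∈ o′∈ → ⊞-injective v (offsets-< o∈) (offsets-< o′∈)) offsets-unique

    opposites : List ℕ
    opposites = o₃ ∷ o₄ ∷ o₅ ∷ o₀ ∷ o₁ ∷ o₂ ∷ []

    opposite : ∀ {o} → o ∈ offsets → ∃ λ o′ → At offsets opposites o o′
    opposite (here refl) = _ , here
    opposite (there (here refl)) = _ , there here
    opposite (there (there (here refl))) = _ , there (there here)
    opposite (there (there (there (here refl)))) = _ , there (there (there here))
    opposite (there (there (there (there (here refl))))) = _ , there (there (there (there here)))
    opposite (there (there (there (there (there (here refl)))))) = _ , there (there (there (there (there here))))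

    opposite-+ : ∀ {o o′} → At offsets opposites o o′ → o + o′ ≡ n × o′ ∈ offsets
    opposite-+ here = refl , there (there (there (here refl)))
    opposite-+ (there here) = refl , there (there (there (there (here refl))))
    opposite-+ (there (there here)) = ℕ.+-suc m t , there (there (there (there (there (here refl)))))
    opposite-+ (there (there (there here))) = ℕ.+-comm (m + t) 1 , here refl
    opposite-+ (there (there (there (there here)))) = ℕ.+-comm t (suc m) , there (here refl)
    opposite-+ (there (there (there (there (there here))))) = cong suc (ℕ.+-comm t m) , there (there (here refl))
    opposite-+ (there (there (there (there (there (there ()))))))

    ⊞-opposite : ∀ v {o o′} → At offsets opposites o o′ → v ⊞ o ⊞ o′ ≡ v
    ⊞-opposite v at = trans (⊞-⊞ v _ _) (trans (cong (v ⊞_) (proj₁ (opposite-+ at))) (⊞-n v))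

    around-sym : ∀ {u v} → v ∈ around u → u ∈ around v
    around-sym {u} v∈ with o , o∈ , refl ← ∈-map⁻ (u ⊞_) v∈ with o′ , at ← opposite o∈ =
      subst (_∈ around (u ⊞ o)) (⊞-opposite u at) (∈-map⁺ (u ⊞ o ⊞_) (proj₂ (opposite-+ at)))

    around-irreflexive : ∀ {v} → v ∉ around v
    around-irreflexive {v} v∈ with o , o∈ , eq ← ∈-map⁻ (v ⊞_) v∈ =
      ℕ.<⇒≢ (offsets-> o∈) (⊞-injective v (s≤s z≤n) (offsets-< o∈) (trans (trans (cong vertex (ℕ.+-identityʳ (toℕ v))) (vertex-toℕ v)) eq))

    open DecMembership (Fin._≟_ {n}) using (_∈?_)

    E : EdgeSet n
    E = filter (λ (u , v) → v ∈? around u) (completeGraph n)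

    E∈ : E ∈ simpleGraphs n
    E∈ = filter∈subsets (λ (u , v) → v ∈? around u) (completeGraph n)

    adj⇒around : ∀ {u v} → Adj E u v → v ∈ around u
    adj⇒around (inj₁ e) = proj₂ (∈-filter⁻ (λ (u , v) → v ∈? around u) {xs = completeGraph n} e)
    adj⇒around (inj₂ e) = around-sym (proj₂ (∈-filter⁻ (λ (u , v) → v ∈? around u) {xs = completeGraph n} e))

    around⇒adj : ∀ {u v} → v ∈ around u → Adj E u v
    around⇒adj {u} {v} v∈ with ℕ.<-cmp (toℕ u) (toℕ v)
    ... | tri< u<v _ _ = inj₁ (edge v∈ u<v)
      where
      edge : ∀ {u v} → v ∈ around u → u Fin.< v → (u , v) ∈ E
      edge {u} {v} v∈ u<v = ∈-filter⁺ (λ (u , v) → v ∈? around u) (∈-filter⁺ (λ (u , v) → u Fin.<? v) (∈-cartesianProduct⁺ (∈-allFin u) (∈-allFin v)) u<v) v∈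
    ... | tri≈ _ eq _ = ⊥-elim (around-irreflexive (subst (_∈ around u) (sym (Fin.toℕ-injective eq)) v∈))
    ... | tri> _ _ v<u = inj₂ (edge (around-sym v∈) v<u)
      where
      edge : ∀ {u v} → v ∈ around u → u Fin.< v → (u , v) ∈ E
      edge {u} {v} v∈ u<v = ∈-filter⁺ (λ (u , v) → v ∈? around u) (∈-filter⁺ (λ (u , v) → u Fin.<? v) (∈-cartesianProduct⁺ (∈-allFin u) (∈-allFin v)) u<v) v∈

    regular : Regular E 6
    regular v = unique-⊆⊇⇒length≡ (Unique.filter⁺ (adj? E v) (Unique.allFin⁺ n)) (around-unique v)
      (λ u∈ → adj⇒around (proj₂ (∈-filter⁻ (adj? E v) {xs = allFin n} u∈)))
      (λ {u} u∈ → ∈-filter⁺ (adj? E v) (∈-allFin u) (around⇒adj u∈))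

    adj-sym : ∀ {u v} → Adj E u v → Adj E v u
    adj-sym (inj₁ e) = inj₂ e
    adj-sym (inj₂ e) = inj₁ e

    connected : Connected E
    connected u v = let (p , p! , path) = simple Fin._≟_ (Star.reverse adj-sym (from-0 u) ◅◅ from-0 v) in
      p , (p! , path-linked path) , path-head path , path-last path
      where
      climb : ∀ k → Star (Adj E) (vertex 0) (vertex k)
      climb zero = ε
      climb (suc k) = climb k ◅◅ (around⇒adj (subst (_∈ around (vertex k)) (trans (vertex-+ k 1) (cong vertex (ℕ.+-comm k 1))) (here refl)) ◅ ε)
      from-0 : ∀ v → Star (Adj E) (vertex 0) v
      from-0 v = subst (Star (Adj E) (vertex 0)) (vertex-toℕ v) (climb (toℕ v))

    follow : V → V → V
    follow v u = v ⊞ assoc offsets rotated (difference v u)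

    ρ : RotationSystem n
    ρ = Vec.tabulate λ v → Vec.tabulate (follow v)

    next-ρ : ∀ v u → next ρ v u ≡ follow v u
    next-ρ v u = trans (cong (λ f → Vec.lookup f u) (Vec.lookup∘tabulate (λ v → Vec.tabulate (follow v)) v)) (Vec.lookup∘tabulate (follow v) u)

    next-⊞ : ∀ v {o o′} → At offsets rotated o o′ → next ρ v (v ⊞ o) ≡ v ⊞ o′
    next-⊞ v {o} at = trans (next-ρ v (v ⊞ o)) (cong (v ⊞_)
      (trans (cong (assoc offsets rotated) (difference-⊞ v (offsets-< (at⇒∈ at)))) (assoc-at offsets-unique at)))

    private
      r₀ : At offsets rotated o₀ o₁
      r₀ = here
      r₁ : At offsets rotated o₁ o₂
      r₁ = there here
      r₂ : At offsets rotated o₂ o₃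
      r₂ = there (there here)
      r₃ : At offsets rotated o₃ o₄
      r₃ = there (there (there here))
      r₄ : At offsets rotated o₄ o₅
      r₄ = there (there (there (there here)))
      r₅ : At offsets rotated o₅ o₀
      r₅ = there (there (there (there (there here))))

    rotation : IsRotation E ρ
    rotation v u a = around⇒adj next∈ , λ w b → reach (∈-map⁻ (v ⊞_) (adj⇒around a)) (∈-map⁻ (v ⊞_) (adj⇒around b))
      where
      f = next ρ v
      follows : ∀ {o} → o ∈ offsets → ∃ λ o′ → At offsets rotated o o′ × o′ ∈ offsets
      follows (here refl) = _ , r₀ , there (here refl)
      follows (there (here refl)) = _ , r₁ , there (there (here refl))
      follows (there (there (here refl))) = _ , r₂ , there (there (there (here refl)))
      follows (there (there (there (here refl)))) = _ , r₃ , there (there (there (there (here refl))))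
      follows (there (there (there (there (here refl))))) = _ , r₄ , there (there (there (there (there (here refl)))))
      follows (there (there (there (there (there (here refl)))))) = _ , r₅ , here refl
      next∈ : f u ∈ around v
      next∈ = let (o , o∈ , u≡) = ∈-map⁻ (v ⊞_) (adj⇒around a) ; (o′ , at , o′∈) = follows o∈ in
        subst (_∈ around v) (sym (trans (cong f u≡) (next-⊞ v at))) (∈-map⁺ (v ⊞_) o′∈)
      iterate-+ : ∀ x i j → iterate f x (i + j) ≡ iterate f (iterate f x i) j
      iterate-+ x zero    j = refl
      iterate-+ x (suc i) j = iterate-+ (f x) i j
      go : ∀ {o o′ x} i → At offsets rotated o o′ → iterate f (v ⊞ o′) i ≡ x → iterate f (v ⊞ o) (suc i) ≡ x
      go i at eq = trans (cong (λ z → iterate f z i) (next-⊞ v at)) eq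
      to-0 : ∀ {o} → o ∈ offsets → ∃ λ i → i ≤ 5 × iterate f (v ⊞ o) i ≡ v ⊞ o₀
      to-0 (here refl) = 0 , z≤n , refl
      to-0 (there (here refl)) = 5 , ℕ.≤-refl , go 4 r₁ (go 3 r₂ (go 2 r₃ (go 1 r₄ (go 0 r₅ refl))))
      to-0 (there (there (here refl))) = 4 , ℕ.n≤1+n 4 , go 3 r₂ (go 2 r₃ (go 1 r₄ (go 0 r₅ refl)))
      to-0 (there (there (there (here refl)))) = 3 , s≤s (s≤s (s≤s z≤n)) , go 2 r₃ (go 1 r₄ (go 0 r₅ refl))
      to-0 (there (there (there (there (here refl))))) = 2 , s≤s (s≤s z≤n) , go 1 r₄ (go 0 r₅ refl)
      to-0 (there (there (there (there (there (here refl)))))) = 1 , s≤s z≤n , go 0 r₅ refl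
      from-0 : ∀ {o} → o ∈ offsets → ∃ λ i → i ≤ 5 × iterate f (v ⊞ o₀) i ≡ v ⊞ o
      from-0 (here refl) = 0 , z≤n , refl
      from-0 (there (here refl)) = 1 , s≤s z≤n , go 0 r₀ refl
      from-0 (there (there (here refl))) = 2 , s≤s (s≤s z≤n) , go 1 r₀ (go 0 r₁ refl)
      from-0 (there (there (there (here refl)))) = 3 , s≤s (s≤s (s≤s z≤n)) , go 2 r₀ (go 1 r₁ (go 0 r₂ refl))
      from-0 (there (there (there (there (here refl))))) = 4 , ℕ.n≤1+n 4 , go 3 r₀ (go 2 r₁ (go 1 r₂ (go 0 r₃ refl)))
      from-0 (there (there (there (there (there (here refl)))))) = 5 , ℕ.≤-refl , go 4 r₀ (go 3 r₁ (go 2 r₂ (go 1 r₃ (go 0 r₄ refl))))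
      reach : ∀ {u w} → (∃ λ o → o ∈ offsets × u ≡ v ⊞ o) → (∃ λ o → o ∈ offsets × w ≡ v ⊞ o) → Orbit f n u w
      reach (o , o∈ , refl) (o′ , o′∈ , refl) = fromℕ< small ,
        trans (cong (iterate f (v ⊞ o)) (Fin.toℕ-fromℕ< small)) (trans (iterate-+ (v ⊞ o) i j) (trans (cong (λ z → iterate f z j) (proj₂ (proj₂ (to-0 o∈)))) (proj₂ (proj₂ (from-0 o′∈)))))
        where
        i = proj₁ (to-0 o∈)
        j = proj₁ (from-0 o′∈)
        -- Every pair is connected by way of the offset 1, with at most five steps before it and
        -- five after; `Orbit f n` requires fewer than n in total.
        small : i + j < n
        small = ℕ.≤-trans (s≤s (ℕ.≤-trans (ℕ.+-mono-≤ (proj₁ (proj₂ (to-0 o∈))) (proj₁ (proj₂ (from-0 o′∈)))) (ℕ.n≤1+n 10))) 12≤n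

    open Rotation E (simple-oriented E∈) (simple-unique E∈) ρ rotation regular using (Darts; ∈-darts⁻; Triangular; all-triangular⇒faces; length-edges; φ)

    -- The offset with which a face continues after a dart with the corresponding entry of
    -- `offsets`: it follows the opposite offset in the rotation.
    turned : List ℕ
    turned = o₄ ∷ o₅ ∷ o₀ ∷ o₁ ∷ o₂ ∷ o₃ ∷ []

    φ-⊞ : ∀ v {o o′} → At offsets turned o o′ → φ (v , v ⊞ o) ≡ (v ⊞ o , v ⊞ o ⊞ o′)
    φ-⊞ v {o} {o′} at = cong (v ⊞ o ,_) (trans (cong (next ρ (v ⊞ o)) (sym (proj₂ (proj₂ (via at))))) (next-⊞ (v ⊞ o) (proj₁ (proj₂ (via at)))))
      where
      via : ∀ {o o′} → At offsets turned o o′ → ∃ λ o″ → At offsets rotated o″ o′ × v ⊞ o ⊞ o″ ≡ v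
      via here = o₃ , r₃ , ⊞-opposite v here
      via (there here) = o₄ , r₄ , ⊞-opposite v (there here)
      via (there (there here)) = o₅ , r₅ , ⊞-opposite v (there (there here))
      via (there (there (there here))) = o₀ , r₀ , ⊞-opposite v (there (there (there here)))
      via (there (there (there (there here)))) = o₁ , r₁ , ⊞-opposite v (there (there (there (there here))))
      via (there (there (there (there (there here))))) = o₂ , r₂ , ⊞-opposite v (there (there (there (there (there here)))))
      via (there (there (there (there (there (there ()))))))

    -- Along a face the offsets advance cyclically by four places, so three consecutive ones are
    -- every other entry of `offsets`. Their sum is n or 2n.
    triangular : ∀ {d} → d ∈ Darts → Triangular d
    triangular {u , v} d∈ = let (o , o∈ , v≡) = ∈-map⁻ (u ⊞_) (adj⇒around (∈-darts⁻ d∈)) in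
      subst (λ v → Triangular (u , v)) (sym v≡) (go o∈)
      where
      s₀ = here
      s₁ = there here
      s₂ = there (there here)
      s₃ = there (there (there here))
      s₄ = there (there (there (there here)))
      s₅ = there (there (there (there (there here))))
      close : ∀ {x y z} → At offsets turned x y → At offsets turned y z → At offsets turned z x → x + y + z ≡ n ⊎ x + y + z ≡ n + n → Triangular (u , u ⊞ x)
      close {x} {y} {z} a b c sum = begin
        φ (φ (φ (u , u ⊞ x))) ≡⟨ cong (φ ∘ φ) (φ-⊞ u a) ⟩
        φ (φ (u ⊞ x , u ⊞ x ⊞ y)) ≡⟨ cong φ (φ-⊞ (u ⊞ x) b) ⟩
        φ (u ⊞ x ⊞ y , u ⊞ x ⊞ y ⊞ z) ≡⟨ φ-⊞ (u ⊞ x ⊞ y) c ⟩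
        (u ⊞ x ⊞ y ⊞ z , u ⊞ x ⊞ y ⊞ z ⊞ x) ≡⟨ cong (λ w → w , w ⊞ x) (trans (cong (_⊞ z) (⊞-⊞ u x y)) (trans (⊞-⊞ u (x + y) z) (round sum))) ⟩
        (u , u ⊞ x) ∎
        where
        open ≡-Reasoning
        round : x + y + z ≡ n ⊎ x + y + z ≡ n + n → u ⊞ (x + y + z) ≡ u
        round (inj₁ eq) = trans (cong (u ⊞_) eq) (⊞-n u)
        round (inj₂ eq) = trans (cong (u ⊞_) eq) (trans (sym (⊞-⊞ u n n)) (trans (cong (_⊞ n) (⊞-n u)) (⊞-n u)))
      go : ∀ {o} → o ∈ offsets → Triangular (u , u ⊞ o)
      go (here refl) = close s₀ s₄ s₂ (inj₁ (solve 2 (λ m t → con 1 :+ t :+ m := con 1 :+ (m :+ t)) refl m t))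
      go (there (here refl)) = close s₁ s₅ s₃ (inj₂ (solve 2 (λ m t → (con 1 :+ m) :+ (con 1 :+ t) :+ (m :+ t) := (con 1 :+ (m :+ t)) :+ (con 1 :+ (m :+ t))) refl m t))
      go (there (there (here refl))) = close s₂ s₀ s₄ (inj₁ (solve 2 (λ m t → m :+ con 1 :+ t := con 1 :+ (m :+ t)) refl m t))
      go (there (there (there (here refl)))) = close s₃ s₁ s₅ (inj₂ (solve 2 (λ m t → (m :+ t) :+ (con 1 :+ m) :+ (con 1 :+ t) := (con 1 :+ (m :+ t)) :+ (con 1 :+ (m :+ t))) refl m t))
      go (there (there (there (there (here refl))))) = close s₄ s₂ s₀ (inj₁ (solve 2 (λ m t → t :+ m :+ con 1 := con 1 :+ (m :+ t)) refl m t))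
      go (there (there (there (there (there (here refl)))))) = close s₅ s₃ s₁ (inj₂ (solve 2 (λ m t → (con 1 :+ t) :+ (m :+ t) :+ (con 1 :+ m) := (con 1 :+ (m :+ t)) :+ (con 1 :+ (m :+ t))) refl m t))

    genus-1 : HasGenus E ρ 1
    genus-1 = begin
      n + faces E ρ + 2 ≡⟨ cong (λ k → n + k + 2) (all-triangular⇒faces triangular) ⟩
      n + n * 2 + 2 ≡⟨ solve 1 (λ n → n :+ n :* con 2 :+ con 2 := n :* con 3 :+ con 2) refl n ⟩
      n * 3 + 2 ≡⟨ cong (_+ 2) length-edges ⟨
      length E + 2 ∎
      where open ≡-Reasoning

    E∈𝒳 : ∀ g → E ∈ 𝒳 n 6 (suc g)
    E∈𝒳 g = ∈-filter⁺ _ E∈ (connected , regular , ρ , rotation , suc zero , genus-1)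

-- Circulants with many spanning trees.

module ManyTrees where

  open Determinant
  open Elimination
  open MatrixTree
  open FiniteLists
  open SpanningTree
  open RotationSystems
  open LatticeFrames
  open BoxEstimate
  open Circulants
  open import Data.List.Base using (List; []; _∷_; _++_; length; map; filter; concatMap; allFin; upTo)
  open import Data.List.Properties using (length-map; length-upTo)
  open import Data.List.Relation.Binary.Permutation.Propositional using (_↭_)
  open import Data.List.Relation.Binary.Permutation.Propositional.Properties using (↭-length)
  open import Data.Nat.Base as ℕ using (ℕ; zero; suc; z≤n; s≤s; s≤s⁻¹; _%_; _/_; _∸_)
  open import Data.Nat.DivMod using (m%n<n; m<n⇒m%n≡m; [m+n]%n≡m%n; [m+kn]%n≡m%n; m≡m%n+[m/n]*n; m*n%n≡0)
  open import Data.Nat.Solver using (module +-*-Solver)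
  open import Data.Rational.Base using (ℚ; 0ℚ; _+_; _*_; _≤_)
  open import Algebra.Definitions.RawSemiring ℚ.+-*-rawSemiring using (_^_)
  open +-*-Solver

  module CirculantTrees (m t : ℕ) (2≤m : 2 ℕ.≤ m) (m+2≤t : suc (suc m) ℕ.≤ t) (12≤n : 12 ℕ.≤ suc (m ℕ.+ t))
    (k : ℕ) (fit : k ℕ.* (suc m ℕ.* suc m) ℕ.< t) where

    open Circulant m t 2≤m m+2≤t 12≤n

    a K : ℕ
    a = suc m
    K = k ℕ.* (a ℕ.* a)

    -- The root is the vertex with the largest number, so that arrows which increase the number lead
    -- to it.
    apex : V
    apex = vertex (m ℕ.+ t)

    toℕ-apex : toℕ apex ≡ m ℕ.+ t
    toℕ-apex = toℕ-vertex-< ℕ.≤-refl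

    open SpanningTrees E (simple-oriented E∈) (simple-unique E∈) apex
    open AcyclicChoices {V} Fin._≟_

    -- A number with lowest digits `i` and `j` in base `a` = m + 1. The steps 1, a and a - 1 of the
    -- circulant then move (i , j) as `hex` does, which is the origin of these steps; a vanishing
    -- digit marks a corridor.
    code : ℕ → Position → ℕ
    code q (i , j) = i ℕ.+ (j ℕ.+ q ℕ.* a) ℕ.* a

    place : ℕ → Position → V
    place q b = vertex (code q b)

    mod-code : ∀ {i} c → i ℕ.< a → (i ℕ.+ c ℕ.* a) % a ≡ i
    mod-code {i} c i<a = trans ([m+kn]%n≡m%n i c a) (m<n⇒m%n≡m i<a)

    div-code : ∀ {i} c → i ℕ.< a → (i ℕ.+ c ℕ.* a) / a ≡ c
    div-code {i} c i<a = ℕ.*-cancelʳ-≡ _ c a (ℕ.+-cancelˡ-≡ i _ _ (begin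
      i ℕ.+ (i ℕ.+ c ℕ.* a) / a ℕ.* a ≡⟨ cong (ℕ._+ (i ℕ.+ c ℕ.* a) / a ℕ.* a) (mod-code c i<a) ⟨
      (i ℕ.+ c ℕ.* a) % a ℕ.+ (i ℕ.+ c ℕ.* a) / a ℕ.* a ≡⟨ m≡m%n+[m/n]*n (i ℕ.+ c ℕ.* a) a ⟨
      i ℕ.+ c ℕ.* a ∎))
      where open ≡-Reasoning

    Inner : V → Set
    Inner v = toℕ v ℕ.< K × toℕ v % a ≢ 0 × (toℕ v / a) % a ≢ 0

    inner? : ∀ v → Dec (Inner v)
    inner? v = (toℕ v ℕ.<? K) ×-dec ¬? (toℕ v % a ℕ.≟ 0) ×-dec ¬? ((toℕ v / a) % a ℕ.≟ 0)

    code-bound : ∀ {q i j} → q ℕ.< k → i ℕ.≤ a → j ℕ.≤ a → code q (i , j) ℕ.≤ a ℕ.+ K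
    code-bound {q} {i} {j} q<k i≤ j≤ = ℕ.+-mono-≤ i≤ (begin
      (j ℕ.+ q ℕ.* a) ℕ.* a ≤⟨ ℕ.*-monoˡ-≤ a (ℕ.+-monoˡ-≤ (q ℕ.* a) j≤) ⟩
      suc q ℕ.* a ℕ.* a ≡⟨ ℕ.*-assoc (suc q) a a ⟩
      suc q ℕ.* (a ℕ.* a) ≤⟨ ℕ.*-monoˡ-≤ (a ℕ.* a) q<k ⟩
      K ∎)
      where open ℕ.≤-Reasoning

    code<n : ∀ {q i j} → q ℕ.< k → i ℕ.≤ a → j ℕ.≤ a → code q (i , j) ℕ.< n
    code<n q<k i≤ j≤ = s≤s (ℕ.≤-trans (code-bound q<k i≤ j≤) (ℕ.≤-trans (ℕ.≤-reflexive (sym (ℕ.+-suc m K))) (ℕ.+-monoʳ-≤ m fit)))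

    toℕ-place : ∀ {q i j} → q ℕ.< k → i ℕ.≤ a → j ℕ.≤ a → toℕ (place q (i , j)) ≡ code q (i , j)
    toℕ-place q<k i≤ j≤ = toℕ-vertex-< (code<n q<k i≤ j≤)

    ∈-Box⁻ : ∀ {i j} → (i , j) ∈ Box m → (∃ λ i′ → i ≡ suc i′ × i′ ℕ.< m) × (∃ λ j′ → j ≡ suc j′ × j′ ℕ.< m)
    ∈-Box⁻ b∈ with i∈ , j∈ ← ∈-cartesianProduct⁻ (range m) (range m) b∈ = ∈-range⁻ i∈ , ∈-range⁻ j∈

    -- On the boundary of the enlarged box, one of the digits vanishes.
    inner-digits : ∀ q {i j} → i ℕ.≤ a → j ℕ.≤ a → code q (i , j) % a ≢ 0 → (code q (i , j) / a) % a ≢ 0 → (i , j) ∈ Box m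
    inner-digits q {zero} {j} i≤ j≤ x≢ y≢ = ⊥-elim (x≢ (mod-code (j ℕ.+ q ℕ.* a) (s≤s z≤n)))
    inner-digits q {suc i} {j} i≤ j≤ x≢ y≢ with suc i ℕ.≟ a
    ... | yes refl = ⊥-elim (x≢ (m*n%n≡0 (suc (j ℕ.+ q ℕ.* a)) a))
    ... | no i≢a with j | j ℕ.≟ a
    ...   | j | yes refl = ⊥-elim (y≢ (trans (cong (_% a) (div-code (a ℕ.+ q ℕ.* a) (ℕ.≤∧≢⇒< i≤ i≢a))) (m*n%n≡0 (suc q) a)))
    ...   | zero | no _ = ⊥-elim (y≢ (trans (cong (_% a) (div-code (q ℕ.* a) (ℕ.≤∧≢⇒< i≤ i≢a))) (m*n%n≡0 q a)))
    ...   | suc j | no j≢a = ∈-cartesianProduct⁺ (∈-range⁺ (s≤s⁻¹ (ℕ.≤∧≢⇒< i≤ i≢a))) (∈-range⁺ (s≤s⁻¹ (ℕ.≤∧≢⇒< j≤ j≢a)))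

    code-injective : ∀ {q q′ b b′} → b ∈ Box m → b′ ∈ Box m → code q b ≡ code q′ b′ → q ≡ q′ × b ≡ b′
    code-injective {q} {q′} {i , j} {i′ , j′} b∈ b′∈ eq
      with (_ , refl , i<) , (_ , refl , j<) ← ∈-Box⁻ b∈ | (_ , refl , i′<) , (_ , refl , j′<) ← ∈-Box⁻ b′∈ = q≡ , cong₂ _,_ i≡ j≡
      where
      i≡ : i ≡ i′
      i≡ = trans (sym (mod-code (j ℕ.+ q ℕ.* a) (s≤s i<))) (trans (cong (_% a) eq) (mod-code (j′ ℕ.+ q′ ℕ.* a) (s≤s i′<)))
      c≡ : j ℕ.+ q ℕ.* a ≡ j′ ℕ.+ q′ ℕ.* a
      c≡ = trans (sym (div-code (j ℕ.+ q ℕ.* a) (s≤s i<))) (trans (cong (_/ a) eq) (div-code (j′ ℕ.+ q′ ℕ.* a) (s≤s i′<)))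
      j≡ : j ≡ j′
      j≡ = trans (sym (mod-code q (s≤s j<))) (trans (cong (_% a) c≡) (mod-code q′ (s≤s j′<)))
      q≡ : q ≡ q′
      q≡ = trans (sym (div-code q (s≤s j<))) (trans (cong (_/ a) c≡) (div-code q′ (s≤s j′<)))

    box≤a : ∀ {i j} → (i , j) ∈ Box m → i ℕ.≤ a × j ℕ.≤ a
    box≤a b∈ with (_ , refl , i<) , (_ , refl , j<) ← ∈-Box⁻ b∈ = s≤s (ℕ.<⇒≤ i<) , s≤s (ℕ.<⇒≤ j<)

    place-injective : ∀ {q q′ b b′} → q ℕ.< k → q′ ℕ.< k → b ∈ Box m → b′ ∈ Box m → place q b ≡ place q′ b′ → q ≡ q′ × b ≡ b′
    place-injective q< q′< b∈ b′∈ eq = code-injective b∈ b′∈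
      (trans (sym (toℕ-place q< (proj₁ (box≤a b∈)) (proj₂ (box≤a b∈)))) (trans (cong toℕ eq) (toℕ-place q′< (proj₁ (box≤a b′∈)) (proj₂ (box≤a b′∈)))))

    place-inner : ∀ {q b} → q ℕ.< k → b ∈ Box m → Inner (place q b)
    place-inner {q} {i , j} q<k b∈ with (i′ , refl , i<) , (j′ , refl , j<) ← ∈-Box⁻ b∈ =
      subst (λ x → x ℕ.< K × x % a ≢ 0 × (x / a) % a ≢ 0) (sym (toℕ-place q<k (proj₁ (box≤a b∈)) (proj₂ (box≤a b∈))))
        (small , (λ eq → case-suc (trans (sym (mod-code (j ℕ.+ q ℕ.* a) (s≤s i<))) eq)) ,
         λ eq → case-suc (trans (sym (trans (cong (_% a) (div-code (j ℕ.+ q ℕ.* a) (s≤s i<))) (mod-code q (s≤s j<)))) eq))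
      where
      case-suc : ∀ {x} → suc x ≢ 0
      case-suc ()
      small : code q (i , j) ℕ.< K
      small = begin-strict
        i ℕ.+ (j ℕ.+ q ℕ.* a) ℕ.* a <⟨ ℕ.+-monoˡ-< ((j ℕ.+ q ℕ.* a) ℕ.* a) (s≤s i<) ⟩
        suc (j ℕ.+ q ℕ.* a) ℕ.* a ≤⟨ ℕ.*-monoˡ-≤ a (ℕ.+-monoˡ-≤ (q ℕ.* a) (s≤s j<)) ⟩
        suc q ℕ.* a ℕ.* a ≡⟨ ℕ.*-assoc (suc q) a a ⟩
        suc q ℕ.* (a ℕ.* a) ≤⟨ ℕ.*-monoˡ-≤ (a ℕ.* a) q<k ⟩
        K ∎
        where open ℕ.≤-Reasoning

    inner-place : ∀ {v} → Inner v → ∃ λ q → ∃ λ b → q ℕ.< k × b ∈ Box m × v ≡ place q b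
    inner-place {v} (x<K , x≢ , y≢) = q , (i , j) , q<k , inner-digits q (ℕ.<⇒≤ i<a) (ℕ.<⇒≤ j<a)
        (subst (λ x → x % a ≢ 0) x≡ x≢) (subst (λ x → (x / a) % a ≢ 0) x≡ y≢) , trans (sym (vertex-toℕ v)) (cong vertex x≡)
      where
      x = toℕ v
      i = x % a
      y = x / a
      j = y % a
      q = y / a
      i<a = m%n<n x a
      j<a = m%n<n y a
      x≡ : x ≡ code q (i , j)
      x≡ = trans (m≡m%n+[m/n]*n x a) (cong (λ y → i ℕ.+ y ℕ.* a) (m≡m%n+[m/n]*n y a))
      q<k : q ℕ.< k
      q<k = ℕ.*-cancelʳ-< (a ℕ.* a) q k (ℕ.≤-<-trans (begin
        q ℕ.* (a ℕ.* a) ≡⟨ ℕ.*-assoc q a a ⟨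
        q ℕ.* a ℕ.* a ≤⟨ ℕ.*-monoˡ-≤ a (ℕ.m≤n+m (q ℕ.* a) j) ⟩
        (j ℕ.+ q ℕ.* a) ℕ.* a ≤⟨ ℕ.m≤n+m _ i ⟩
        code q (i , j) ≡⟨ x≡ ⟨
        x ∎) x<K)
        where open ℕ.≤-Reasoning

    -- Outside the boxes every vertex is sent to a larger one, again outside.
    hop : ℕ → ℕ
    hop x = choose (x ℕ.<? K) (choose (x % a ℕ.≟ 0) a 1) 1

    target : V → V
    target v = v ⊞ hop (toℕ v)

    Outer : ℕ → Set
    Outer x = ¬ (x ℕ.< K × x % a ≢ 0 × (x / a) % a ≢ 0)

    -- A step by `a` preserves a vanishing last digit. If instead the second digit vanishes, a step
    -- by 1 either preserves that or carries into a vanishing last digit. Beyond `K` there are no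
    -- boxes, and `fit` leaves room for a last step by `a`.
    hop-spec : ∀ x → x ℕ.< m ℕ.+ t → Outer x → (hop x ≡ o₀ ⊎ hop x ≡ o₁) × x ℕ.+ hop x ℕ.< n × Outer (x ℕ.+ hop x)
    hop-spec x x<r out with x ℕ.<? K
    ... | no x≮K = inj₁ refl , subst (ℕ._< n) (ℕ.+-comm 1 x) (s≤s x<r) , λ (lt , _) → x≮K (ℕ.≤-<-trans (ℕ.m≤m+n x 1) lt)
    ... | yes x<K with x % a ℕ.≟ 0
    ...   | yes x%a≡0 = inj₂ refl , s≤s (ℕ.≤-trans (ℕ.≤-reflexive (ℕ.+-comm x a)) (ℕ.≤-trans (ℕ.≤-reflexive (sym (ℕ.+-suc m x))) (ℕ.+-monoʳ-≤ m (ℕ.<-trans x<K fit)))) ,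
        λ (_ , ne , _) → ne (trans ([m+n]%n≡m%n x a) x%a≡0)
    ...   | no x%a≢0 = inj₁ refl , subst (ℕ._< n) (ℕ.+-comm 1 x) (s≤s x<r) , outer
      where
      i = x % a
      y = x / a
      y%a≡0 : y % a ≡ 0
      y%a≡0 = decidable-stable (y % a ℕ.≟ 0) λ ne → out (x<K , x%a≢0 , ne)
      x+1≡ : x ℕ.+ 1 ≡ suc i ℕ.+ y ℕ.* a
      x+1≡ = trans (ℕ.+-comm x 1) (cong suc (m≡m%n+[m/n]*n x a))
      outer : Outer (x ℕ.+ 1)
      outer (_ , ne , ne′) with suc i ℕ.≟ a
      ... | yes eq = ne (trans (cong (_% a) (trans x+1≡ (cong (ℕ._+ y ℕ.* a) eq))) (m*n%n≡0 (suc y) a))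
      ... | no neq = ne′ (trans (cong (λ x → (x / a) % a) x+1≡) (trans (cong (_% a) (div-code y (ℕ.≤∧≢⇒< (m%n<n x a) neq))) y%a≡0))

    cs bs blocks : List V
    cs = filter (¬? ∘ inner?) others
    bs = filter inner? others
    blocks = concatMap (λ q → map (place q) (Box m)) (upTo k)

    cs-unique : Unique cs
    cs-unique = Unique.filter⁺ (¬? ∘ inner?) others-unique

    bs-unique : Unique bs
    bs-unique = Unique.filter⁺ inner? others-unique

    cs++bs-unique : Unique (cs ++ bs)
    cs++bs-unique = Unique.++⁺ cs-unique bs-unique λ { (x∈ , y∈) →
      proj₂ (∈-filter⁻ (¬? ∘ inner?) {xs = others} x∈) (proj₂ (∈-filter⁻ inner? {xs = others} y∈)) }

    others↭ : others ↭ cs ++ bs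
    others↭ = unique-⊆⊇⇒↭ others-unique cs++bs-unique to from
      where
      to : ∀ {x} → x ∈ others → x ∈ cs ++ bs
      to {x} x∈ with inner? x
      ... | yes i = ∈-++⁺ʳ cs (∈-filter⁺ inner? x∈ i)
      ... | no ¬i = ∈-++⁺ˡ (∈-filter⁺ (¬? ∘ inner?) x∈ ¬i)
      from : ∀ {x} → x ∈ cs ++ bs → x ∈ others
      from x∈ with ∈-++⁻ cs x∈
      ... | inj₁ x∈cs = proj₁ (∈-filter⁻ (¬? ∘ inner?) {xs = others} x∈cs)
      ... | inj₂ x∈bs = proj₁ (∈-filter⁻ inner? {xs = others} x∈bs)

    ∈-bs⁻ : ∀ {x} → x ∈ bs → Inner x
    ∈-bs⁻ x∈ = proj₂ (∈-filter⁻ inner? {xs = others} x∈)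

    inner⇒≢root : ∀ {x} → Inner x → x ≢ apex
    inner⇒≢root (x<K , _) refl = ℕ.<⇒≱ (ℕ.<-trans x<K fit) (subst (t ℕ.≤_) (sym toℕ-apex) (ℕ.m≤n+m t m))

    ∈-bs⁺ : ∀ {x} → Inner x → x ∈ bs
    ∈-bs⁺ i = ∈-filter⁺ inner? (∈-others (inner⇒≢root i)) i

    blocks-unique : Unique blocks
    blocks-unique = concatMap-unique (λ q → map (place q) (Box m)) {R = _≢_} (Unique.upTo⁺ k)
      (λ {q} q∈ → unique-map⁺ (place q) (λ b∈ b′∈ eq → proj₂ (place-injective (∈-upTo⁻ q∈) (∈-upTo⁻ q∈) b∈ b′∈ eq)) (Box-unique m))
      λ {q} {q′} q∈ q′∈ q≢ x∈ x∈′ → let (b , b∈ , eq) = ∈-map⁻ (place q) x∈ ; (b′ , b′∈ , eq′) = ∈-map⁻ (place q′) x∈′ in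
        q≢ (proj₁ (place-injective (∈-upTo⁻ q∈) (∈-upTo⁻ q′∈) b∈ b′∈ (trans (sym eq) eq′)))

    bs↭blocks : bs ↭ blocks
    bs↭blocks = unique-⊆⊇⇒↭ bs-unique blocks-unique
      (λ x∈ → let (q , b , q< , b∈ , eq) = inner-place (∈-bs⁻ x∈) in
        ∈-concatMap⁺ (λ q → map (place q) (Box m)) (∈-upTo⁺ q<) (subst (_∈ map (place q) (Box m)) (sym eq) (∈-map⁺ (place q) b∈)))
      (λ x∈ → let (q , q∈ , x∈q) = ∈-concatMap⁻ (λ q → map (place q) (Box m)) (upTo k) x∈ ; (b , b∈ , eq) = ∈-map⁻ (place q) x∈q in
        ∈-bs⁺ (subst Inner (sym eq) (place-inner (∈-upTo⁻ q∈) b∈)))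

    target-spec : ∀ {c} → c ∈ cs → target c ∈ neighbours c × n ∸ toℕ (target c) ℕ.< n ∸ toℕ c × target c ∉ bs
    target-spec {c} c∈ with c∈o , ¬i ← ∈-filter⁻ (¬? ∘ inner?) {xs = others} c∈
      with c≢root ← proj₂ (∈-filter⁻ (λ v → ¬? (v Fin.≟ apex)) {xs = allFin n} c∈o)
      with which , lt , out ← hop-spec (toℕ c) (ℕ.≤∧≢⇒< (s≤s⁻¹ (Fin.toℕ<n c)) (λ eq → c≢root (Fin.toℕ-injective (trans eq (sym toℕ-apex))))) ¬i
      with toℕ≡ ← toℕ-vertex-< lt =
      ∈-filter⁺ (adj? E c) (∈-allFin (target c)) (around⇒adj (∈-map⁺ (c ⊞_) (is-offset which))) ,
      subst (λ z → n ∸ z ℕ.< n ∸ toℕ c) (sym toℕ≡) (ℕ.∸-monoʳ-< (ℕ.m<m+n (toℕ c) (positive which)) (ℕ.<⇒≤ lt)) ,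
      λ x∈ → out (subst (λ z → z ℕ.< K × z % a ≢ 0 × (z / a) % a ≢ 0) toℕ≡ (∈-bs⁻ x∈))
      where
      is-offset : hop (toℕ c) ≡ o₀ ⊎ hop (toℕ c) ≡ o₁ → hop (toℕ c) ∈ offsets
      is-offset (inj₁ eq) = here eq
      is-offset (inj₂ eq) = there (here eq)
      positive : hop (toℕ c) ≡ o₀ ⊎ hop (toℕ c) ≡ o₁ → 0 ℕ.< hop (toℕ c)
      positive (inj₁ eq) = subst (0 ℕ.<_) (sym eq) (s≤s z≤n)
      positive (inj₂ eq) = subst (0 ℕ.<_) (sym eq) (s≤s z≤n)

    around-place : ∀ q i j → map (place q) (hex (suc i , suc j)) ≡ around (place q (suc i , suc j))
    around-place q i j = cong₂ _∷_ (hop-to o₀ (code q (suc (suc i) , suc j)) (up o₀ (code q (suc (suc i) , suc j)) (solve 1 (λ x → con 1 :+ x := x :+ con 1) refl x)))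
      (cong₂ _∷_ (hop-to o₁ (code q (suc i , suc (suc j))) (up o₁ (code q (suc i , suc (suc j))) (solve 4 (λ i j s a → i :+ (con 1 :+ j :+ s) :* a := i :+ (j :+ s) :* a :+ a) refl (suc i) (suc j) (q ℕ.* a) a)))
      (cong₂ _∷_ (hop-to o₂ (code q (i , suc (suc j))) (up o₂ (code q (i , suc (suc j))) (solve 4 (λ i j s m → i :+ (con 1 :+ j :+ s) :* (con 1 :+ m) := con 1 :+ i :+ (j :+ s) :* (con 1 :+ m) :+ m) refl i (suc j) (q ℕ.* a) m)))
      (cong₂ _∷_ (hop-to o₃ (code q (i , suc j)) (down o₃ (code q (i , suc j)) (solve 4 (λ i r m t → i :+ r :+ (con 1 :+ (m :+ t)) := con 1 :+ i :+ r :+ (m :+ t)) refl i ((suc j ℕ.+ q ℕ.* a) ℕ.* a) m t)))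
      (cong₂ _∷_ (hop-to o₄ (code q (suc i , j)) (down o₄ (code q (suc i , j)) (solve 5 (λ i j s m t → i :+ (j :+ s) :* (con 1 :+ m) :+ (con 1 :+ (m :+ t)) := i :+ (con 1 :+ j :+ s) :* (con 1 :+ m) :+ t) refl (suc i) j (q ℕ.* a) m t)))
      (cong₂ _∷_ (hop-to o₅ (code q (suc (suc i) , j)) (down o₅ (code q (suc (suc i) , j)) (solve 5 (λ i j s m t → con 1 :+ i :+ (j :+ s) :* (con 1 :+ m) :+ (con 1 :+ (m :+ t)) := i :+ (con 1 :+ j :+ s) :* (con 1 :+ m) :+ (con 1 :+ t)) refl (suc i) j (q ℕ.* a) m t)))
      refl)))))
      where
      x = code q (suc i , suc j)
      hop-to : ∀ o y → vertex y ≡ vertex (x ℕ.+ o) → vertex y ≡ place q (suc i , suc j) ⊞ o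
      hop-to o y eq = trans eq (sym (vertex-+ x o))
      up : ∀ o y → y ≡ x ℕ.+ o → vertex y ≡ vertex (x ℕ.+ o)
      up o y = cong vertex
      down : ∀ o y → y ℕ.+ n ≡ x ℕ.+ o → vertex y ≡ vertex (x ℕ.+ o)
      down o y eq = trans (sym (vertex-+n y)) (cong vertex eq)

    hex≤a : ∀ {i j z} → i ℕ.< m → j ℕ.< m → z ∈ hex (suc i , suc j) → proj₁ z ℕ.≤ a × proj₂ z ℕ.≤ a
    hex≤a i< j< (here refl) = s≤s i< , s≤s (ℕ.<⇒≤ j<)
    hex≤a i< j< (there (here refl)) = s≤s (ℕ.<⇒≤ i<) , s≤s j<
    hex≤a i< j< (there (there (here refl))) = ℕ.<⇒≤ (ℕ.m<n⇒m<1+n i<) , s≤s j<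
    hex≤a i< j< (there (there (there (here refl)))) = ℕ.<⇒≤ (ℕ.m<n⇒m<1+n i<) , s≤s (ℕ.<⇒≤ j<)
    hex≤a i< j< (there (there (there (there (here refl))))) = s≤s (ℕ.<⇒≤ i<) , ℕ.<⇒≤ (ℕ.m<n⇒m<1+n j<)
    hex≤a i< j< (there (there (there (there (there (here refl)))))) = s≤s i< , ℕ.<⇒≤ (ℕ.m<n⇒m<1+n j<)

    module Contracted (r : V → V) (keep : ∀ z → z ∉ cs → r z ≡ z) (leave : ∀ z → z ∈ cs → r z ∉ bs) where

      M : Matrix V
      M = step (map r ∘ neighbours)

      M-around : ∀ x y → M x y ≡ Σ (around x) (λ z → sixth (r z) y)
      M-around x y = trans (Σ-map r (neighbours x) (λ z → sixth z y)) (ℚ.≤-antisym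
        (Σ-⊆ (λ z → 0≤sixth (r z) y) (neighbours-unique x) (λ z∈ → adj⇒around (∈-neighbours z∈)))
        (Σ-⊆ (λ z → 0≤sixth (r z) y) (around-unique x) (λ {z} z∈ → ∈-filter⁺ (adj? E x) (∈-allFin z) (around⇒adj z∈))))

      -- A neighbour of a box vertex is either a vertex of the same box or it is
      -- contracted out of all boxes.
      sixth-place : ∀ {q q′ i j b′ z} → q ℕ.< k → q′ ℕ.< k → i ℕ.< m → j ℕ.< m → b′ ∈ Box m → z ∈ hex (suc i , suc j) →
                    r (place q z) ≡ place q′ b′ → q ≡ q′ × z ≡ b′
      sixth-place {q} {q′} {b′ = b′} {z} q< q′< i< j< b′∈ z∈ eq with inner? (place q z)
      ... | no ¬i = ⊥-elim (outside (∈-bs⁺ {place q′ b′} (place-inner {q′} {b′} q′< b′∈)))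
        where
        outside : place q′ b′ ∉ bs
        outside with place q z Fin.≟ apex
        ... | yes eq′ = λ x∈ → inner⇒≢root (∈-bs⁻ x∈) (trans (sym eq) (trans (keep (place q z) (λ c∈ → proj₂ (∈-filter⁻ (λ v → ¬? (v Fin.≟ apex)) {xs = allFin n} (proj₁ (∈-filter⁻ (¬? ∘ inner?) {xs = others} c∈))) eq′)) eq′))
        ... | no ≢root = subst (_∉ bs) eq (leave (place q z) (∈-filter⁺ (¬? ∘ inner?) (∈-others ≢root) ¬i))
      ... | yes i = place-injective {q} {q′} {z} {b′} q< q′< z∈Box b′∈ (trans (sym (keep (place q z) (λ c∈ → proj₂ (∈-filter⁻ (¬? ∘ inner?) {xs = others} c∈) i))) eq)
        where
        bounds = hex≤a i< j< z∈
        i′ = subst (λ x → x ℕ.< K × x % a ≢ 0 × (x / a) % a ≢ 0) (toℕ-place q< (proj₁ bounds) (proj₂ bounds)) i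
        z∈Box : z ∈ Box m
        z∈Box = inner-digits q (proj₁ bounds) (proj₂ bounds) (proj₁ (proj₂ i′)) (proj₂ (proj₂ i′))

      M-place : ∀ {q q′ b b′} → b ∈ Box m → M (place q b) (place q′ b′) ≡ Σ (hex b) (λ z → sixth (r (place q z)) (place q′ b′))
      M-place {q} {q′} {i , j} {b′} b∈ with (i′ , refl , i<) , (j′ , refl , j<) ← ∈-Box⁻ b∈ =
        trans (M-around (place q (i , j)) (place q′ b′))
          (trans (cong (λ l → Σ l (λ z → sixth (r z) (place q′ b′))) (sym (around-place q i′ j′))) (Σ-map (place q) (hex (i , j)) (λ z → sixth (r z) (place q′ b′))))

      M-same : ∀ {q b b′} → q ℕ.< k → b ∈ Box m → b′ ∈ Box m → M (place q b) (place q b′) ≡ Lattice.step hex b b′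
      M-same {q} {i , j} {b′} q< b∈ b′∈ = trans (M-place {q} {q} {i , j} {b′} b∈) (Σ-cong (hex (i , j)) λ {z} z∈ → same z z∈)
        where
        same : ∀ z → z ∈ hex (i , j) → sixth (r (place q z)) (place q b′) ≡ Lattice.sixth z b′
        same z z∈ with z ≟ᴾ b′
        ... | yes refl = trans (cong (λ x → sixth x (place q z)) (keep (place q z) (λ c∈ → proj₂ (∈-filter⁻ (¬? ∘ inner?) {xs = others} c∈) (place-inner {q} {z} q< b′∈)))) (sixth-≡ (place q z))
        ... | no z≢b′ with (i′ , refl , i<) , (j′ , refl , j<) ← ∈-Box⁻ b∈ = sixth-≢ λ eq → z≢b′ (proj₂ (sixth-place {q} {q} {b′ = b′} {z} q< q< i< j< b′∈ z∈ eq))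

      M-apart : ∀ {q q′ b b′} → q ℕ.< k → q′ ℕ.< k → q ≢ q′ → b ∈ Box m → b′ ∈ Box m → M (place q b) (place q′ b′) ≡ 0ℚ
      M-apart {q} {q′} {i , j} {b′} q< q′< q≢ b∈ b′∈ = trans (M-place {q} {q′} {i , j} {b′} b∈)
        (trans (Σ-cong (hex (i , j)) λ {z} z∈ → zeros z z∈) (trans (Σ-const (hex (i , j)) 0ℚ) (ℚ.*-zeroʳ (ι (length (hex (i , j)))))))
        where
        zeros : ∀ z → z ∈ hex (i , j) → sixth (r (place q z)) (place q′ b′) ≡ 0ℚ
        zeros z z∈ with (i′ , refl , i<) , (j′ , refl , j<) ← ∈-Box⁻ b∈ = sixth-≢ λ eq → q≢ (proj₁ (sixth-place {q} {q′} {b′ = b′} {z} q< q′< i< j< b′∈ z∈ eq))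

      D-blocks : D blocks M ≡ D (Box m) (Lattice.step hex) ^ k
      D-blocks = trans (go (upTo k) (Unique.upTo⁺ k) ∈-upTo⁻) (cong (D (Box m) (Lattice.step hex) ^_) (length-upTo k))
        where
        go : ∀ qs → Unique qs → (∀ {q} → q ∈ qs → q ℕ.< k) → D (concatMap (λ q → map (place q) (Box m)) qs) M ≡ D (Box m) (Lattice.step hex) ^ length qs
        go [] _ _ = refl
        go (q ∷ qs) (q∉ ∷ u) <k = trans
          (D-++ (map (place q) (Box m)) (concatMap (λ q → map (place q) (Box m)) qs) M
            (λ x∈ y∈ → let (b , b∈ , eq) = ∈-map⁻ (place q) x∈ ; (q′ , q′∈ , y∈′) = ∈-concatMap⁻ (λ q → map (place q) (Box m)) qs y∈ ; (b′ , b′∈ , eq′) = ∈-map⁻ (place q′) y∈′ in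
              trans (cong₂ M eq eq′) (M-apart (<k (here refl)) (<k (there q′∈)) (All.lookup q∉ q′∈) b∈ b′∈))
            (λ x∈ y∈ → let (b , b∈ , eq) = ∈-map⁻ (place q) y∈ ; (q′ , q′∈ , x∈′) = ∈-concatMap⁻ (λ q → map (place q) (Box m)) qs x∈ ; (b′ , b′∈ , eq′) = ∈-map⁻ (place q′) x∈′ in
              trans (cong₂ M eq′ eq) (M-apart (<k (there q′∈)) (<k (here refl)) (λ e → All.lookup q∉ q′∈ (sym e)) b′∈ b∈)))
          (cong₂ _*_ (trans (D-map (place q) (Box m) M) (D-cong (Box m) (λ b∈ b′∈ → M-same (<k (here refl)) b∈ b′∈))) (go qs u (λ q∈ → <k (there q∈))))

      #acyclic-bs : ι (#acyclic neighbours bs r) ≡ ι (A m ℕ.^ k)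
      #acyclic-bs = begin
        ι (#acyclic neighbours bs r) ≡⟨ #acyclic≡D neighbours regular bs-unique r ⟩
        ι 6 ^ length bs * D bs M ≡⟨ cong₂ (λ l d → ι 6 ^ l * d) (trans (↭-length bs↭blocks) length-blocks) (trans (D-↭ bs↭blocks M) D-blocks) ⟩
        ι 6 ^ (k ℕ.* (m ℕ.* m)) * D (Box m) (Lattice.step hex) ^ k ≡⟨ cong (_* D (Box m) (Lattice.step hex) ^ k) (^-* (ι 6) k (m ℕ.* m)) ⟩
        (ι 6 ^ (m ℕ.* m)) ^ k * D (Box m) (Lattice.step hex) ^ k ≡⟨ *-^ (ι 6 ^ (m ℕ.* m)) (D (Box m) (Lattice.step hex)) k ⟨
        (ι 6 ^ (m ℕ.* m) * D (Box m) (Lattice.step hex)) ^ k ≡⟨ cong (_^ k) (ι-A m) ⟨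
        ι (A m) ^ k ≡⟨ ι-^ (A m) k ⟨
        ι (A m ℕ.^ k) ∎
        where
        open ≡-Reasoning
        length-blocks : length blocks ≡ k ℕ.* (m ℕ.* m)
        length-blocks = trans (length-concatMap (λ q → map (place q) (Box m)) (m ℕ.* m) (upTo k) (λ {q} _ → trans (length-map (place q) (Box m)) (length-Box m)))
          (cong (ℕ._* (m ℕ.* m)) (length-upTo k))

    τ-lower : A m ℕ.^ k ℕ.≤ τ E
    τ-lower = bound (collapse neighbours cs bs id target (λ v → n ∸ toℕ v) target-spec)
      where
      -- The list of acyclic choices depends on the order of the vertices, but its length does not,
      -- being given by a determinant.
      reorder : #acyclic neighbours others id ≡ #acyclic neighbours (cs ++ bs) id
      reorder = ℕ.≤-antisym (ι-cancel-≤ (ℚ.≤-reflexive eq)) (ι-cancel-≤ (ℚ.≤-reflexive (sym eq)))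
        where
        eq : ι (#acyclic neighbours others id) ≡ ι (#acyclic neighbours (cs ++ bs) id)
        eq = trans (#acyclic≡D neighbours regular others-unique id)
          (trans (cong₂ (λ l d → ι 6 ^ l * d) (↭-length others↭) (D-↭ others↭ (step (map id ∘ neighbours)))) (sym (#acyclic≡D neighbours regular cs++bs-unique id)))
      bound : (∃ λ r → (∀ z → z ∉ cs → r z ≡ z) × (∀ z → z ∈ cs → r z ∉ bs) × #acyclic neighbours bs r ℕ.≤ #acyclic neighbours (cs ++ bs) id) → A m ℕ.^ k ℕ.≤ τ E
      bound (r , keep , leave , le) = ℕ.≤-trans (ι-cancel-≤ (ℚ.≤-reflexive (sym (Contracted.#acyclic-bs r keep leave))))
        (ℕ.≤-trans le (ℕ.≤-reflexive (trans (sym reorder) (sym τ≡#acyclic))))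

-- The upper bound for all graphs of a given genus.

module FewTrees where

  open Determinant
  open Elimination
  open MatrixTree
  open FiniteLists
  open SpanningTree
  open RotationSystems
  open LatticeFrames
  open BoxEstimate
  open Circulants
  open import Data.List.Base using (length; allFin; upTo)
  open import Data.List.Properties using (length-filter; length-tabulate; length-upTo)
  open import Data.Nat.Base as ℕ using (ℕ; zero; suc; NonZero)
  open import Data.Nat.Solver using (module +-*-Solver)
  open import Data.Rational.Base using (ℚ; 0ℚ; _*_; _≤_)
  open import Algebra.Definitions.RawSemiring ℚ.+-*-rawSemiring using (_^_)
  open +-*-Solver

  module Upper {n : ℕ} (g : ℕ) (E : EdgeSet (suc n)) (E∈𝒳 : E ∈ 𝒳 (suc n) 6 g) where

    private
      parts : E ∈ simpleGraphs (suc n) × Connected E × Regular E 6 × Embeddable g E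
      parts = ∈-filter⁻ (λ E → connected? E ×-dec regular? E 6 ×-dec embeddable? g E) {xs = simpleGraphs (suc n)} E∈𝒳

    E∈ : E ∈ simpleGraphs (suc n)
    E∈ = proj₁ parts

    regular : Regular E 6
    regular = proj₁ (proj₂ (proj₂ parts))

    embedding : Embeddable g E
    embedding = proj₂ (proj₂ (proj₂ parts))

    ρ : RotationSystem (suc n)
    ρ = proj₁ embedding

    rotation : IsRotation E ρ
    rotation = proj₁ (proj₂ embedding)

    h : Fin (suc g)
    h = proj₁ (proj₂ (proj₂ embedding))

    genus : HasGenus E ρ (toℕ h)
    genus = proj₂ (proj₂ (proj₂ embedding))

    open Rotation E (simple-oriented E∈) (simple-unique E∈) ρ rotation regular using (nonTriangular; nonTriangular-bound; length-darts; Darts)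
    open Frames E (simple-oriented E∈) (simple-unique E∈) ρ rotation regular zero using (module Boxes)
    open SpanningTrees E (simple-oriented E∈) (simple-unique E∈) zero using (others; others-unique; neighbours; τ≡#acyclic)

    h≤g : toℕ h ℕ.≤ g
    h≤g = ℕ.s≤s⁻¹ (Fin.toℕ<n h)

    few-nonTriangular : length nonTriangular ℕ.+ 24 ℕ.≤ 24 ℕ.* g
    few-nonTriangular = ℕ.≤-trans (nonTriangular-bound {toℕ h} genus) (ℕ.*-monoʳ-≤ 24 h≤g)

    g≢0 : g ≡ 0 → ⊥
    g≢0 g≡0 = impossible (subst (λ g → 24 ℕ.≤ 24 ℕ.* g) g≡0 (ℕ.≤-trans (ℕ.m≤n+m 24 (length nonTriangular)) few-nonTriangular))
      where
      impossible : 24 ℕ.≤ 24 ℕ.* 0 → ⊥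
      impossible ()

    module _ (m : ℕ) {{_ : NonZero (m ℕ.* m ℕ.* 6)}} where

      open Boxes m using (goodFrames; words; tests; corners; good?; many-goodFrames; cover-bound; module G)

      private
        N K C L F : ℕ
        N = m ℕ.* m
        K = m ℕ.* m ℕ.* 6
        C = suc m ℕ.* suc m ℕ.* 3 ℕ.* (24 ℕ.* g ℕ.+ 6)
        L = length others
        F = length goodFrames
        d : ℚ
        d = D (Box m) (Lattice.step hex)

        length-words : length words ≡ suc m ℕ.* suc m ℕ.* 3
        length-words = trans (length-concatMap tests 3 corners (λ _ → refl))
          (cong (ℕ._* 3) (trans (length-cartesianProduct (upTo (suc m)) (upTo (suc m))) (cong₂ ℕ._*_ (length-upTo (suc m)) (length-upTo (suc m)))))

        enough : suc n ℕ.* 6 ℕ.≤ F ℕ.+ C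
        enough = ℕ.≤-trans many-goodFrames (ℕ.+-monoʳ-≤ F (subst (λ w → w ℕ.* (length nonTriangular ℕ.+ 6) ℕ.≤ C) (sym length-words)
          (ℕ.*-monoʳ-≤ (suc m ℕ.* suc m ℕ.* 3) (ℕ.+-monoˡ-≤ 6 (ℕ.≤-trans (ℕ.m≤m+n _ 24) few-nonTriangular)))))

        F≤ : F ℕ.≤ suc n ℕ.* 6
        F≤ = subst (F ℕ.≤_) length-darts (length-filter good? Darts)

        L≤ : L ℕ.≤ suc n
        L≤ = subst (L ℕ.≤_) (length-tabulate {n = suc n} id) (length-filter (λ v → ¬? (v Fin.≟ zero)) (allFin (suc n)))

        ι-τ : ι (τ E) ≡ ι 6 ^ L * D others (G.step neighbours)
        ι-τ = trans (cong ι τ≡#acyclic) (trans (G.#acyclic≡D neighbours regular others-unique id)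
          (cong (ι 6 ^ L *_) (D-≗ others λ x y → Σ-map id (neighbours x) (λ z → G.sixth z y))))

        0≤d^ : 0ℚ ≤ d ^ F
        0≤d^ = 0≤^ F (0≤D (box-substochastic (Box-unique m)))

        -- Compares the powers of 6 on the two sides: `K` layers with `L` vertices against `F` boxes
        -- with `N` vertices. The frames that are not good leave a deficit of at most `N * C`, which
        -- does not depend on the size of the graph.
        exponent : K ℕ.* L ℕ.≤ F ℕ.* N ℕ.+ N ℕ.* C
        exponent = begin
          K ℕ.* L ≤⟨ ℕ.*-monoʳ-≤ K L≤ ⟩
          N ℕ.* 6 ℕ.* suc n ≡⟨ solve 2 (λ k n → k :* con 6 :* n := k :* (n :* con 6)) refl N (suc n) ⟩
          N ℕ.* (suc n ℕ.* 6) ≤⟨ ℕ.*-monoʳ-≤ N enough ⟩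
          N ℕ.* (F ℕ.+ C) ≡⟨ solve 3 (λ k f c → k :* (f :+ c) := f :* k :+ k :* c) refl N F C ⟩
          F ℕ.* N ℕ.+ N ℕ.* C ∎
          where open ℕ.≤-Reasoning

        rational-bound : ι (τ E) ^ K ≤ ι (6 ℕ.^ (N ℕ.* C)) * ι (A m ℕ.^ F)
        rational-bound = begin
          ι (τ E) ^ K ≡⟨ cong (_^ K) ι-τ ⟩
          (ι 6 ^ L * D others (G.step neighbours)) ^ K ≡⟨ *-^ (ι 6 ^ L) (D others (G.step neighbours)) K ⟩
          (ι 6 ^ L) ^ K * D others (G.step neighbours) ^ K ≤⟨ *-monoˡ _ (0≤^ K (0≤^ L (0≤ι 6))) cover-bound ⟩
          (ι 6 ^ L) ^ K * d ^ F ≡⟨ cong (_* d ^ F) (trans (sym (^-* (ι 6) K L)) (sym (ι-^ 6 (K ℕ.* L)))) ⟩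
          ι (6 ℕ.^ (K ℕ.* L)) * d ^ F ≤⟨ *-monoʳ _ 0≤d^ (ι-mono (ℕ.^-monoʳ-≤ 6 exponent)) ⟩
          ι (6 ℕ.^ (F ℕ.* N ℕ.+ N ℕ.* C)) * d ^ F ≡⟨ cong (_* d ^ F) (trans (ι-^ 6 (F ℕ.* N ℕ.+ N ℕ.* C)) (trans (^-+ (ι 6) (F ℕ.* N) (N ℕ.* C)) (cong₂ _*_ (^-* (ι 6) F N) (sym (ι-^ 6 (N ℕ.* C)))))) ⟩
          (ι 6 ^ N) ^ F * ι (6 ℕ.^ (N ℕ.* C)) * d ^ F ≡⟨ trans (cong (_* d ^ F) (ℚ.*-comm ((ι 6 ^ N) ^ F) _)) (ℚ.*-assoc (ι (6 ℕ.^ (N ℕ.* C))) _ _) ⟩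
          ι (6 ℕ.^ (N ℕ.* C)) * ((ι 6 ^ N) ^ F * d ^ F) ≡⟨ cong (ι (6 ℕ.^ (N ℕ.* C)) *_) (trans (sym (*-^ (ι 6 ^ N) d F)) (trans (cong (_^ F) (sym (ι-A m))) (sym (ι-^ (A m) F)))) ⟩
          ι (6 ℕ.^ (N ℕ.* C)) * ι (A m ℕ.^ F) ∎
          where open ℚ.≤-Reasoning

      τ-upper : τ E ℕ.^ (m ℕ.* m ℕ.* 6) ℕ.≤ 6 ℕ.^ (m ℕ.* m ℕ.* (suc m ℕ.* suc m ℕ.* 3 ℕ.* (24 ℕ.* g ℕ.+ 6))) ℕ.* A m ℕ.^ (suc n ℕ.* 6)
      τ-upper = ℕ.≤-trans
        (ι-cancel-≤ (ℚ.≤-trans (ℚ.≤-reflexive (ι-^ (τ E) K)) (ℚ.≤-trans rational-bound (ℚ.≤-reflexive (sym (ι-* (6 ℕ.^ (N ℕ.* C)) (A m ℕ.^ F)))))))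
        (ℕ.*-monoʳ-≤ (6 ℕ.^ (N ℕ.* C)) (ℕ.^-monoʳ-≤ (A m) {{ℕ.>-nonZero (1≤A m)}} F≤))

-- Exponential growth and approximation of reals.

module Growth where

  open Elimination
  open MatrixTree
  open import Data.List.Base using ([]; _∷_; map)
  open import Data.Nat.Base as ℕ using (ℕ; zero; suc; NonZero)
  import Data.Integer.Base as ℤ
  import Data.Integer.Properties as ℤ
  open import Data.Rational.Base hiding (NonZero; negative)
  import Data.Rational.Unnormalised.Base as ℚᵘ
  import Data.Rational.Unnormalised.Properties as ℚᵘ
  open import Algebra.Definitions.RawSemiring ℚ.+-*-rawSemiring using (_^_)
  open import Data.Rational.Solver using (module +-*-Solver)
  open +-*-Solver

  archimedean : ∀ p → ∃ λ m → p ≤ ι m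
  archimedean p@(mkℚ a d _) = ℤ.∣ a ∣ , ℚ.toℚᵘ-cancel-≤
    (ℚᵘ.≤-respʳ-≃ (ℚᵘ.≃-sym (ℚ.toℚᵘ-fromℚᵘ (ℚᵘ.mkℚᵘ (ℤ.+ ℤ.∣ a ∣) 0))) (ℚᵘ.*≤* (subst (ℤ._≤ ℤ.+ ℤ.∣ a ∣ ℤ.* ℤ.+ suc d) (sym (ℤ.*-identityʳ a)) (bound a))))
    where
    bound : ∀ a → a ℤ.≤ ℤ.+ ℤ.∣ a ∣ ℤ.* ℤ.+ suc d
    bound (ℤ.+ m)       = subst (ℤ.+ m ℤ.≤_) (ℤ.pos-* m (suc d)) (ℤ.+≤+ (ℕ.m≤m*n m (suc d)))
    bound (ℤ.-[1+ m ]) = ℤ.-≤+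

  abstract
    archimedean-* : ∀ p {e} → 0ℚ < e → ∃ λ m → p ≤ ι m * e
    archimedean-* p {e} 0<e = proj₁ pt≤m , (begin
      p ≡⟨ trans (sym (ℚ.*-identityʳ p)) (trans (cong (p *_) (sym (proj₂ (proj₂ t)))) (sym (ℚ.*-assoc p (proj₁ t) e))) ⟩
      p * proj₁ t * e ≤⟨ *-monoʳ e (ℚ.<⇒≤ 0<e) (proj₂ pt≤m) ⟩
      ι (proj₁ pt≤m) * e ∎)
      where
      open ℚ.≤-Reasoning
      t : ∃ λ t → 0ℚ ≤ t × t * e ≡ 1ℚ
      t = inverse 0<e
      pt≤m : ∃ λ m → p * proj₁ t ≤ ι m
      pt≤m = archimedean (p * proj₁ t)

  0<-diff : ∀ {a b} → a < b → 0ℚ < b - a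
  0<-diff {a} {b} a<b = subst (_< b - a) (ℚ.+-inverseʳ a) (ℚ.+-monoˡ-< (- a) a<b)

  0<^ : ∀ {x} n → 0ℚ < x → 0ℚ < x ^ n
  0<^ zero    0<x = ℚ.positive⁻¹ 1ℚ
  0<^ {x} (suc n) 0<x = ℚ.positive⁻¹ _ {{ℚ.pos*pos⇒pos x {{positive 0<x}} (x ^ n) {{positive (0<^ n 0<x)}}}}

  ^-mono-≤ : ∀ {x y} n → 0ℚ ≤ x → x ≤ y → x ^ n ≤ y ^ n
  ^-mono-≤ zero    0≤x x≤y = ℚ.≤-refl
  ^-mono-≤ (suc n) 0≤x x≤y = *-mono (0≤^ n 0≤x) (ℚ.≤-trans 0≤x x≤y) x≤y (^-mono-≤ n 0≤x x≤y)

  ^-mono-< : ∀ {x y} n .{{_ : NonZero n}} → 0ℚ ≤ x → x < y → x ^ n < y ^ n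
  ^-mono-< {x} {y} (suc n) 0≤x x<y = ℚ.≤-<-trans (*-monoˡ x 0≤x (^-mono-≤ n 0≤x (ℚ.<⇒≤ x<y)))
    (ℚ.*-monoˡ-<-pos (y ^ n) {{positive (0<^ n (ℚ.≤-<-trans 0≤x x<y))}} x<y)

  ^-cancel-< : ∀ {x y} n → 0ℚ ≤ y → x ^ n < y ^ n → x < y
  ^-cancel-< n 0≤y lt = ℚ.≰⇒> λ y≤x → ℚ.<-irrefl refl (ℚ.<-≤-trans lt (^-mono-≤ n 0≤y y≤x))

  ^-^-comm : ∀ x m n → (x ^ m) ^ n ≡ (x ^ n) ^ m
  ^-^-comm x m n = trans (sym (^-* x n m)) (trans (cong (x ^_) (ℕ.*-comm n m)) (^-* x m n))

  -- Bernoulli's inequality, with the denominator y ^ k cleared.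
  bernoulli : ∀ {y e} → 0ℚ ≤ y → 0ℚ ≤ e → ∀ k → (y + ι k * e) * y ^ k ≤ y * (y + e) ^ k
  bernoulli {y} {e} 0≤y 0≤e zero    = ℚ.≤-reflexive (solve 2 (λ y e → (y :+ con 0ℚ :* e) :* con 1ℚ := y :* con 1ℚ) refl y e)
  bernoulli {y} {e} 0≤y 0≤e (suc k) = begin
    (y + ι (suc k) * e) * (y * y ^ k) ≡⟨ cong (λ i → (y + i * e) * (y * y ^ k)) (ι-+ 1 k) ⟩
    (y + (1ℚ + ι k) * e) * (y * y ^ k) ≤⟨ ≤-from-+ (ι k * e * e * y ^ k) (0≤* (0≤* (0≤* (0≤ι k) 0≤e) 0≤e) (0≤^ k 0≤y))
        (solve 4 (λ y i e p → (y :+ (con 1ℚ :+ i) :* e) :* (y :* p) :+ i :* e :* e :* p := (y :+ e) :* ((y :+ i :* e) :* p)) refl y (ι k) e (y ^ k)) ⟩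
    (y + e) * ((y + ι k * e) * y ^ k) ≤⟨ *-monoˡ (y + e) (0≤+ 0≤y 0≤e) (bernoulli 0≤y 0≤e k) ⟩
    (y + e) * (y * (y + e) ^ k) ≡⟨ solve 3 (λ y e p → (y :+ e) :* (y :* p) := y :* ((y :+ e) :* p)) refl y e ((y + e) ^ k) ⟩
    y * ((y + e) * (y + e) ^ k) ∎
    where open ℚ.≤-Reasoning

  abstract
    -- Bernoulli's inequality with x = y + e makes the ratio of the powers grow at least linearly.
    -- This stands in for taking n-th roots of constants: every constant factor in the counting
    -- bounds is removed by it.
    outgrows : ∀ C {x y} → 0ℚ < y → y < x → ∃ λ N → ∀ k → N ℕ.≤ k → C * y ^ k < x ^ k
    outgrows C {x} {y} 0<y y<x = proj₁ threshold , λ k N≤k → ℚ.*-cancelˡ-<-nonNeg y {{nonNegative 0≤y}} (begin-strict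
        y * (C * y ^ k) ≡⟨ solve 3 (λ y c p → y :* (c :* p) := c :* y :* p) refl y C (y ^ k) ⟩
        C * y * y ^ k ≤⟨ *-monoʳ (y ^ k) (0≤^ k 0≤y) (ℚ.≤-trans (proj₂ threshold) (*-monoʳ e 0≤e (ι-mono N≤k))) ⟩
        ι k * e * y ^ k <⟨ ℚ.*-monoˡ-<-pos (y ^ k) {{positive (0<^ k 0<y)}} (a<b+a (ι k * e)) ⟩
        (y + ι k * e) * y ^ k ≤⟨ bernoulli 0≤y 0≤e k ⟩
        y * (y + e) ^ k ≡⟨ cong (λ z → y * z ^ k) (solve 2 (λ x y → y :+ (x :- y) := x) refl x y) ⟩
        y * x ^ k ∎)
      where
      open ℚ.≤-Reasoning
      e : ℚ
      e = x - y
      0≤y : 0ℚ ≤ y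
      0≤y = ℚ.<⇒≤ 0<y
      0≤e : 0ℚ ≤ e
      0≤e = ℚ.<⇒≤ (0<-diff y<x)
      threshold : ∃ λ N → C * y ≤ ι N * e
      threshold = archimedean-* (C * y) (0<-diff y<x)
      a<b+a : ∀ a → a < y + a
      a<b+a a = subst (_< y + a) (ℚ.+-identityˡ a) (ℚ.+-monoˡ-< a 0<y)

  module _ (x : ℝ≥0) where

    open ℝ≥0 x

    -- A search upwards in steps of ε / 3. While the cut places the point one step ahead below the
    -- real, the search advances; the first opposite answer encloses the real within two steps. The
    -- upper bound `B` limits the number of steps.
    approximate : ∀ ε → 0ℚ < ε → ∃₂ λ a b → b - a < ε × L a × U b
    approximate ε 0<ε = search (proj₁ fuel) (- δ) (negative (subst (- δ <_) refl (ℚ.neg-antimono-< 0<δ))) (proj₂ fuel)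
      where
      δ = ε * (ℤ.+ 1 / 3)
      0<δ : 0ℚ < δ
      0<δ = ℚ.positive⁻¹ δ {{ℚ.pos*pos⇒pos ε {{positive 0<ε}} (ℤ.+ 1 / 3)}}
      B = proj₁ bounded
      fuel : ∃ λ m → B ≤ - δ + ι m * δ
      fuel = let (m , le) = archimedean-* (B + δ) 0<δ in
        m , subst (_≤ - δ + ι m * δ) (solve 2 (λ b d → :- d :+ (b :+ d) := b) refl B δ) (ℚ.+-monoʳ-≤ (- δ) le)
      2δ<ε : ∀ a → (a + δ + δ) - a < ε
      2δ<ε a = subst₂ _<_ (solve 2 (λ a d → d :+ d := a :+ d :+ d :- a) refl a δ) (solve 1 (λ e → e :* con (ℤ.+ 1 / 3) :+ e :* con (ℤ.+ 1 / 3) :+ e :* con (ℤ.+ 1 / 3) := e) refl ε)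
        (subst (_< δ + δ + δ) (ℚ.+-identityʳ (δ + δ)) (ℚ.+-monoʳ-< (δ + δ) 0<δ))
      a<a+δ : ∀ a → a < a + δ
      a<a+δ a = subst (_< a + δ) (ℚ.+-identityʳ a) (ℚ.+-monoʳ-< a 0<δ)
      search : ∀ m a → L a → B ≤ a + ι m * δ → ∃₂ λ a b → b - a < ε × L a × U b
      search zero a la B≤a = ⊥-elim (too-far (subst (B ≤_) (solve 2 (λ a d → a :+ con 0ℚ :* d := a) refl a δ) B≤a) (L-open la))
        where
        too-far : B ≤ a → (∃ λ r → a < r × L r) → ⊥
        too-far B≤a (r , a<r , lr) = disjoint lr (U-up (ℚ.≤-<-trans B≤a a<r) (proj₂ bounded))
      search (suc m) a la B≤ with located (a<a+δ (a + δ))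
      ... | inj₁ l = search m (a + δ) l (subst (B ≤_) (trans (cong (λ i → a + i * δ) (ι-+ 1 m)) (solve 3 (λ a i d → a :+ (con 1ℚ :+ i) :* d := a :+ d :+ i :* d) refl a (ι m) δ)) B≤)
      ... | inj₂ u = a , a + δ + δ , 2δ<ε a , la , u

  sup-L : ∀ {A : Set} (f : A → ℝ≥0) {x xs q} → x ∈ xs → ℝ≥0.L (f x) q → ℝ≥0.L (sup (map f xs)) q
  sup-L f (here refl) l = inj₁ l
  sup-L f (there x∈) l = inj₂ (sup-L f x∈ l)

  sup-U : ∀ {A : Set} (f : A → ℝ≥0) xs {q} → 0ℚ < q → (∀ {x} → x ∈ xs → ℝ≥0.U (f x) q) → ℝ≥0.U (sup (map f xs)) q
  sup-U f []       0<q u = 0<q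
  sup-U f (x ∷ xs) 0<q u = u (here refl) , sup-U f xs 0<q (λ x∈ → u (there x∈))

-- The limit as a located cut.

module Limits where

  open Elimination
  open MatrixTree
  open LatticeFrames
  open BoxEstimate
  open Circulants
  open ManyTrees
  open FewTrees
  open Growth
  open Determinant using (D)
  open import Data.List.Base using (map)
  open import Data.Nat.Base as ℕ using (ℕ; zero; suc; z≤n; s≤s; NonZero)
  import Data.Nat.DivMod as ℕ
  import Data.Nat.Solver
  open import Data.Rational.Base hiding (NonZero; negative)
  open import Algebra.Definitions.RawSemiring ℚ.+-*-rawSemiring using (_^_)
  open ℝ≥0

  module ℕS = Data.Nat.Solver.+-*-Solver

  module _ (m : ℕ) where

    a : ℕ
    a = suc (2 ℕ.+ m)

    many-trees : ∀ k t → suc k ℕ.* (a ℕ.* a) ℕ.< t → ∃ λ (E : EdgeSet (a ℕ.+ t)) →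
      (∀ g → E ∈ 𝒳 (a ℕ.+ t) 6 (suc g)) × A (2 ℕ.+ m) ℕ.^ suc k ℕ.≤ τ E
    many-trees k t fit = Circulant.E (2 ℕ.+ m) t 2≤ m+4≤t 12≤n , Circulant.E∈𝒳 (2 ℕ.+ m) t 2≤ m+4≤t 12≤n ,
      CirculantTrees.τ-lower (2 ℕ.+ m) t 2≤ m+4≤t 12≤n (suc k) fit
      where
      2≤ : 2 ℕ.≤ 2 ℕ.+ m
      2≤ = s≤s (s≤s z≤n)
      a²<t : a ℕ.* a ℕ.< t
      a²<t = ℕ.≤-<-trans (ℕ.m≤m+n (a ℕ.* a) (k ℕ.* (a ℕ.* a))) fit
      m+4≤t : suc (suc (2 ℕ.+ m)) ℕ.≤ t
      m+4≤t = ℕ.≤-trans (s≤s (ℕ.m≤m*n a a)) a²<t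
      12≤n : 12 ℕ.≤ suc (2 ℕ.+ m ℕ.+ t)
      12≤n = ℕ.+-mono-≤ {3} {a} {9} (s≤s (s≤s (s≤s z≤n)))
        (ℕ.≤-trans (ℕ.*-mono-≤ {3} {a} {3} (s≤s (s≤s (s≤s z≤n))) (s≤s (s≤s (s≤s z≤n)))) (ℕ.<⇒≤ a²<t))

  abstract
    few-trees : ∀ g m → ∃ λ C → ∀ n (E : EdgeSet (suc n)) → E ∈ 𝒳 (suc n) 6 g →
      τ E ℕ.^ (suc m ℕ.* suc m ℕ.* 6) ℕ.≤ C ℕ.* A (suc m) ℕ.^ (suc n ℕ.* 6)
    few-trees g m = 6 ℕ.^ (suc m ℕ.* suc m ℕ.* (suc (suc m) ℕ.* suc (suc m) ℕ.* 3 ℕ.* (24 ℕ.* g ℕ.+ 6))) ,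
      λ n E E∈ → Upper.τ-upper g E E∈ (suc m)

  -- The numbers A (2 + m) ^ (1 / (3 + m)²) approximate the limit from below, and
  -- the numbers A (1 + m) ^ (1 / (1 + m)²) from above.
  below above : ℕ → ℝ≥0
  below m = root (a m ℕ.* a m) (ι (A (2 ℕ.+ m)))
  above m = root (suc m ℕ.* suc m) (ι (A (suc m)))

  0<ιA : ∀ m → 0ℚ < ι (A m)
  0<ιA m = ι-mono-< (1≤A m)

  ιA≤6^ : ∀ m → ι (A m) ≤ ι 6 ^ (m ℕ.* m)
  ιA≤6^ m = subst₂ _≤_ (sym (ι-A m)) (ℚ.*-identityʳ (ι 6 ^ (m ℕ.* m))) (*-monoˡ (ι 6 ^ (m ℕ.* m)) (ℚ.<⇒≤ (0<ι^ 6 (m ℕ.* m))) (D≤1 (box-substochastic (Box-unique m))))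

  -- With the least admissible `t` both sides are exponential in `k`, with bases `α ^ K` and
  -- `β ^ (M * 6)` up to a constant. Were the first base larger, it would outgrow the bound.
  growth-rates : ∀ {α β C d M K} → 1 ℕ.≤ β →
    (∀ k t → suc k ℕ.* M ℕ.< t → (α ℕ.^ suc k) ℕ.^ K ℕ.≤ C ℕ.* β ℕ.^ ((d ℕ.+ t) ℕ.* 6)) → α ℕ.^ K ℕ.≤ β ℕ.^ (M ℕ.* 6)
  growth-rates {α} {β} {C} {d} {M} {K} 1≤β hyp = ℕ.≮⇒≥ λ Y<X → outgrown
    (outgrows (ι C₁) (ι-mono-< (ℕ.m^n>0 β {{ℕ.>-nonZero 1≤β}} (M ℕ.* 6))) (ι-mono-< Y<X))
    where
    X = α ℕ.^ K
    Y = β ℕ.^ (M ℕ.* 6)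
    R = (d ℕ.+ 1) ℕ.* 6
    C₁ = C ℕ.* β ℕ.^ R
    bound : ∀ k → X ℕ.^ suc k ℕ.≤ C₁ ℕ.* Y ℕ.^ suc k
    bound k = begin
      X ℕ.^ suc k ≡⟨ trans (ℕ.^-*-assoc α K (suc k)) (trans (cong (α ℕ.^_) (ℕ.*-comm K (suc k))) (sym (ℕ.^-*-assoc α (suc k) K))) ⟩
      (α ℕ.^ suc k) ℕ.^ K ≤⟨ hyp k (suc (suc k ℕ.* M)) ℕ.≤-refl ⟩
      C ℕ.* β ℕ.^ ((d ℕ.+ suc (suc k ℕ.* M)) ℕ.* 6) ≡⟨ cong (λ e → C ℕ.* β ℕ.^ e) exponent ⟩
      C ℕ.* β ℕ.^ (R ℕ.+ M ℕ.* 6 ℕ.* suc k) ≡⟨ cong (C ℕ.*_) (ℕ.^-distribˡ-+-* β R (M ℕ.* 6 ℕ.* suc k)) ⟩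
      C ℕ.* (β ℕ.^ R ℕ.* β ℕ.^ (M ℕ.* 6 ℕ.* suc k)) ≡⟨ trans (sym (ℕ.*-assoc C _ _)) (cong (C₁ ℕ.*_) (sym (ℕ.^-*-assoc β (M ℕ.* 6) (suc k)))) ⟩
      C₁ ℕ.* Y ℕ.^ suc k ∎
      where
      open ℕ.≤-Reasoning
      open ℕS
      exponent : (d ℕ.+ suc (suc k ℕ.* M)) ℕ.* 6 ≡ R ℕ.+ M ℕ.* 6 ℕ.* suc k
      exponent = solve 3 (λ d k M → (d :+ (con 1 :+ k :* M)) :* con 6 := (d :+ con 1) :* con 6 :+ M :* con 6 :* k) refl d (suc k) M
    ι-cancel-< : ∀ {x y} → ι x < ι y → x ℕ.< y
    ι-cancel-< lt = ℕ.≰⇒> λ y≤x → ℚ.<-irrefl refl (ℚ.<-≤-trans lt (ι-mono y≤x))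
    outgrown : (∃ λ N → ∀ k → N ℕ.≤ k → ι C₁ * ι Y ^ k < ι X ^ k) → ⊥
    outgrown (N , grow) = ℕ.<⇒≱ (ι-cancel-< (subst₂ _<_
      (trans (cong (ι C₁ *_) (sym (ι-^ Y (suc N)))) (sym (ι-* C₁ (Y ℕ.^ suc N)))) (sym (ι-^ X (suc N))) (grow (suc N) (ℕ.n≤1+n N)))) (bound N)

  -- Otherwise the circulant graphs would have more spanning trees than a graph
  -- on the torus can have.
  below≤above : ∀ m m′ → A (2 ℕ.+ m) ℕ.^ (suc m′ ℕ.* suc m′ ℕ.* 6) ℕ.≤ A (suc m′) ℕ.^ (a m ℕ.* a m ℕ.* 6)
  below≤above m m′ = growth-rates {A (2 ℕ.+ m)} {A (suc m′)} {C = proj₁ (few-trees 1 m′)} {d = a m} {M = a m ℕ.* a m} {K = suc m′ ℕ.* suc m′ ℕ.* 6} (1≤A (suc m′)) λ k t fit →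
    let (E , E∈ , many) = many-trees m k t fit in
    ℕ.≤-trans (ℕ.^-monoˡ-≤ (suc m′ ℕ.* suc m′ ℕ.* 6) many) (proj₂ (few-trees 1 m′) (2 ℕ.+ m ℕ.+ t) E (E∈ 0))

  below-above-disjoint : ∀ {q} m m′ → L (below m) q → U (above m′) q → ⊥
  below-above-disjoint {q} m m′ l (0<q , A′<) = ℚ.<-irrefl refl (begin-strict
    (q ^ N) ^ (M ℕ.* 6) ≡⟨ ^-^-comm q N (M ℕ.* 6) ⟩
    (q ^ (M ℕ.* 6)) ^ N ≡⟨ cong (_^ N) (trans (cong (q ^_) (ℕ.*-comm M 6)) (^-* q 6 M)) ⟩
    ((q ^ M) ^ 6) ^ N ≡⟨ trans (sym (^-* (q ^ M) N 6)) refl ⟩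
    (q ^ M) ^ (N ℕ.* 6) ≤⟨ ^-mono-≤ (N ℕ.* 6) (0≤^ M (ℚ.<⇒≤ 0<q)) (ℚ.<⇒≤ (l (ℚ.<⇒≤ 0<q))) ⟩
    ι (A (2 ℕ.+ m)) ^ (N ℕ.* 6) ≡⟨ ι-^ (A (2 ℕ.+ m)) (N ℕ.* 6) ⟨
    ι (A (2 ℕ.+ m) ℕ.^ (N ℕ.* 6)) ≤⟨ ι-mono (below≤above m m′) ⟩
    ι (A (suc m′) ℕ.^ (M ℕ.* 6)) ≡⟨ ι-^ (A (suc m′)) (M ℕ.* 6) ⟩
    ι (A (suc m′)) ^ (M ℕ.* 6) <⟨ ^-mono-< (M ℕ.* 6) (0≤ι (A (suc m′))) A′< ⟩
    (q ^ N) ^ (M ℕ.* 6) ∎)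
    where
    open ℚ.≤-Reasoning
    M = a m ℕ.* a m
    N = suc m′ ℕ.* suc m′

  above-6 : ∀ {r} m → ι 6 < r → U (above m) r
  above-6 {r} m 6<r = ℚ.<-trans (ι-mono-< {0} {6} (s≤s z≤n)) 6<r ,
    ℚ.≤-<-trans (ιA≤6^ (suc m)) (^-mono-< (suc m ℕ.* suc m) (0≤ι 6) 6<r)

  1≤^ : ∀ {x} n → 1ℚ ≤ x → 1ℚ ≤ x ^ n
  1≤^ zero    1≤x = ℚ.≤-refl
  1≤^ (suc n) 1≤x = *-mono 0≤1 (ℚ.≤-trans 0≤1 1≤x) 1≤x (1≤^ n 1≤x)
  ^-monoʳ-≤ : ∀ {x i j} → 1ℚ ≤ x → i ℕ.≤ j → x ^ i ≤ x ^ j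
  ^-monoʳ-≤ {j = j} 1≤x z≤n = 1≤^ j 1≤x
  ^-monoʳ-≤ {x} 1≤x (s≤s i≤j) = *-monoˡ x (ℚ.≤-trans 0≤1 1≤x) (^-monoʳ-≤ 1≤x i≤j)

  -- The exponents differ by 2m + 1, which is at most 3m and of lower order than m². The factor
  -- `c ^ 3` pays for the difference once the gap is raised to the power m.
  power-gap : ∀ m .{{_ : NonZero m}} {s r c} → 0ℚ ≤ s → s ≤ c → 1ℚ ≤ c → c ^ 3 * s ^ m < r ^ m → s ^ (suc m ℕ.* suc m) < r ^ (m ℕ.* m)
  power-gap m {s} {r} {c} 0≤s s≤c 1≤c gap = begin-strict
    s ^ (suc m ℕ.* suc m) ≡⟨ trans (cong (s ^_) (ℕS.solve 1 (λ m → (ℕS.con 1 ℕS.:+ m) ℕS.:* (ℕS.con 1 ℕS.:+ m) ℕS.:= (ℕS.con 1 ℕS.:+ m ℕS.:* ℕS.con 2) ℕS.:+ m ℕS.:* m) refl m)) (^-+ s (1 ℕ.+ m ℕ.* 2) (m ℕ.* m)) ⟩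
    s ^ (1 ℕ.+ m ℕ.* 2) * s ^ (m ℕ.* m) ≤⟨ *-monoʳ _ (0≤^ (m ℕ.* m) 0≤s) (^-mono-≤ (1 ℕ.+ m ℕ.* 2) 0≤s s≤c) ⟩
    c ^ (1 ℕ.+ m ℕ.* 2) * s ^ (m ℕ.* m) ≤⟨ *-monoʳ _ (0≤^ (m ℕ.* m) 0≤s) (^-monoʳ-≤ 1≤c 1+2m≤3m) ⟩
    c ^ (m ℕ.* 3) * s ^ (m ℕ.* m) ≡⟨ cong₂ _*_ (^-* c m 3) (^-* s m m) ⟩
    (c ^ 3) ^ m * (s ^ m) ^ m ≡⟨ *-^ (c ^ 3) (s ^ m) m ⟨
    (c ^ 3 * s ^ m) ^ m <⟨ ^-mono-< m (0≤* (0≤^ 3 (ℚ.≤-trans 0≤1 1≤c)) (0≤^ m 0≤s)) gap ⟩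
    (r ^ m) ^ m ≡⟨ ^-* r m m ⟨
    r ^ (m ℕ.* m) ∎
    where
    open ℚ.≤-Reasoning
    1+2m≤3m : 1 ℕ.+ m ℕ.* 2 ℕ.≤ m ℕ.* 3
    1+2m≤3m = ℕ.≤-trans (ℕ.+-monoˡ-≤ (m ℕ.* 2) (ℕ.>-nonZero⁻¹ m)) (ℕ.≤-reflexive (sym (ℕ.*-suc m 2)))

  -- The number `A (2 + N)` belongs to both cuts, with exponent (3 + N)² in `below N` and (2 + N)²
  -- in `above (suc N)`. Comparing it with a power of some `s` between `q` and `r` decides, because
  -- for large `N` the gap from `s` to `r` outweighs the difference of the exponents.
  limit-located : ∀ {q r} → q < r → (∃ λ m → L (below m) q) ⊎ (∃ λ m → U (above m) r)
  limit-located {q} {r} q<r with 0ℚ ℚ.≤? q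
  ... | no 0≰q = inj₁ (0 , negative (below 0) (ℚ.≰⇒> 0≰q))
  ... | yes 0≤q = between (ℚ.<-dense q<r)
    where
    compare : ∀ {s} → q < s → s < r → s ≤ ι 6 → (∃ λ N → ∀ k → N ℕ.≤ k → ι 6 ^ 3 * s ^ k < r ^ k) → (∃ λ m → L (below m) q) ⊎ (∃ λ m → U (above m) r)
    compare {s} q<s s<r s≤6 (N , grow) with s ^ (a N ℕ.* a N) ℚ.<? ι (A (2 ℕ.+ N))
    ... | yes s<A = inj₁ (N , L-down (below N) q<s (λ _ → s<A))
    ... | no  s≮A = inj₂ (suc N , ℚ.≤-<-trans 0≤q q<r ,
      ℚ.≤-<-trans (ℚ.≮⇒≥ s≮A) (power-gap (2 ℕ.+ N) {s} {r} {ι 6} (ℚ.≤-trans 0≤q (ℚ.<⇒≤ q<s)) s≤6 (ι-mono {1} {6} (s≤s z≤n)) (grow (2 ℕ.+ N) (ℕ.m≤n+m N 2))))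
    between : (∃ λ s → q < s × s < r) → (∃ λ m → L (below m) q) ⊎ (∃ λ m → U (above m) r)
    between (s , q<s , s<r) with ι 6 ℚ.<? s
    ... | yes 6<s = inj₂ (0 , above-6 0 (ℚ.<-trans 6<s s<r))
    ... | no  6≮s = compare q<s s<r (ℚ.≮⇒≥ 6≮s) (outgrows (ι 6 ^ 3) (ℚ.≤-<-trans 0≤q q<s) s<r)

  limit : ℝ≥0
  limit = record
    { L        = λ q → ∃ λ m → L (below m) q
    ; U        = λ q → ∃ λ m → U (above m) q
    ; negative = λ q<0 → 0 , negative (below 0) q<0
    ; bounded  = ι 7 , 0 , above-6 0 (ι-mono-< {6} {7} ℕ.≤-refl)
    ; L-down   = λ q<r (m , l) → m , L-down (below m) q<r l
    ; L-open   = λ (m , l) → let (r , q<r , l′) = L-open (below m) l in r , q<r , m , l′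
    ; U-up     = λ q<r (m , u) → m , U-up (above m) q<r u
    ; U-open   = λ (m , u) → let (q , q<r , u′) = U-open (above m) u in q , q<r , m , u′
    ; disjoint = λ (m , l) (m′ , u) → below-above-disjoint m m′ l u
    ; located  = limit-located
    }

  sequence : ℕ → (n : ℕ) .{{_ : NonZero n}} → ℝ≥0
  sequence g n = sup (map (τ^1/ n) (𝒳 n 6 g))

  circulant-dense : ∀ m {r} → 0ℚ < r → r ^ (a m ℕ.* a m) < ι (A (2 ℕ.+ m)) →
    ∃ λ N → ∀ t → N ℕ.≤ t → ∃ λ (E : EdgeSet (a m ℕ.+ t)) → (∀ g → E ∈ 𝒳 (a m ℕ.+ t) 6 (suc g)) × r ^ (a m ℕ.+ t) < ι (τ E)
  circulant-dense m {r} 0<r r^M<A = suc (suc N ℕ.* M) , λ { (suc s) (s≤s le) → dense s le }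
    where
    M = a m ℕ.* a m
    -- Bounds `r ^ R` for every remainder that occurs; the base is 1 + r because `r` itself may be
    -- less than 1.
    C = (1ℚ + r) ^ (a m ℕ.+ suc M)
    0≤r = ℚ.<⇒≤ 0<r
    growth : ∃ λ N → ∀ k → N ℕ.≤ k → C * (r ^ M) ^ k < ι (A (2 ℕ.+ m)) ^ k
    growth = outgrows C (0<^ M 0<r) r^M<A
    N = proj₁ growth
    1≤1+r : 1ℚ ≤ 1ℚ + r
    1≤1+r = a≤a+b 0≤r
    r≤1+r : r ≤ 1ℚ + r
    r≤1+r = subst (_≤ 1ℚ + r) (ℚ.+-identityˡ r) (ℚ.+-monoˡ-≤ r 0≤1)
    dense : ∀ s → suc N ℕ.* M ℕ.≤ s → ∃ λ (E : EdgeSet (a m ℕ.+ suc s)) → (∀ g → E ∈ 𝒳 (a m ℕ.+ suc s) 6 (suc g)) × r ^ (a m ℕ.+ suc s) < ι (τ E)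
    dense s le = E , E∈ , (begin-strict
      r ^ (a m ℕ.+ suc s) ≡⟨ cong (r ^_) split ⟩
      r ^ (R ℕ.+ K ℕ.* M) ≡⟨ trans (^-+ r R (K ℕ.* M)) (cong (r ^ R *_) (^-* r K M)) ⟩
      r ^ R * (r ^ M) ^ K ≤⟨ *-monoʳ _ (0≤^ K (0≤^ M 0≤r)) (ℚ.≤-trans (^-mono-≤ R 0≤r r≤1+r) (^-monoʳ-≤ 1≤1+r (ℕ.+-monoʳ-≤ (a m) (s≤s (ℕ.<⇒≤ (ℕ.m%n<n s M)))))) ⟩
      C * (r ^ M) ^ K <⟨ proj₂ growth K (ℕ.<⇒≤ N<K) ⟩
      ι (A (2 ℕ.+ m)) ^ K ≡⟨ ι-^ (A (2 ℕ.+ m)) K ⟨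
      ι (A (2 ℕ.+ m) ℕ.^ K) ≡⟨ cong (λ k → ι (A (2 ℕ.+ m) ℕ.^ k)) suc-k≡K ⟨
      ι (A (2 ℕ.+ m) ℕ.^ suc k) ≤⟨ ι-mono (proj₂ (proj₂ G)) ⟩
      ι (τ E) ∎)
      where
      open ℚ.≤-Reasoning
      K = s ℕ./ M
      R = a m ℕ.+ suc (s ℕ.% M)
      N<K : N ℕ.< K
      N<K = subst (ℕ._≤ K) (ℕ.m*n/n≡m (suc N) M) (ℕ./-monoˡ-≤ M le)
      k = ℕ.pred K
      suc-k≡K : suc k ≡ K
      suc-k≡K = ℕ.suc-pred K {{ℕ.>-nonZero (ℕ.≤-<-trans z≤n N<K)}}
      split : a m ℕ.+ suc s ≡ R ℕ.+ K ℕ.* M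
      split = trans (cong (λ s → a m ℕ.+ suc s) (ℕ.m≡m%n+[m/n]*n s M)) (sym (ℕ.+-assoc (a m) (suc (s ℕ.% M)) (K ℕ.* M)))
      fit : suc k ℕ.* M ℕ.< suc s
      fit = s≤s (subst (λ k → k ℕ.* M ℕ.≤ s) (sym suc-k≡K) (ℕ.m/n*n≤m s M))
      G = many-trees m k (suc s) fit
      E = proj₁ G
      E∈ = proj₁ (proj₂ G)

-- Convergence of the suprema and comparison of the constants.

module Convergence where

  open Limits
  open Elimination
  open MatrixTree
  open LatticeFrames
  open BoxEstimate
  open Circulants
  open ManyTrees
  open FewTrees
  open Growth
  open Determinant using (D)
  open import Data.List.Base using (List; []; _∷_; map)
  open import Data.Nat.Base as ℕ using (ℕ; zero; suc; NonZero)
  import Data.Nat.DivMod as ℕ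
  import Data.Integer.Base as ℤ
  import Data.Nat.Solver
  open import Data.Rational.Base hiding (NonZero; negative)
  open import Algebra.Definitions.RawSemiring ℚ.+-*-rawSemiring using (_^_)
  open ℝ≥0

  eventually-below : ∀ g m {q} → L (below m) q → ∃ λ N → ∀ n .{{_ : NonZero n}} → N ℕ.≤ n → L (sequence (suc g) n) q
  eventually-below g m {q} l = split (0ℚ ℚ.≤? q)
    where
    above-q : 0ℚ ≤ q → (∃ λ r → q < r × L (below m) r) → ∃ λ N → ∀ n .{{_ : NonZero n}} → N ℕ.≤ n → L (sequence (suc g) n) q
    above-q 0≤q (r , q<r , l′) = graphs (circulant-dense m 0<r (l′ (ℚ.<⇒≤ 0<r)))
      where
      0<r : 0ℚ < r
      0<r = ℚ.≤-<-trans 0≤q q<r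
      transport : ∀ n .{{_ : NonZero n}} {n′} → n′ ≡ n → (∃ λ (E : EdgeSet n′) → (∀ g → E ∈ 𝒳 n′ 6 (suc g)) × r ^ n′ < ι (τ E)) → L (sequence (suc g) n) r
      transport n refl (E , E∈ , lt) = sup-L (τ^1/ n) {E} {𝒳 n 6 (suc g)} {r} (E∈ g) (λ _ → lt)
      graphs : (∃ λ N → ∀ t → N ℕ.≤ t → ∃ λ (E : EdgeSet (a m ℕ.+ t)) → (∀ g → E ∈ 𝒳 (a m ℕ.+ t) 6 (suc g)) × r ^ (a m ℕ.+ t) < ι (τ E)) →
               ∃ λ N → ∀ n .{{_ : NonZero n}} → N ℕ.≤ n → L (sequence (suc g) n) q
      graphs (N , dense) = a m ℕ.+ N , λ n le → L-down (sequence (suc g) n) q<r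
        (transport n (ℕ.m+[n∸m]≡n (ℕ.≤-trans (ℕ.m≤m+n (a m) N) le))
          (dense (n ℕ.∸ a m) (subst (ℕ._≤ n ℕ.∸ a m) (ℕ.m+n∸m≡n (a m) N) (ℕ.∸-monoˡ-≤ (a m) le))))

    split : Dec (0ℚ ≤ q) → ∃ λ N → ∀ n .{{_ : NonZero n}} → N ℕ.≤ n → L (sequence (suc g) n) q
    split (no 0≰q)  = 0 , λ n _ → negative (sequence (suc g) n) (ℚ.≰⇒> 0≰q)
    split (yes 0≤q) = above-q 0≤q (L-open (below m) l)

  take-root : ∀ {x C α S n q} → 0ℚ ≤ q → x ℕ.^ (S ℕ.* 6) ℕ.≤ C ℕ.* α ℕ.^ (n ℕ.* 6) →
    ι C * ι α ^ (n ℕ.* 6) < (q ^ S) ^ (n ℕ.* 6) → ι x < q ^ n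
  take-root {x} {C} {α} {S} {n} {q} 0≤q le lt = ^-cancel-< (S ℕ.* 6) (0≤^ n 0≤q) (begin-strict
    ι x ^ (S ℕ.* 6) ≡⟨ ι-^ x (S ℕ.* 6) ⟨
    ι (x ℕ.^ (S ℕ.* 6)) ≤⟨ ι-mono le ⟩
    ι (C ℕ.* α ℕ.^ (n ℕ.* 6)) ≡⟨ trans (ι-* C (α ℕ.^ (n ℕ.* 6))) (cong (ι C *_) (ι-^ α (n ℕ.* 6))) ⟩
    ι C * ι α ^ (n ℕ.* 6) <⟨ lt ⟩
    (q ^ S) ^ (n ℕ.* 6) ≡⟨ ^-^-comm q S (n ℕ.* 6) ⟩
    (q ^ (n ℕ.* 6)) ^ S ≡⟨ cong (_^ S) (trans (cong (q ^_) (ℕ.*-comm n 6)) (^-* q 6 n)) ⟩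
    ((q ^ n) ^ 6) ^ S ≡⟨ ^-* (q ^ n) S 6 ⟨
    (q ^ n) ^ (S ℕ.* 6) ∎)
    where open ℚ.≤-Reasoning

  eventually-above : ∀ g m {q} → U (above m) q → ∃ λ N → ∀ n .{{_ : NonZero n}} → N ℕ.≤ n → U (sequence g n) q
  eventually-above g m {q} (0<q , A<) = conclude (few-trees g m)
    where
    S : ℕ
    S = suc m ℕ.* suc m
    conclude : (∃ λ C → ∀ n (E : EdgeSet (suc n)) → E ∈ 𝒳 (suc n) 6 g → τ E ℕ.^ (S ℕ.* 6) ℕ.≤ C ℕ.* A (suc m) ℕ.^ (suc n ℕ.* 6)) →
               ∃ λ N → ∀ n .{{_ : NonZero n}} → N ℕ.≤ n → U (sequence g n) q
    conclude (C , few) = bound (outgrows (ι C) (0<ιA (suc m)) A<)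
      where
      bound : (∃ λ N → ∀ k → N ℕ.≤ k → ι C * ι (A (suc m)) ^ k < (q ^ S) ^ k) → ∃ λ N → ∀ n .{{_ : NonZero n}} → N ℕ.≤ n → U (sequence g n) q
      bound (N , grow) = N , λ { n@(suc n′) N≤n → sup-U (τ^1/ n) (𝒳 n 6 g) 0<q λ {E} E∈ → 0<q ,
        take-root {τ E} {C} {A (suc m)} {S} {n} {q} (ℚ.<⇒≤ 0<q) (few n′ E E∈) (grow (n ℕ.* 6) (ℕ.≤-trans N≤n (ℕ.m≤m*n n 6))) }

  convergence : ∀ g → sequence (suc g) ⟶ limit
  convergence g ε 0<ε =
    let (p , q , q-p<ε , (m , l) , (m′ , u)) = approximate limit ε 0<ε
        (N , lower) = eventually-below g m l
        (N′ , upper) = eventually-above (suc g) m′ u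
    in N ℕ.+ N′ , λ n le → p , q , q-p<ε ,
         (lower n (ℕ.≤-trans (ℕ.m≤m+n N N′) le) , upper n (ℕ.≤-trans (ℕ.m≤n+m N′ N) le)) , ((m , l) , (m′ , u))

  -- The Euler characteristic rules out 6-regular graphs on the sphere.
  sphere-empty : ∀ n .{{_ : NonZero n}} → 𝒳 n 6 0 ≡ []
  sphere-empty (suc n) = empty (𝒳 (suc n) 6 0) λ {E} E∈ → Upper.g≢0 0 E E∈ refl
    where
    empty : ∀ {A : Set} (xs : List A) → (∀ {x} → x ∈ xs → ⊥) → xs ≡ []
    empty []       none = refl
    empty (x ∷ xs) none = ⊥-elim (none (here refl))

  sphere-convergence : sequence 0 ⟶ 0ᴿ
  sphere-convergence ε 0<ε = let (p , q , q-p<ε , l , u) = approximate 0ᴿ ε 0<ε in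
    0 , λ n _ → p , q , q-p<ε ,
      subst (λ xs → L (sup (map (τ^1/ n) xs)) p × U (sup (map (τ^1/ n) xs)) q) (sym (sphere-empty n)) (l , u) , (l , u)

  -- An `r` in the lower cut of the limit cannot exceed 16 / 3, since the one box of `A-small` would
  -- place it in the upper cut. Locatedness of the right side turns this exclusion into membership.
  limit≤ : limit ≤ᴿ σ 3 ^ᴿ 2
  limit≤ {q} l = larger (L-open limit l)
    where
    c : ℚ
    c = ℤ.+ 16 / 3
    too-large : ∀ {r} → c < r → L limit r → (∃ λ m → 1 ℕ.≤ m × A m ℕ.* 3 ℕ.^ (m ℕ.* m) ℕ.≤ 16 ℕ.^ (m ℕ.* m)) → ⊥
    too-large {r} c<r l′ (suc m , _ , small) = disjoint limit l′ (m , ℚ.<-trans (ℚ.positive⁻¹ c) c<r , (begin-strict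
      ι (A (suc m)) ≤⟨ ℚ.*-cancelʳ-≤-pos (ι 3 ^ S) {{positive (0<ι^ 3 S)}} scaled ⟩
      c ^ S <⟨ ^-mono-< S (ℚ.nonNegative⁻¹ c) c<r ⟩
      r ^ S ∎))
      where
      open ℚ.≤-Reasoning
      S = suc m ℕ.* suc m
      scaled : ι (A (suc m)) * ι 3 ^ S ≤ c ^ S * ι 3 ^ S
      scaled = begin
        ι (A (suc m)) * ι 3 ^ S ≡⟨ trans (cong (ι (A (suc m)) *_) (sym (ι-^ 3 S))) (sym (ι-* (A (suc m)) (3 ℕ.^ S))) ⟩
        ι (A (suc m) ℕ.* 3 ℕ.^ S) ≤⟨ ι-mono small ⟩
        ι (16 ℕ.^ S) ≡⟨ ι-^ 16 S ⟩
        (c * ι 3) ^ S ≡⟨ *-^ c (ι 3) S ⟩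
        c ^ S * ι 3 ^ S ∎
    larger : (∃ λ r → q < r × L limit r) → L (σ 3 ^ᴿ 2) q
    larger (r , q<r , l′) = compare (located (σ 3 ^ᴿ 2) q<r)
      where
      compare : L (σ 3 ^ᴿ 2) q ⊎ U (σ 3 ^ᴿ 2) r → L (σ 3 ^ᴿ 2) q
      compare (inj₁ lσ) = lσ
      compare (inj₂ (b , (0<b , c<b²) , b²<r)) = ⊥-elim (too-large (ℚ.<-trans c<b² b²<r) l′ A-small)

  σ₃²<σ₆ : σ 3 ^ᴿ 2 <ᴿ σ 6
  -- 27 / 5 separates 16 / 3 from the square root of 5^10 / 24^4, and 231 / 100 lies between the
  -- square roots of 16 / 3 and 27 / 5.
  σ₃²<σ₆ = ℤ.+ 27 / 5 ,
    (ℤ.+ 231 / 100 , (from-yes (0ℚ ℚ.<? ℤ.+ 231 / 100) , from-yes (ℤ.+ 16 / 3 ℚ.<? (ℤ.+ 231 / 100) ^ 2)) , from-yes ((ℤ.+ 231 / 100) ^ 2 ℚ.<? ℤ.+ 27 / 5)) ,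
    λ _ → from-yes ((ℤ.+ 27 / 5) ^ 2 ℚ.<? ℤ.+ (5 ℕ.^ 10) / (24 ℕ.^ 4))

open Limits
open Convergence
open ℝ≥0 using (negative)

theorem4p1 : (g : ℕ) →
    (∃ λ (ℓ : ℝ≥0) →
    ((λ (n : ℕ) .{{_ : NonZero n}} → sup (map (τ^1/ n) (𝒳 n 6 g))) ⟶ ℓ)
    × (ℓ ≤ᴿ σ 3 ^ᴿ 2))
    × (σ 3 ^ᴿ 2 <ᴿ σ 6)
theorem4p1 zero    = (0ᴿ , sphere-convergence , negative (σ 3 ^ᴿ 2)) , σ₃²<σ₆
theorem4p1 (suc g) = (limit , convergence g , limit≤) , σ₃²<σ₆
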